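{- The problem $F_2||\sum_{J_j\in E} w_j$ (just-in-time flow-shop scheduling on two machines, in its decision version) is W[1]-hard when parameterized by the number $\#d$ of different due dates, even if all jobs have unit processing times on the second machine, i.e. even when restricted to instances with $p^{(2)}_j=1$ for all jobs $J_j$.
   Context: JIT flow-shop problem $F_m||\sum_{J_j\in E}w_j$: an instance consists of $n$ independent, non-preemptive jobs $\mathcal J=\{J_1,\dots,J_n\}$, all available at time $0$, and $m$ machines $M_1,\dots,M_m$. Job $J_j$ has a processing time $p^{(i)}_j$ on each machine $M_i$, a due date $d_j$ and a weight $w_j$; all these numbers are positive integers (encoded in binary). Every scheduled job must be processed first on $M_1$, then on $M_2$, and so on up to $M_m$; its processing on $M_i$ cannot start before its processing on $M_{i-1}$ is completed; each machine processes at most one job at a time; idle time and waiting between machines are allowed, and the processing orders on different machines may differ. A job is scheduled in JIT mode if its processing on $M_m$ is completed exactly at time $d_j$. A partition $\mathcal J=E\cup T$ is feasible if the jobs of $E$ can all be scheduled in JIT mode (jobs of $T$ are rejected and are not processed). The goal is to find a feasible partition maximizing $\sum_{J_j\in E}w_j$. In the decision version one is additionally given an integer $W$ and asks whether a feasible partition with $\sum_{J_j\in E}w_j\ge W$ exists. $\#d$ is the number of distinct values among the due dates $d_1,\dots,d_n$. A problem is fixed-parameter tractable (FPT) with respect to a parameter $k$ if every instance $I$ can be solved in $f(k)\cdot|I|^{O(1)}$ time for a computable function $f$ depending only on $k$. A decision problem $\pi$ is W[1]-hard with respect to $k$ if $\pi$ being FPT with respect to $k$ implies that all problems in the class W[1]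 are FPT. W[1]-hardness is transferred by parameterized reductions: a parameterized reduction from $\pi_2$ to $\pi_1$ is an algorithm mapping an instance $I_2$ of $\pi_2$ with parameter $k_2$ to an instance $I_1$ of $\pi_1$ with parameter $k_1$ in time $f(k_2)|I_2|^{O(1)}$, such that $k_1\le f(k_2)$ and $I_1$ is a yes-instance iff $I_2$ is a yes-instance. -}

module Defs where

open import Data.Bool.Base using (Bool; true; false)
import Data.Bool.Base as Bool
open import Data.Bool.ListAction using (and; or)
open import Data.Fin.Base using (Fin; zero; suc; toℕ)
open import Data.Fin.Subset using (Subset; ∣_∣; _∈_)
open import Data.Fin.Subset.Properties using (_∈?_)
open import Data.Integer.Base using (ℤ; +_; -[1+_])
import Data.Integer.Base as ℤ
open import Data.List.Base using (List; []; _∷_; map; length; foldr; filter; deduplicate; allFin)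
open import Data.Nat.Base using (ℕ; zero; suc; _+_; _*_; _^_; _⊔_; _≤_; _<_)
open import Data.Nat.Binary.Base using (ℕᵇ; 2[1+_]; 1+[2_]; fromℕ)
open import Data.Nat.ListAction using (sum)
open import Data.Nat.Properties using (_≟_; _≤?_)
open import Data.Product.Base using (Σ; ∃-syntax; _×_; proj₁)
open import Data.Sum.Base using (_⊎_)
open import Data.Vec.Base using (Vec; []; _∷_; lookup; replicate)
open import Function.Base using (_∘_)
open import Function.Bundles using (_⇔_)
open import Relation.Binary.PropositionalEquality using (_≡_; _≢_)
open import Relation.Nullary.Decidable using (Dec; does)

infixr 5 _∙_

data Tree : Set where
  nil : Tree
  _∙_ : Tree → Tree → Tree

size : Tree → ℕ
size nil     = 1
size (a ∙ b) = suc (size a + size b)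

-- The machine model is a point-free form of Jones's WHILE language on binary
-- trees: a program denotes a partial function on trees.
infixr 4 _⨾_

data Prog : Set where
  idᵖ nilᵖ hdᵖ tlᵖ : Prog
  ⟨_,_⟩            : Prog → Prog → Prog
  _⨾_              : Prog → Prog → Prog
  ifᵖ              : (test yes no : Prog) → Prog
  whileᵖ           : (test body : Prog) → Prog

hd tl : Tree → Tree
hd nil     = nil
hd (a ∙ _) = a
tl nil     = nil
tl (_ ∙ b) = b

-- p ⊢ x ⇓ y [ t ]: on input x, program p halts with output y after time t.
-- A basic operation is charged the size of its argument rather than 1, so the
-- time is never smaller than the size of the input or of the output, and no
-- exponentially large tree can be built by sharing.  Time is thereby
-- polynomially related to Turing machine time.
infix 3 _⊢_⇓_[_]

data _⊢_⇓_[_] : Prog → Tree → Tree → ℕ → Set where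
  ⇓id    : ∀ {x} → idᵖ  ⊢ x ⇓ x    [ size x ]
  ⇓nil   : ∀ {x} → nilᵖ ⊢ x ⇓ nil  [ size x ]
  ⇓hd    : ∀ {x} → hdᵖ  ⊢ x ⇓ hd x [ size x ]
  ⇓tl    : ∀ {x} → tlᵖ  ⊢ x ⇓ tl x [ size x ]
  ⇓pair  : ∀ {p q x y z s t} →
           p ⊢ x ⇓ y [ s ] → q ⊢ x ⇓ z [ t ] →
           ⟨ p , q ⟩ ⊢ x ⇓ y ∙ z [ suc (s + t) ]
  ⇓seq   : ∀ {p q x y z s t} →
           p ⊢ x ⇓ y [ s ] → q ⊢ y ⇓ z [ t ] →
           p ⨾ q ⊢ x ⇓ z [ suc (s + t) ]
  ⇓yes   : ∀ {b p q x u v y s t} →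
           b ⊢ x ⇓ u ∙ v [ s ] → p ⊢ x ⇓ y [ t ] →
           ifᵖ b p q ⊢ x ⇓ y [ suc (s + t) ]
  ⇓no    : ∀ {b p q x y s t} →
           b ⊢ x ⇓ nil [ s ] → q ⊢ x ⇓ y [ t ] →
           ifᵖ b p q ⊢ x ⇓ y [ suc (s + t) ]
  ⇓stop  : ∀ {b p x s} →
           b ⊢ x ⇓ nil [ s ] →
           whileᵖ b p ⊢ x ⇓ x [ suc s ]
  ⇓again : ∀ {b p x u v y z r s t} →
           b ⊢ x ⇓ u ∙ v [ r ] → p ⊢ x ⇓ y [ s ] → whileᵖ b p ⊢ y ⇓ z [ t ] →
           whileᵖ b p ⊢ x ⇓ z [ suc (r + s + t) ]

encodeBool : Bool → Tree
encodeBool false = nil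
encodeBool true  = nil ∙ nil

encodeᵇ : ℕᵇ → Tree
encodeᵇ ℕᵇ.zero  = nil
encodeᵇ 2[1+ n ] = encodeBool false ∙ encodeᵇ n
encodeᵇ 1+[2 n ] = encodeBool true ∙ encodeᵇ n

-- Numbers are written in (bijective) binary.
encodeℕ : ℕ → Tree
encodeℕ = encodeᵇ ∘ fromℕ

encodeℤ : ℤ → Tree
encodeℤ (+ n)    = encodeBool true ∙ encodeℕ n
encodeℤ -[1+ n ] = encodeBool false ∙ encodeℕ n

encodeList : ∀ {A : Set} → (A → Tree) → List A → Tree
encodeList code []       = nil
encodeList code (x ∷ xs) = code x ∙ encodeList code xs

encodeVec : ∀ {A : Set} {n} → (A → Tree) → Vec A n → Tree
encodeVec code []       = nil
encodeVec code (x ∷ xs) = code x ∙ encodeVec code xs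

Computable : (ℕ → ℕ) → Set
Computable f = ∃[ p ] ∀ n → ∃[ t ] (p ⊢ encodeℕ n ⇓ encodeℕ (f n) [ t ])

-- Algorithms for a problem only have to be correct on codes of instances.
record ParamProblem : Set₁ where
  field
    Instance : Set
    code     : Instance → Tree
    param    : Instance → ℕ
    Yes      : Instance → Set

  ∥_∥ : Instance → ℕ
  ∥ I ∥ = size (code I)

open ParamProblem

restrict : (P : ParamProblem) → (Instance P → Set) → ParamProblem
restrict P R = record
  { Instance = Σ (Instance P) R
  ; code     = code P ∘ proj₁
  ; param    = param P ∘ proj₁
  ; Yes      = Yes P ∘ proj₁
  }

FPT : ParamProblem → Set
FPT P =
  ∃[ p ] ∃[ f ] ∃[ c ] Computable f ×
    (∀ I → Σ (Dec (Yes P I)) λ answer → ∃[ t ]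
      (p ⊢ code P I ⇓ encodeBool (does answer) [ t ]) ×
      t ≤ f (param P I) * ∥_∥ P I ^ c)

infix 4 _≤fpt_

_≤fpt_ : ParamProblem → ParamProblem → Set
P ≤fpt Q =
  ∃[ p ] ∃[ f ] ∃[ c ] Computable f ×
    (∀ I → ∃[ J ] ∃[ t ]
      (p ⊢ code P I ⇓ code Q J [ t ]) ×
      t ≤ f (param P I) * ∥_∥ P I ^ c ×
      param Q J ≤ f (param P I) ×
      (Yes Q J ⇔ Yes P I))

data Gate (W : Set) : Set where
  notᵍ       : W → Gate W
  andᵍ orᵍ   : List W → Gate W

mapGate : ∀ {V W : Set} → (V → W) → Gate V → Gate W
mapGate f (notᵍ w)  = notᵍ (f w)
mapGate f (andᵍ ws) = andᵍ (map f ws)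
mapGate f (orᵍ ws)  = orᵍ (map f ws)

operands : ∀ {W : Set} → Gate W → List W
operands (notᵍ w)  = w ∷ []
operands (andᵍ ws) = ws
operands (orᵍ ws)  = ws

-- A circuit with n inputs and m nodes, in topological order.  Nodes are de
-- Bruijn indices: the most recently added gate is node zero, and the n inputs
-- come last.
infixl 5 _▷_

data Circuit (n : ℕ) : ℕ → Set where
  inputs : Circuit n n
  _▷_    : ∀ {m} → Circuit n m → Gate (Fin m) → Circuit n (suc m)

nodeValues : ∀ {A : Set} {n m} → (Gate A → A) → Vec A n → Circuit n m → Vec A m
nodeValues alg xs inputs  = xs
nodeValues alg xs (C ▷ g) =
  let vs = nodeValues alg xs C in alg (mapGate (lookup vs) g) ∷ vs

evalGate : Gate Bool → Bool
evalGate (notᵍ b)  = Bool.not b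
evalGate (andᵍ bs) = and bs
evalGate (orᵍ bs)  = or bs

maximum : List ℕ → ℕ
maximum = foldr _⊔_ 0

isLarge : ∀ {W : Set} → Gate W → Bool
isLarge g = does (3 ≤? length (operands g))

evaluate : ∀ {n m} → Circuit n m → Subset n → Fin m → Bool
evaluate C S = lookup (nodeValues evalGate S C)

-- depth (resp. weft) of a node: the largest number of gates (resp. of gates of
-- fan-in larger than two) on a path ending in that node.
depth : ∀ {n m} → Circuit n m → Fin m → ℕ
depth C = lookup (nodeValues (λ g → suc (maximum (operands g))) (replicate _ 0) C)

weft : ∀ {n m} → Circuit n m → Fin m → ℕ
weft C = lookup (nodeValues step (replicate _ 0) C)
  where
  step : Gate ℕ → ℕ
  step g = (Bool.if isLarge g then 1 else 0) + maximum (operands g)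

-- Nodes are referred to in unary, which is harmless as a circuit is given by
-- the list of all its nodes.
encodeFin : ∀ {m} → Fin m → Tree
encodeFin zero    = nil
encodeFin (suc i) = nil ∙ encodeFin i

encodeGate : ∀ {m} → Gate (Fin m) → Tree
encodeGate (notᵍ i)  = nil ∙ encodeFin i
encodeGate (andᵍ is) = (nil ∙ nil) ∙ encodeList encodeFin is
encodeGate (orᵍ is)  = (nil ∙ nil ∙ nil) ∙ encodeList encodeFin is

encodeCircuit : ∀ {n m} → Circuit n m → Tree
encodeCircuit {n} inputs = encodeVec (λ x → x) (replicate n nil)
encodeCircuit (C ▷ g)    = encodeGate g ∙ encodeCircuit C

record WeightedCircuit (t d : ℕ) : Set where
  field
    #inputs #nodes : ℕ
    circuit        : Circuit #inputs #nodes
    output         : Fin #nodes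
    weight         : ℕ
    weft≤          : weft circuit output ≤ t
    depth≤         : depth circuit output ≤ d

WeightedCircuitSat : (t d : ℕ) → ParamProblem
WeightedCircuitSat t d = record
  { Instance = WeightedCircuit t d
  ; code     = λ I → let open WeightedCircuit I in
                 encodeCircuit circuit ∙ encodeFin output ∙ encodeℕ weight
  ; param    = WeightedCircuit.weight
  ; Yes      = λ I → let open WeightedCircuit I in
                 ∃[ S ] ∣ S ∣ ≡ weight × evaluate circuit S output ≡ true
  }

W[_] : ℕ → ParamProblem → Set
W[ t ] P = ∃[ d ] P ≤fpt WeightedCircuitSat t d

W[1]-hard : ParamProblem → Set₁
W[1]-hard P = FPT P → ∀ Q → W[ 1 ] Q → FPT Q

record Job (m : ℕ) : Set where
  field
    processing   : Vec ℕ m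
    due          : ℕ
    weight       : ℕ
    processing>0 : ∀ i → 0 < lookup processing i
    due>0        : 0 < due
    weight>0     : 0 < weight

record FlowShop (m : ℕ) : Set where
  field
    #jobs  : ℕ
    jobs   : Vec (Job m) #jobs
    target : ℤ

  job : Fin #jobs → Job m
  job = lookup jobs

  -- p j i is the processing time of job j on machine i.
  p : Fin #jobs → Fin m → ℕ
  p j = lookup (Job.processing (job j))

  d w : Fin #jobs → ℕ
  d j = Job.due (job j)
  w j = Job.weight (job j)

  -- Start times are integral, which loses nothing: all data are integers, so
  -- rounding all start times down preserves feasibility and the JIT condition.
  -- The start times of rejected jobs are unconstrained dummies.
  record JITSchedule (E : Subset #jobs) : Set where
    field
      start : Fin #jobs → Fin m → ℕ

    completion : Fin #jobs → Fin m → ℕ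
    completion j i = start j i + p j i

    field
      route    : ∀ {j} → j ∈ E → ∀ {i i′} → toℕ i′ ≡ suc (toℕ i) →
                 completion j i ≤ start j i′
      capacity : ∀ {j j′} → j ∈ E → j′ ∈ E → j ≢ j′ → ∀ i →
                 completion j i ≤ start j′ i ⊎ completion j′ i ≤ start j i
      jit      : ∀ {j} → j ∈ E → ∀ {i} → suc (toℕ i) ≡ m →
                 completion j i ≡ d j

  totalWeight : Subset #jobs → ℕ
  totalWeight E = sum (map w (filter (_∈? E) (allFin #jobs)))

  #dueDates : ℕ
  #dueDates = length (deduplicate _≟_ (map d (allFin #jobs)))

encodeJob : ∀ {m} → Job m → Tree
encodeJob J = encodeVec encodeℕ processing ∙ encodeℕ due ∙ encodeℕ weight
  where open Job J

JITFlowShop : ℕ → ParamProblem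
JITFlowShop m = record
  { Instance = FlowShop m
  ; code     = λ I → let open FlowShop I in encodeVec encodeJob jobs ∙ encodeℤ target
  ; param    = FlowShop.#dueDates
  ; Yes      = λ I → let open FlowShop I in
                 ∃[ E ] JITSchedule E × target ℤ.≤ + totalWeight E
  }

UnitOnSecondMachine : FlowShop 2 → Set
UnitOnSecondMachine I = ∀ j → p j (suc zero) ≡ 1
  where open FlowShop I

{-# OPTIONS --safe #-}

-- An oracle for the flow shop decides weighted satisfiability of circuits of
-- weft 1 and depth d.  A node without large gates depends on boundedly many
-- inputs, so its value is a polynomial of degree q = 2 ^ d in the inputs.
-- Expanding the gates above the large ones, and large disjunctions, gives a
-- disjunctive normal form of polynomial length.  The number of false literals of
-- a conjunction is again such a polynomial, so a set of k inputs satisfies the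
-- circuit if and only if one of polynomially many polynomials vanishes there.
-- The oracle is called for each of them.
--
-- The k chosen inputs fill slots.  A polynomial is evaluated by summing the
-- coefficients of the monomials found in all tuples of q slots.  To say that it
-- vanishes, choose for every slot the distance to the previous chosen input and
-- for every tuple of slots a monomial, subject to linear equations: the monomials
-- agree with the slots, and their coefficients have the right sum.  Read as the
-- digits of large numbers, the equations become a single one, Σ x = T, in which
-- one number x is chosen from each class.
--
-- In the flow shop, a class becomes a due date slightly above T, and a number x
-- becomes a job of weight x with processing time x on the first machine.  The
-- first machine yields Σ x ≤ T, the target weight Σ x ≥ T, and further digits
-- force one job from each class.  There are k + (k + 1) ^ q due dates.

module Submission where

open import Defs
open import Data.Bool.Base using (Bool; true; false; if_then_else_; not; _∧_; _∨_; _xor_; T)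
open import Data.Bool.ListAction using (and; or)
open import Data.Bool.Properties using (∧-identityʳ; ∨-zeroʳ; not-involutive; xor-assoc)
open import Data.Empty using (⊥-elim)
open import Data.Fin.Base using (Fin; zero; suc; toℕ)
open import Data.Fin.Subset using (Subset; ∣_∣) renaming (_∈_ to _∈ˢ_)
open import Data.Fin.Subset.Properties using (_∈?_)
import Data.Integer.Base as ℤ
import Data.Integer.Properties as ℤ
open import Data.List.Base
  using (List; []; _∷_; [_]; _++_; map; length; foldr; foldl; reverse; replicate; concatMap; drop; downFrom;
         filter; allFin; tabulate; zipWith; cartesianProduct)
open import Data.List.Properties
  using (reverse-foldl; unfold-reverse; length-++; length-reverse; length-replicate; length-map; length-zipWith;
         length-filter; length-downFrom; map-tabulate; map-id; map-∘; map-++; ++-is-foldr; ∷-injective)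
open import Data.List.Membership.Propositional using (_∈_)
open import Data.List.Membership.Propositional.Properties
  using (∈-map⁺; ∈-map⁻; ∈-deduplicate⁻; ∈-∃++; ∈-++⁻; ∈-++⁺ˡ; ∈-++⁺ʳ; ∈-cartesianProduct⁺; ∈-cartesianProduct⁻;
         ∈-downFrom⁺; ∈-downFrom⁻)
open import Data.List.Relation.Binary.Pointwise using (Pointwise; []; _∷_)
import Data.List.Relation.Binary.Pointwise as Pointwise
open import Data.List.Relation.Binary.Sublist.Propositional using (_⊆_; []; _∷_; _∷ʳ_; from∈; to∈)
import Data.List.Relation.Binary.Sublist.Propositional.Properties as Sublist
open import Data.List.Relation.Unary.All using (All; []; _∷_)
import Data.List.Relation.Unary.All as All
import Data.List.Relation.Unary.All.Properties as All
open import Data.List.Relation.Unary.AllPairs using (AllPairs; []; _∷_)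
import Data.List.Relation.Unary.AllPairs as AllPairs
import Data.List.Relation.Unary.AllPairs.Properties as AllPairs
open import Data.List.Relation.Unary.Any using (Any; here; there)
import Data.List.Relation.Unary.Any as Any
import Data.List.Relation.Unary.Any.Properties as Any
open import Data.List.Relation.Unary.Unique.Propositional using (Unique)
import Data.List.Relation.Unary.Unique.Propositional.Properties as Unique
open import Data.Maybe.Base using (Maybe; just; nothing)
open import Data.Nat.Base
open import Data.Nat.Binary.Base using (ℕᵇ; 2[1+_]; 1+[2_])
import Data.Nat.Binary.Base as ℕᵇ
open import Data.Nat.Binary.Properties using (toℕ-fromℕ; fromℕ-toℕ)
open import Data.Nat.GeneralisedArithmetic using (fold)
open import Data.Nat.ListAction using (sum)
open import Data.Nat.ListAction.Properties using (sum-++)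
open import Data.Nat.Properties
open import Data.List.Relation.Unary.Unique.DecPropositional.Properties _≟_ using (deduplicate-!)
open import Data.Nat.Tactic.RingSolver using (solve-∀)
open import Data.Product.Base using (Σ; ∃-syntax; _×_; _,_; proj₁; proj₂)
open import Data.Sum.Base using (_⊎_; inj₁; inj₂)
open import Data.Unit.Base using (⊤; tt)
open import Data.Vec.Base using (Vec; []; _∷_; lookup; fromList; here; there)
import Data.Vec.Base as Vec
open import Function.Base using (_∘_; id)
open import Function.Bundles using (Equivalence)
open import Relation.Binary.Definitions using (tri<; tri≈; tri>)
open import Relation.Binary.PropositionalEquality hiding ([_])
open import Relation.Nullary using (¬_; contradiction)
open import Relation.Nullary.Decidable using (Dec; yes; no; does; map′; ¬?)
open import Relation.Unary using (Decidable)

-- `W[1]-hard` asks for nothing but a transfer of `FPT`, so the algorithm for the flow shop may be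
-- called once per polynomial, and the polynomials need not be merged into one instance.
--
-- Digits can only be added, so every equation avoids subtraction: a monomial with coefficient -1 is
-- counted at all tuples of slots that differ from it, which shifts the total by a known amount, and
-- agreement of a slot with a leaf of a monomial becomes slot + (n - leaf) = n. Gaps are chosen
-- rather than inputs because positive gaps make the chosen inputs distinct, while a slot remains
-- linear in the choices. Slot 0 holds the number 0, read as the constant true; monomials of lower
-- degree are padded with it. As slots are distinct, a true monomial is found in exactly one tuple,
-- and summing over tuples needs no correction for multiplicity.
--
-- Two obstacles concern time. The function in an `FPT` bound is computable but perhaps not
-- monotone, so a sum over all smaller arguments replaces it. The weight k is written in binary
-- whereas the programs are polynomial in k, so the cost of unary notation is charged to the
-- parameter.

private variable
  X Y : Set

open ParamProblem

-- Types of data and their encodings as trees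

infixr 5 _⊗_

-- `nat` and `bin` have the same values and differ only in the encoding, so the cost of one function
-- can be measured in either. In `gate`, `nothing` is an input of a circuit.
data Ty : Set where
  unit nat bool bin gate : Ty
  _⊗_                    : Ty → Ty → Ty
  list                   : Ty → Ty

⟦_⟧ : Ty → Set
⟦ unit ⟧   = ⊤
⟦ nat ⟧    = ℕ
⟦ bool ⟧   = Bool
⟦ bin ⟧    = ℕ
⟦ gate ⟧   = Maybe (Gate ℕ)
⟦ A ⊗ B ⟧  = ⟦ A ⟧ × ⟦ B ⟧
⟦ list A ⟧ = List ⟦ A ⟧

unary : ℕ → Tree
unary zero    = nil
unary (suc n) = nil ∙ unary n

encGate : Maybe (Gate ℕ) → Tree
encGate nothing          = nil
encGate (just (notᵍ i))  = nil ∙ unary i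
encGate (just (andᵍ is)) = (nil ∙ nil) ∙ encodeList unary is
encGate (just (orᵍ is))  = (nil ∙ nil ∙ nil) ∙ encodeList unary is

enc : (A : Ty) → ⟦ A ⟧ → Tree
enc unit _          = nil
enc nat n           = unary n
enc bool b          = encodeBool b
enc bin n           = encodeℕ n
enc gate g          = encGate g
enc (A ⊗ B) (x , y) = enc A x ∙ enc B y
enc (list A) xs     = encodeList (enc A) xs

siz : (A : Ty) → ⟦ A ⟧ → ℕ
siz A x = size (enc A x)

size>0 : ∀ x → 1 ≤ size x
size>0 nil     = ≤-refl
size>0 (_ ∙ _) = s≤s z≤n

in≤time : ∀ {p x y t} → p ⊢ x ⇓ y [ t ] → size x ≤ t
in≤time ⇓id = ≤-refl
in≤time ⇓nil = ≤-refl
in≤time ⇓hd = ≤-refl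
in≤time ⇓tl = ≤-refl
in≤time (⇓pair r _) = m≤n⇒m≤1+n (≤-trans (in≤time r) (m≤m+n _ _))
in≤time (⇓seq r _) = m≤n⇒m≤1+n (≤-trans (in≤time r) (m≤m+n _ _))
in≤time (⇓yes r _) = m≤n⇒m≤1+n (≤-trans (in≤time r) (m≤m+n _ _))
in≤time (⇓no r _) = m≤n⇒m≤1+n (≤-trans (in≤time r) (m≤m+n _ _))
in≤time (⇓stop r) = m≤n⇒m≤1+n (in≤time r)
in≤time (⇓again r _ _) = m≤n⇒m≤1+n (≤-trans (in≤time r) (≤-trans (m≤m+n _ _) (m≤m+n _ _)))

size-hd : ∀ x → size (hd x) ≤ size x
size-hd nil     = ≤-refl
size-hd (a ∙ b) = m≤n⇒m≤1+n (m≤m+n _ _)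

size-tl : ∀ x → size (tl x) ≤ size x
size-tl nil     = ≤-refl
size-tl (a ∙ b) = m≤n⇒m≤1+n (m≤n+m _ _)

-- A bound on the time is thereby a bound on the size of the output, which is what composition
-- needs. `in≤time` enters for a loop that stops at once and returns its input.
out≤time : ∀ {p x y t} → p ⊢ x ⇓ y [ t ] → size y ≤ t
out≤time ⇓id = ≤-refl
out≤time ⇓nil = size>0 _
out≤time (⇓hd {x}) = size-hd x
out≤time (⇓tl {x}) = size-tl x
out≤time (⇓pair r s) = s≤s (+-mono-≤ (out≤time r) (out≤time s))
out≤time (⇓seq _ r) = m≤n⇒m≤1+n (≤-trans (out≤time r) (m≤n+m _ _))
out≤time (⇓yes _ r) = m≤n⇒m≤1+n (≤-trans (out≤time r) (m≤n+m _ _))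
out≤time (⇓no _ r) = m≤n⇒m≤1+n (≤-trans (out≤time r) (m≤n+m _ _))
out≤time (⇓stop r) = m≤n⇒m≤1+n (in≤time r)
out≤time (⇓again _ _ r) = m≤n⇒m≤1+n (≤-trans (out≤time r) (m≤n+m _ _))

-- Polynomially bounded functions

record PB (A : Ty) (t : ⟦ A ⟧ → ℕ) : Set where
  no-eta-equality
  pattern
  constructor _,_
  field
    deg : ℕ
    bnd : ∀ x → t x ≤ suc (siz A x) ^ deg

open PB public

^-mono : ∀ {a b c d} → 1 ≤ a → a ≤ b → c ≤ d → a ^ c ≤ b ^ d
^-mono {suc a} {b} {c} {d} _ a≤b c≤d = ≤-trans (^-monoʳ-≤ (suc a) c≤d) (^-monoˡ-≤ d a≤b)

n<2^n : ∀ n → n < 2 ^ n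
n<2^n zero    = s≤s z≤n
n<2^n (suc n) = ≤-trans (≤-reflexive (+-comm 1 (suc n)))
  (+-mono-≤ (n<2^n n) (≤-trans (m^n>0 2 n) (≤-reflexive (sym (+-identityʳ _)))))

n≤2^n : ∀ n → n ≤ 2 ^ n
n≤2^n n = <⇒≤ (n<2^n n)

module _ {A : Ty} where

  private
    b : ⟦ A ⟧ → ℕ
    b x = suc (siz A x)

    2≤b : ∀ x → 2 ≤ b x
    2≤b x = s≤s (size>0 _)

  pb-≤ : ∀ {s t : ⟦ A ⟧ → ℕ} → (∀ x → s x ≤ t x) → PB A t → PB A s
  pb-≤ s≤t (c , p) = c , λ x → ≤-trans (s≤t x) (p x)

  pb-size : PB A (siz A)
  pb-size = 1 , λ x → ≤-trans (n≤1+n _) (≤-reflexive (sym (*-identityʳ _)))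

  -- The base of the power is at least 2, so constants and sums are absorbed by the exponent, and a
  -- single number suffices to describe a polynomial bound.
  pb-const : ∀ n → PB A (λ _ → n)
  pb-const n = n , λ x → ≤-trans (n≤2^n n) (^-monoˡ-≤ n (2≤b x))

  pb-* : ∀ {s t : ⟦ A ⟧ → ℕ} → PB A s → PB A t → PB A (λ x → s x * t x)
  pb-* (c , p) (d , q) = c + d , λ x →
    ≤-trans (*-mono-≤ (p x) (q x)) (≤-reflexive (sym (^-distribˡ-+-* (b x) c d)))

  pb-+ : ∀ {s t : ⟦ A ⟧ → ℕ} → PB A s → PB A t → PB A (λ x → s x + t x)
  pb-+ (c , p) (d , q) = suc (c + d) , λ x →
    let m  = ^-mono {b x} {b x} {0} {c} (s≤s z≤n) ≤-refl z≤n
        le : ∀ e → e ≤ c + d → b x ^ e ≤ b x ^ (c + d)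
        le e h = ^-mono (s≤s z≤n) ≤-refl h
    in ≤-trans (+-mono-≤ (≤-trans (p x) (le c (m≤m+n c d))) (≤-trans (q x) (le d (m≤n+m d c))))
       (≤-trans (≤-reflexive (cong (b x ^ (c + d) +_) (sym (+-identityʳ _))))
         (*-monoˡ-≤ (b x ^ (c + d)) (2≤b x)))

  pb-suc : ∀ {t : ⟦ A ⟧ → ℕ} → PB A t → PB A (λ x → suc (t x))
  pb-suc p = pb-+ (pb-const 1) p

  pb-^ : ∀ {t : ⟦ A ⟧ → ℕ} n → PB A t → PB A (λ x → t x ^ n)
  pb-^ n (c , p) = c * n , λ x →
    ≤-trans (^-monoˡ-≤ n (p x)) (≤-reflexive (^-*-assoc (b x) c n))

  pb-∘ : ∀ {B} {f : ⟦ A ⟧ → ⟦ B ⟧} {t : ⟦ B ⟧ → ℕ} →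
         PB B t → PB A (λ x → siz B (f x)) → PB A (λ x → t (f x))
  pb-∘ (c , p) q = pb-≤ (λ x → p _) (pb-^ c (pb-suc q))

-- Computable functions and their cost

infix 3 _⇀_

record _⇀_ (A B : Ty) : Set where
  no-eta-equality
  field
    fun  : ⟦ A ⟧ → ⟦ B ⟧
    prog : Prog
    time : ⟦ A ⟧ → ℕ
    run  : ∀ x → prog ⊢ enc A x ⇓ enc B (fun x) [ time x ]

open _⇀_ public

private variable
  A B C Γ : Ty

Poly : A ⇀ B → Set
Poly {A} f = PB A (time f)

poly-size : (f : A ⇀ B) → Poly f → PB A (λ x → siz B (fun f x))
poly-size f = pb-≤ (λ x → out≤time (run f x))

idᶜ : A ⇀ A
idᶜ {A} = record { fun = id ; prog = idᵖ ; time = siz A ; run = λ _ → ⇓id }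

castᶜ : (g : ⟦ A ⟧ → ⟦ B ⟧) → (∀ x → enc A x ≡ enc B (g x)) → A ⇀ B
castᶜ {A} g e = record
  { fun = g ; prog = idᵖ ; time = siz A
  ; run = λ x → subst (λ y → idᵖ ⊢ _ ⇓ y [ _ ]) (e x) ⇓id }

hdᶜ : (g : ⟦ A ⟧ → ⟦ B ⟧) → (∀ x → hd (enc A x) ≡ enc B (g x)) → A ⇀ B
hdᶜ {A} g e = record
  { fun = g ; prog = hdᵖ ; time = siz A
  ; run = λ x → subst (λ y → hdᵖ ⊢ _ ⇓ y [ _ ]) (e x) ⇓hd }

tlᶜ : (g : ⟦ A ⟧ → ⟦ B ⟧) → (∀ x → tl (enc A x) ≡ enc B (g x)) → A ⇀ B
tlᶜ {A} g e = record
  { fun = g ; prog = tlᵖ ; time = siz A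
  ; run = λ x → subst (λ y → tlᵖ ⊢ _ ⇓ y [ _ ]) (e x) ⇓tl }

infixr 9 _∘ᶜ_

_∘ᶜ_ : B ⇀ C → A ⇀ B → A ⇀ C
g ∘ᶜ f = record
  { fun  = λ x → fun g (fun f x)
  ; prog = prog f ⨾ prog g
  ; time = λ x → suc (time f x + time g (fun f x))
  ; run  = λ x → ⇓seq (run f x) (run g (fun f x)) }

pairᶜ : Γ ⇀ A → Γ ⇀ B → Γ ⇀ A ⊗ B
pairᶜ f g = record
  { fun  = λ x → fun f x , fun g x
  ; prog = ⟨ prog f , prog g ⟩
  ; time = λ x → suc (time f x + time g x)
  ; run  = λ x → ⇓pair (run f x) (run g x) }

treeᵖ : Tree → Prog
treeᵖ nil     = nilᵖ
treeᵖ (a ∙ b) = ⟨ treeᵖ a , treeᵖ b ⟩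

treeTime : Tree → ℕ → ℕ
treeTime nil     s = s
treeTime (a ∙ b) s = suc (treeTime a s + treeTime b s)

treeRun : ∀ y x → treeᵖ y ⊢ x ⇓ y [ treeTime y (size x) ]
treeRun nil     x = ⇓nil
treeRun (a ∙ b) x = ⇓pair (treeRun a x) (treeRun b x)

treeTime≤ : ∀ y s → treeTime y s ≤ size y * suc s
treeTime≤ nil     s = ≤-trans (n≤1+n s) (m≤m+n _ 0)
treeTime≤ (a ∙ b) s = +-mono-≤ {1} {suc s} (s≤s z≤n)
  (≤-trans (+-mono-≤ (treeTime≤ a s) (treeTime≤ b s))
    (≤-reflexive (sym (*-distribʳ-+ (suc s) (size a) (size b)))))

constᶜ : ⟦ B ⟧ → A ⇀ B
constᶜ {B} {A} y = record
  { fun = λ _ → y ; prog = treeᵖ (enc B y) ; time = λ x → treeTime (enc B y) (siz A x)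
  ; run = λ x → treeRun (enc B y) (enc A x) }

asᶜ : (f : A ⇀ B) (g : ⟦ A ⟧ → ⟦ B ⟧) → (∀ x → fun f x ≡ g x) → A ⇀ B
asᶜ {A} {B} f g e = record
  { fun = g ; prog = prog f ; time = time f
  ; run = λ x → subst (λ y → prog f ⊢ enc A x ⇓ enc B y [ time f x ]) (e x) (run f x) }

elimList : ∀ {X Y : Set} → List X → Y → (X × List X → Y) → Y
elimList []       n c = n
elimList (x ∷ xs) n c = c (x , xs)

matchᶜ : Γ ⇀ list A → Γ ⇀ B → Γ ⊗ (A ⊗ list A) ⇀ B → Γ ⇀ B
matchᶜ {Γ} {A} {B} e n c = record
  { fun  = λ γ → elimList (fun e γ) (fun n γ) (λ z → fun c (γ , z))
  ; prog = q
  ; time = λ γ → suc (time e γ + tm γ (fun e γ))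
  ; run  = rn }
  where
  q : Prog
  -- A test discards its value, so the branch computes the list again.
  q = ifᵖ (prog e) (⟨ idᵖ , prog e ⟩ ⨾ prog c) (prog n)
  tm : ⟦ Γ ⟧ → List ⟦ A ⟧ → ℕ
  tm γ xs = elimList xs (time n γ)
              (λ z → suc (suc (siz Γ γ + time e γ) + time c (γ , z)))
  rn : ∀ γ → q ⊢ enc Γ γ ⇓ enc B (elimList (fun e γ) (fun n γ) (λ z → fun c (γ , z)))
               [ suc (time e γ + tm γ (fun e γ)) ]
  rn γ with fun e γ | run e γ
  ... | []     | r = ⇓no r (run n γ)
  ... | x ∷ xs | r = ⇓yes r (⇓seq (⇓pair ⇓id r) (run c (γ , x , xs)))

-- The loop behind folds.  Its state is γ ∙ (xs ∙ acc), where xs is the list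
-- still to be processed.

guardᵖ : Prog
guardᵖ = tlᵖ ⨾ hdᵖ

bodyᵖ : Prog → Prog
bodyᵖ f = ⟨ hdᵖ , ⟨ tlᵖ ⨾ hdᵖ ⨾ tlᵖ , ⟨ hdᵖ , ⟨ tlᵖ ⨾ hdᵖ ⨾ hdᵖ , tlᵖ ⨾ tlᵖ ⟩ ⟩ ⨾ f ⟩ ⟩

-- An iteration on a state of size S consists of a bounded number of basic operations, covered by 60
-- + 20 * S, and one step of time F. The additional iteration pays for the final test.
loopBound : ℕ → ℕ → ℕ → ℕ
loopBound l S F = suc l * (60 + 20 * S + F)

pb-loopBound : ∀ {l S F : ⟦ A ⟧ → ℕ} → PB A l → PB A S → PB A F → PB A (λ x → loopBound (l x) (S x) (F x))
pb-loopBound l S F = pb-* (pb-suc l) (pb-+ (pb-+ (pb-const 60) (pb-* (pb-const 20) S)) F)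

module Loop (f : Γ ⊗ (A ⊗ B) ⇀ B) (γ : ⟦ Γ ⟧) where

  step : ⟦ B ⟧ → ⟦ A ⟧ → ⟦ B ⟧
  step acc x = fun f (γ , x , acc)

  loop : ∀ xs acc → ∃[ t ] whileᵖ guardᵖ (bodyᵖ (prog f)) ⊢
           enc Γ γ ∙ (enc (list A) xs ∙ enc B acc) ⇓
           enc Γ γ ∙ (nil ∙ enc B (foldl step acc xs)) [ t ]
  loop []       acc = _ , ⇓stop (⇓seq ⇓tl ⇓hd)
  loop (x ∷ xs) acc = _ ,
    ⇓again (⇓seq ⇓tl ⇓hd)
      (⇓pair ⇓hd (⇓pair (⇓seq ⇓tl (⇓seq ⇓hd ⇓tl))
        (⇓seq (⇓pair ⇓hd (⇓pair (⇓seq ⇓tl (⇓seq ⇓hd ⇓hd)) (⇓seq ⇓tl ⇓tl)))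
          (run f (γ , x , acc)))))
      (proj₂ (loop xs (step acc x)))

  loopTime : List ⟦ A ⟧ → ⟦ B ⟧ → ℕ
  loopTime xs acc = proj₁ (loop xs acc)

  stateSize : List ⟦ A ⟧ → ⟦ B ⟧ → ℕ
  stateSize xs acc = siz Γ γ + siz (list A) xs + siz B acc

  -- The invariant `I` relates the unread part of the list to the accumulator: an accumulator may be
  -- known to be small only because of what has been read, or of what is still to come.
  loopTime≤ : (I : List ⟦ A ⟧ → ⟦ B ⟧ → Set) (S F : ℕ) →
              (∀ {x xs acc} → I (x ∷ xs) acc → I xs (step acc x)) →
              (∀ {xs acc} → I xs acc → stateSize xs acc ≤ S) →
              (∀ {x xs acc} → I (x ∷ xs) acc → time f (γ , x , acc) ≤ F) →
              ∀ xs acc → I xs acc → loopTime xs acc ≤ loopBound (length xs) S F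
  loopTime≤ I S F st sz fm [] acc i =
    ≤-trans (≤-trans (small (siz Γ γ) (siz B acc)) (+-monoʳ-≤ 60 (*-monoʳ-≤ 20 (sz i))))
            (≤-trans (m≤m+n _ F) (m≤m+n _ 0))
    where
    small : ∀ g a → suc (suc (suc (g + suc (1 + a)) + suc (1 + a))) ≤ 60 + 20 * (g + 1 + a)
    small g a = ≤-trans (m≤m+n _ (53 + 20 + 19 * g + 18 * a)) (≤-reflexive (eq g a))
      where
      eq : ∀ g a → suc (suc (suc (g + suc (1 + a)) + suc (1 + a))) +
        (53 + 20 + 19 * g + 18 * a) ≡ 60 + 20 * (g + 1 + a)
      eq = solve-∀
  loopTime≤ I S F st sz fm (x ∷ xs) acc i =
    ≤-trans (≤-trans (one (siz Γ γ) (siz A x) (siz (list A) xs) (siz B acc) (time f (γ , x , acc))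
      (loopTime xs (step acc x)))
              (+-monoˡ-≤ _ (+-mono-≤ (+-monoʳ-≤ 60 (*-monoʳ-≤ 20 (sz i))) (fm i))))
            (+-monoʳ-≤ (60 + 20 * S + F) (loopTime≤ I S F st sz fm xs (step acc x) (st i)))
    where
    -- The left-hand side is the cost of an iteration as given by the rules.
    one : ∀ g x l a m r → 1 + ((1 + ((1 + (g + (1 + ((1 + (x + l)) + a)))) +
      (1 + ((1 + (x + l)) + a)))) + (1 + ((1 + (g + (1 + ((1 + (x + l)) + a)))) +
      (1 + ((1 + ((1 + (g + (1 + ((1 + (x + l)) + a)))) +
      (1 + ((1 + ((1 + (x + l)) + a)) + (1 + (x + l)))))) +
      (1 + ((1 + ((1 + (g + (1 + ((1 + (x + l)) + a)))) +
      (1 + ((1 + ((1 + (g + (1 + ((1 + (x + l)) + a)))) +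
      (1 + ((1 + ((1 + (x + l)) + a)) + (1 + (x + l)))))) +
      (1 + ((1 + (g + (1 + ((1 + (x + l)) + a)))) + (1 +
      ((1 + (x + l)) + a)))))))) + m)))))) + r) ≤ 60 + 20 * (g + (1 + (x + l)) + a) + m + r
    one g x l a m r = ≤-trans (m≤m+n _ (40 + 14 * g + 8 * x + 8 * l + 10 * a)) (≤-reflexive (eq g x l a m r))
      where
      eq : ∀ g x l a m r → 1 + ((1 + ((1 + (g + (1 + ((1 + (x + l)) + a)))) +
        (1 + ((1 + (x + l)) + a)))) + (1 + ((1 + (g + (1 + ((1 + (x + l)) + a)))) +
        (1 + ((1 + ((1 + (g + (1 + ((1 + (x + l)) + a)))) +
        (1 + ((1 + ((1 + (x + l)) + a)) + (1 + (x + l)))))) +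
        (1 + ((1 + ((1 + (g + (1 + ((1 + (x + l)) + a)))) +
        (1 + ((1 + ((1 + (g + (1 + ((1 + (x + l)) + a)))) +
        (1 + ((1 + ((1 + (x + l)) + a)) + (1 + (x + l)))))) +
        (1 + ((1 + (g + (1 + ((1 + (x + l)) + a)))) + (1 + ((1 + (x + l)) + a)))))))) + m)))))) + r) +
        (40 + 14 * g + 8 * x + 8 * l + 10 * a) ≡ 60 + 20 * (g + (1 + (x + l)) + a) + m + r
      eq = solve-∀

length≤siz : ∀ (xs : List ⟦ A ⟧) → length xs ≤ siz (list A) xs
length≤siz []           = z≤n
length≤siz {A} (x ∷ xs) = s≤s (≤-trans (length≤siz xs) (m≤n+m _ (siz A x)))

siz-++ : ∀ (xs ys : List ⟦ A ⟧) → suc (siz (list A) (xs ++ ys)) ≡ siz (list A) xs + siz (list A) ys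
siz-++ []           ys = refl
siz-++ {A} (x ∷ xs) ys = cong suc (trans (sym (+-suc (siz A x) _))
  (trans (cong (siz A x +_) (siz-++ xs ys)) (sym (+-assoc (siz A x) _ _))))

siz-reverse : ∀ (xs : List ⟦ A ⟧) → siz (list A) (reverse xs) ≡ siz (list A) xs
siz-reverse []           = refl
siz-reverse {A} (x ∷ xs) = suc-injective (begin
  suc (siz (list A) (reverse (x ∷ xs)))                     ≡⟨ cong (suc ∘ siz (list A)) (unfold-reverse x xs) ⟩
  suc (siz (list A) (reverse xs ++ [ x ]))                  ≡⟨ siz-++ (reverse xs) [ x ] ⟩
  siz (list A) (reverse xs) + suc (siz A x + 1)             ≡⟨ cong (_+ suc (siz A x + 1)) (siz-reverse xs) ⟩
  siz (list A) xs + suc (siz A x + 1)                       ≡⟨ eq (siz (list A) xs) (siz A x) ⟩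
  suc (suc (siz A x + siz (list A) xs))                     ∎)
  where
  open ≡-Reasoning
  eq : ∀ l x → l + suc (x + 1) ≡ suc (suc (x + l))
  eq = solve-∀

consᶜ : Γ ⊗ (A ⊗ list A) ⇀ list A
consᶜ = tlᶜ (λ (_ , x , xs) → x ∷ xs) (λ _ → refl)

module Foldr (f : Γ ⊗ (A ⊗ B) ⇀ B) (xs : Γ ⇀ list A) (z : Γ ⇀ B) where

  open Loop

  result : ⟦ Γ ⟧ → List ⟦ A ⟧ → ⟦ B ⟧
  result γ = foldr (λ x acc → fun f (γ , x , acc)) (fun z γ)

  foldrᵖ : Prog
  foldrᵖ = ⟨ idᵖ , ⟨ prog xs , nilᵖ ⟩ ⟩
         -- A loop reads its list from the left, so a right fold starts by reversing it: dropping
         -- `γ` from `γ ∙ (x ∙ acc)` puts `x` in front of the accumulator.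
         ⨾ whileᵖ guardᵖ (bodyᵖ tlᵖ)
         ⨾ ⟨ hdᵖ , ⟨ tlᵖ ⨾ tlᵖ , hdᵖ ⨾ prog z ⟩ ⟩
         ⨾ whileᵖ guardᵖ (bodyᵖ (prog f))
         ⨾ tlᵖ ⨾ tlᵖ

  phases : ℕ → ℕ → ℕ → ℕ → ℕ → ℕ
  phases a b c m d = suc (a + suc (b + suc (c + suc (m + d))))

  initTime revTime midTime mainTime endTime foldrTime : ⟦ Γ ⟧ → ℕ
  initTime γ = suc (siz Γ γ + suc (time xs γ + siz Γ γ))
  revTime γ = loopTime (consᶜ {Γ} {A}) γ (fun xs γ) []
  midTime γ =
    let r = siz (list A) (reverse (fun xs γ))
        s = suc (siz Γ γ + suc (1 + r))
    in suc (s + suc (suc (s + suc (1 + r)) + suc (s + time z γ)))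
  mainTime γ = loopTime f γ (reverse (fun xs γ)) (fun z γ)
  endTime γ = let o = siz B (result γ (fun xs γ)) in suc (suc (siz Γ γ + suc (1 + o)) + suc (1 + o))
  foldrTime γ = phases (initTime γ) (revTime γ) (midTime γ) (mainTime γ) (endTime γ)

  foldrᶜ : Γ ⇀ B
  foldrᶜ = record
    { fun = λ γ → result γ (fun xs γ) ; prog = foldrᵖ ; time = foldrTime ; run = rn }
    where
    rn : ∀ γ → foldrᵖ ⊢ enc Γ γ ⇓ enc B (result γ (fun xs γ)) [ foldrTime γ ]
    rn γ with loop f γ (reverse (fun xs γ)) (fun z γ)
    ... | t , r = ⇓seq (⇓pair ⇓id (⇓pair (run xs γ) ⇓nil))
      (⇓seq (proj₂ (loop (consᶜ {Γ} {A}) γ (fun xs γ) []))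
      (⇓seq (⇓pair ⇓hd (⇓pair (⇓seq ⇓tl ⇓tl) (⇓seq ⇓hd (run z γ))))
      (⇓seq (subst (λ y → _ ⊢ _ ⇓ enc Γ γ ∙ (nil ∙ enc B y) [ _ ])
                   (reverse-foldl (step f γ) (fun z γ) (fun xs γ)) r)
      (⇓seq ⇓tl ⇓tl))))

  -- Costs are bounded along a map e into the environments, so that they may be
  -- measured by another encoding.  The cost of the main loop may exceed a
  -- polynomial by a factor W.
  module Cost {X : Ty} (e : ⟦ X ⟧ → ⟦ Γ ⟧)
              (pbγ : PB X (λ x → siz Γ (e x))) (pbxs : PB X (λ x → time xs (e x))) where

    N : ⟦ X ⟧ → ℕ
    N x = siz Γ (e x) + suc (siz (list A) (fun xs (e x)))

    pb-list : PB X (λ x → siz (list A) (fun xs (e x)))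
    pb-list = pb-≤ (λ x → out≤time (run xs (e x))) pbxs

    pbN : PB X N
    pbN = pb-+ pbγ (pb-suc pb-list)

    shift : ∀ x l a → l + suc (x + a) ≡ suc (x + l) + a
    shift = solve-∀

    pb-rev : PB X (λ x → revTime (e x))
    pb-rev = pb-≤ (λ x → let γ = e x in loopTime≤ (consᶜ {Γ} {A}) γ
        (λ ys acc → siz (list A) ys + siz (list A) acc ≤ suc (siz (list A) (fun xs γ)))
        (N x) (suc (suc (N x)))
        (λ {x} {ys} {acc} → ≤-trans (≤-reflexive (shift (siz A x) (siz (list A) ys) (siz (list A) acc))))
        (λ {ys} {acc} i → ≤-trans (≤-reflexive (+-assoc (siz Γ γ) _ _)) (+-monoʳ-≤ (siz Γ γ) i))
        (λ {x} {ys} {acc} i → s≤s (≤-trans (+-monoʳ-≤ (siz Γ γ) (s≤s (≤-trans (+-monoˡ-≤ (siz (list A) acc) (≤-trans (m≤m+n (siz A x) (siz (list A) ys)) (n≤1+n _))) i))) (≤-reflexive (+-suc (siz Γ γ) _))))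
        (fun xs γ) [] (≤-reflexive (+-comm _ 1)))
      (pb-loopBound (pb-≤ (λ x → length≤siz (fun xs (e x))) pb-list) pbN (pb-suc (pb-suc pbN)))

    total : (pbz : PB X (λ x → time z (e x))) (pbo : PB X (λ x → siz B (fun foldrᶜ (e x))))
            (W M : ⟦ X ⟧ → ℕ) → (∀ x → 1 ≤ W x) → PB X M → (∀ x → mainTime (e x) ≤ W x * M x) →
            ∃[ t ] PB X t × (∀ x → foldrTime (e x) ≤ W x * t x)
    total pbz pbo W M 1≤W pbM main≤ =
      (λ x → phases (initTime (e x)) (revTime (e x)) (midTime (e x)) (M x) (endTime (e x))) ,
      pb-suc (pb-+ pbi (pb-suc (pb-+ pb-rev (pb-suc (pb-+ pbm (pb-suc (pb-+ pbM pbe))))))) ,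
      λ x → weigh (W x) {initTime (e x)} {revTime (e x)} {midTime (e x)} {endTime (e x)} (1≤W x) (main≤ x)
      where
      pbr : PB X (λ x → siz (list A) (reverse (fun xs (e x))))
      pbr = pb-≤ (λ x → ≤-reflexive (siz-reverse (fun xs (e x)))) pb-list
      pbs : PB X (λ x → suc (siz Γ (e x) + suc (1 + siz (list A) (reverse (fun xs (e x))))))
      pbs = pb-suc (pb-+ pbγ (pb-suc (pb-suc pbr)))
      pbi : PB X (λ x → initTime (e x))
      pbi = pb-suc (pb-+ pbγ (pb-suc (pb-+ pbxs pbγ)))
      pbm : PB X (λ x → midTime (e x))
      pbm = pb-suc (pb-+ pbs (pb-suc (pb-+ (pb-suc (pb-+ pbs (pb-suc (pb-suc pbr)))) (pb-suc (pb-+ pbs pbz)))))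
      pbe : PB X (λ x → endTime (e x))
      pbe = pb-suc (pb-+ (pb-suc (pb-+ pbγ (pb-suc (pb-suc pbo)))) (pb-suc (pb-suc pbo)))
      weigh : ∀ w {a b c d m n} → 1 ≤ w → n ≤ w * m →
              phases a b c n d ≤ w * phases a b c m d
      weigh (suc w) {a} {b} {c} {d} {m} {n} _ n≤ = ≤-trans
        (s≤s (+-monoʳ-≤ a (s≤s (+-monoʳ-≤ b (s≤s (+-monoʳ-≤ c (s≤s (+-monoˡ-≤ d n≤))))))))
        (≤-trans (m≤m+n _ (w * (4 + a + b + c + d))) (≤-reflexive (eq w a b c d m)))
        where
        eq : ∀ w a b c d m → 1 + (a + (1 + (b + (1 + (c + (1 + ((m + w * m) + d))))))) + w *
          (4 + a + b + c + d) ≡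
                             (1 + w) * (1 + (a + (1 + (b + (1 + (c + (1 + (m + d))))))))
        eq = solve-∀

  module _ (growth : PB (Γ ⊗ list A) (λ (γ , ys) → siz B (result γ ys)))
           (W : ⟦ Γ ⟧ → ℕ) (1≤W : ∀ γ → 1 ≤ W γ)
           (c′ : ℕ) (step≤ : ∀ γ x acc → time f (γ , x , acc) ≤ W γ * suc
             (siz (Γ ⊗ (A ⊗ B)) (γ , x , acc)) ^ c′)
           (polyxs : Poly xs) (polyz : Poly z) where

    private
      open Cost {Γ} id pb-size polyxs
      c = deg growth

      M : ⟦ Γ ⟧ → ℕ
      M γ = suc (suc (N γ)) ^ c

      pbM : PB Γ M
      pbM = pb-^ c (pb-suc (pb-suc pbN))

      module Main (γ : ⟦ Γ ⟧) where
        -- The accumulator is the fold of the part `zs` read so far, so `growth` bounds it. The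
        -- sizes of the unread and the read part have a constant sum.
        I : List ⟦ A ⟧ → ⟦ B ⟧ → Set
        I ys acc = ∃[ zs ] acc ≡ result γ zs × siz (list A) ys + siz (list A) zs ≤ suc (siz (list A) (fun xs γ))
        accs : ∀ {ys acc} → I ys acc → siz B acc ≤ M γ
        accs {ys} (zs , refl , le) = ≤-trans (bnd growth (γ , zs))
          (^-monoˡ-≤ c (s≤s (s≤s (+-monoʳ-≤ (siz Γ γ) (≤-trans (m≤n+m _ _) le)))))
        ysb : ∀ {ys acc} → I ys acc → siz (list A) ys ≤ suc (siz (list A) (fun xs γ))
        ysb (_ , _ , le) = ≤-trans (m≤m+n _ _) le
        bound : mainTime γ ≤ loopBound (length (reverse (fun xs γ))) (N γ + M γ)
          (W γ * suc (suc (suc (N γ + M γ))) ^ c′)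
        bound = loopTime≤ f γ I (N γ + M γ) _
          (λ { {x} {ys} (zs , refl , le) → x ∷ zs , refl , ≤-trans (≤-reflexive (shift (siz A x) (siz (list A) ys) (siz (list A) zs))) le })
          (λ {ys} {acc} i → +-mono-≤ (+-monoʳ-≤ (siz Γ γ) (≤-trans (m≤m+n _ _) (proj₂ (proj₂ i)))) (accs i))
          (λ {x} {ys} {acc} i → ≤-trans (step≤ γ x acc) (*-monoʳ-≤ (W γ) (^-monoˡ-≤ c′
            (s≤s (s≤s (≤-trans (≤-reflexive (+-suc (siz Γ γ) _))
              (s≤s (≤-trans (≤-reflexive (sym (+-assoc (siz Γ γ) _ _)))
              (+-mono-≤ (+-monoʳ-≤ (siz Γ γ) (≤-trans (m≤m+n (siz A x) (siz (list A) ys))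
                (≤-trans (n≤1+n _) (ysb {x ∷ ys} i)))) (accs {x ∷ ys} i))))))))))
          (reverse (fun xs γ)) (fun z γ)
          ([] , refl , ≤-reflexive (trans (+-comm _ 1) (cong suc (siz-reverse (fun xs γ)))))

      weigh : ∀ {w} l a b → 1 ≤ w → l * (a + w * b) ≤ w * (l * (a + b))
      weigh {w} l a b 1≤w = ≤-trans (*-monoʳ-≤ l (≤-trans
        (+-monoˡ-≤ (w * b) (m≤n*m a w {{>-nonZero 1≤w}})) (≤-reflexive (sym (*-distribˡ-+ w a b)))))
        (≤-reflexive (eq l w (a + b)))
        where
        eq : ∀ l w s → l * (w * s) ≡ w * (l * s)
        eq = solve-∀

    foldr-cost : ∃[ t ] PB Γ t × (∀ γ → foldrTime γ ≤ W γ * t γ)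
    foldr-cost = total polyz
      (pb-∘ {B = Γ ⊗ list A} {f = λ γ → γ , fun xs γ} growth (pb-suc (pb-+ pb-size pb-list)))
      W _ 1≤W
      (pb-loopBound (pb-≤ (λ γ → ≤-trans (≤-reflexive (length-reverse (fun xs γ)))
        (length≤siz (fun xs γ))) pb-list)
        (pb-+ pbN pbM) (pb-^ c′ (pb-suc (pb-suc (pb-suc (pb-+ pbN pbM))))))
      (λ γ → ≤-trans (Main.bound γ) (weigh (suc (length (reverse (fun xs γ))))
        (60 + 20 * (N γ + M γ)) _ (1≤W γ)))

  foldr-poly : PB (Γ ⊗ list A) (λ (γ , ys) → siz B (result γ ys)) → Poly f → Poly xs → Poly z → Poly foldrᶜ
  foldr-poly growth polyf polyxs polyz = pb-≤ (λ γ → ≤-trans (proj₂ (proj₂ cost) γ)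
    (≤-reflexive (*-identityˡ _))) (proj₁ (proj₂ cost))
    where
    cost = foldr-cost growth (λ _ → 1) (λ _ → ≤-refl) (deg polyf)
             (λ γ x acc → ≤-trans (bnd polyf (γ , x , acc)) (≤-reflexive (sym (*-identityˡ _)))) polyxs polyz

open Foldr public using (foldrᶜ; foldr-poly)

-- Functions computable in polynomial time

infix 3 _⟶_

-- In contrast, `_⇀_` also covers calls of the oracle and the conversion to unary.
record _⟶_ (A B : Ty) : Set where
  no-eta-equality
  constructor _by_
  field
    arr  : A ⇀ B
    poly : Poly arr

open _⟶_ public

infixl 10 _·_

_·_ : A ⟶ B → ⟦ A ⟧ → ⟦ B ⟧
f · x = fun (arr f) x

-- Sealed arrows keep their values transparent, but hide programs and running
-- times, which would be costly to normalise.
abstract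
  seal : A ⟶ B → A ⟶ B
  seal f = f

  seal-fun : (f : A ⟶ B) → ∀ x → seal f · x ≡ f · x
  seal-fun f x = refl

as : (f : A ⟶ B) (g : ⟦ A ⟧ → ⟦ B ⟧) → (∀ x → f · x ≡ g x) → A ⟶ B
as f g e = asᶜ (arr (seal f)) g (λ x → trans (seal-fun f x) (e x)) by poly (seal f)

cast : (g : ⟦ A ⟧ → ⟦ B ⟧) → (∀ x → enc A x ≡ enc B (g x)) → A ⟶ B
cast g e = castᶜ g e by pb-size

hdₐ : (g : ⟦ A ⟧ → ⟦ B ⟧) → (∀ x → hd (enc A x) ≡ enc B (g x)) → A ⟶ B
hdₐ g e = hdᶜ g e by pb-size

tlₐ : (g : ⟦ A ⟧ → ⟦ B ⟧) → (∀ x → tl (enc A x) ≡ enc B (g x)) → A ⟶ B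
tlₐ g e = tlᶜ g e by pb-size

idₐ : A ⟶ A
idₐ = idᶜ by pb-size

infixr 9 _⊚_
infixr 4 _,ₐ_

_⊚_ : B ⟶ C → A ⟶ B → A ⟶ C
g ⊚ f = (arr g ∘ᶜ arr f) by
  pb-suc (pb-+ (poly f) (pb-∘ (poly g) (poly-size (arr f) (poly f))))

_,ₐ_ : Γ ⟶ A → Γ ⟶ B → Γ ⟶ A ⊗ B
f ,ₐ g = pairᶜ (arr f) (arr g) by pb-suc (pb-+ (poly f) (poly g))

constₐ : ⟦ B ⟧ → A ⟶ B
constₐ {B} y = constᶜ y by pb-≤ (λ x → treeTime≤ (enc B y) _)
  (pb-* (pb-const (size (enc B y))) (pb-suc pb-size))

matchₐ : Γ ⟶ list A → Γ ⟶ B → Γ ⊗ (A ⊗ list A) ⟶ B → Γ ⟶ B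
matchₐ {Γ} {A} e n c = matchᶜ (arr e) (arr n) (arr c) by
  pb-suc (pb-+ (poly e) (pb-≤ (λ γ → le γ (e · γ))
    (pb-+ (poly n) (pb-suc (pb-+ (pb-suc (pb-+ pb-size (poly e)))
      (pb-^ (deg (poly c)) (pb-suc (pb-suc (pb-+ pb-size (poly-size (arr e) (poly e)))))))))))
  where
  le : ∀ γ xs →
       elimList xs (time (arr n) γ) (λ z → suc (suc (siz Γ γ + time (arr e) γ) + time (arr c) (γ , z))) ≤
       time (arr n) γ + suc (suc (siz Γ γ + time (arr e) γ) + suc
         (suc (siz Γ γ + siz (list A) xs)) ^ deg (poly c))
  le γ []       = m≤m+n _ _
  le γ (x ∷ xs) = ≤-trans
    (s≤s (+-monoʳ-≤ (suc (siz Γ γ + time (arr e) γ)) (bnd (poly c) (γ , x , xs)))) (m≤n+m _ _)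

foldrₐ : (f : Γ ⊗ (A ⊗ B) ⟶ B) (xs : Γ ⟶ list A) (z : Γ ⟶ B) →
         PB (Γ ⊗ list A) (λ (γ , ys) → siz B (foldr (λ x acc → f · (γ , x , acc)) (z · γ) ys)) →
         Γ ⟶ B
foldrₐ f xs z growth = foldrᶜ (arr f) (arr xs) (arr z) by
  foldr-poly (arr f) (arr xs) (arr z) growth (poly f) (poly xs) (poly z)

π₁ : A ⊗ B ⟶ A
π₁ = hdₐ proj₁ (λ _ → refl)

π₂ : A ⊗ B ⟶ B
π₂ = tlₐ proj₂ (λ _ → refl)

pb-at : ∀ {t : ⟦ B ⟧ → ℕ} (f : A ⟶ B) → PB B t → PB A (λ x → t (f · x))
pb-at f p = pb-∘ {f = f ·_} p (poly-size (arr f) (poly f))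

pb-sizeat : (f : A ⟶ B) → PB A (λ x → siz B (f · x))
pb-sizeat f = poly-size (arr f) (poly f)

consₐ : Γ ⟶ A → Γ ⟶ list A → Γ ⟶ list A
consₐ x xs = cast (λ (y , ys) → y ∷ ys) (λ _ → refl) ⊚ (x ,ₐ xs)

-- `nil ∙ nil` is the code both of `true` and of `[ tt ]`, so a conditional is a match on a list.
units : Bool → List ⊤
units true  = [ tt ]
units false = []

unitsₐ : bool ⟶ list unit
unitsₐ = cast units (λ { true → refl ; false → refl })

elim-units : ∀ {Y : Set} {n y : Y} b → elimList (units b) n (λ _ → y) ≡ (if b then y else n)
elim-units true  = refl
elim-units false = refl

ifₐ : Γ ⟶ bool → Γ ⟶ B → Γ ⟶ B → Γ ⟶ B
ifₐ b y n = as (matchₐ (unitsₐ ⊚ b) n (y ⊚ π₁)) (λ γ → if b · γ then y · γ else n · γ)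
  (λ γ → elim-units (b · γ))

if-not : ∀ b → (if b then false else true) ≡ not b
if-not true  = refl
if-not false = refl

if-∧ : ∀ b c → (if b then c else false) ≡ b ∧ c
if-∧ true  c = refl
if-∧ false c = refl

if-xor : ∀ b c → (if b then not c else c) ≡ b xor c
if-xor true  c = refl
if-xor false c = refl

notₐ : Γ ⟶ bool → Γ ⟶ bool
notₐ b = as (ifₐ b (constₐ false) (constₐ true)) (λ γ → not (b · γ)) (λ γ → if-not (b · γ))

andₐ xorₐ : Γ ⟶ bool → Γ ⟶ bool → Γ ⟶ bool
andₐ b c = as (ifₐ b c (constₐ false)) (λ γ → b · γ ∧ c · γ) (λ γ → if-∧ (b · γ) (c · γ))
xorₐ b c = as (ifₐ b (notₐ c) c) (λ γ → b · γ xor c · γ) (λ γ → if-xor (b · γ) (c · γ))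

siz-++≤ : ∀ (xs ys : List ⟦ A ⟧) → siz (list A) (xs ++ ys) ≤ siz (list A) xs + siz (list A) ys
siz-++≤ xs ys = ≤-trans (n≤1+n _) (≤-reflexive (siz-++ xs ys))

appendₐ : Γ ⟶ list A → Γ ⟶ list A → Γ ⟶ list A
appendₐ {Γ} {A} xs ys = as
  (foldrₐ (consₐ (π₁ ⊚ π₂) (π₂ ⊚ π₂)) xs ys
    (pb-≤ (λ (γ , zs) → ≤-trans (≤-reflexive (cong (siz (list A)) (sym (++-is-foldr zs (ys · γ)))))
      (siz-++≤ zs (ys · γ)))
      (pb-+ (pb-sizeat {A = Γ ⊗ list A} π₂) (pb-sizeat {A = Γ ⊗ list A} (ys ⊚ π₁)))))
  (λ γ → xs · γ ++ ys · γ) (λ γ → sym (++-is-foldr (xs · γ) (ys · γ)))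

foldr-concatMap : ∀ {X Y : Set} (f : X → List Y) xs →
                  foldr (λ x acc → f x ++ acc) [] xs ≡ concatMap f xs
foldr-concatMap f []       = refl
foldr-concatMap f (x ∷ xs) = cong (f x ++_) (foldr-concatMap f xs)

concatMapₐ : Γ ⟶ list A → Γ ⊗ A ⟶ list B → Γ ⟶ list B
concatMapₐ {Γ} {A} {B} xs f = as
  (foldrₐ (appendₐ (f ⊚ (π₁ ,ₐ (π₁ ⊚ π₂))) (π₂ ⊚ π₂)) xs (constₐ [])
    (pb-≤ (λ (γ , ys) → bound γ ys)
      (pb-suc (pb-* (pb-size {Γ ⊗ list A}) (pb-^ c (pb-suc (pb-size {Γ ⊗ list A})))))))
  (λ γ → concatMap (λ x → f · (γ , x)) (xs · γ))
  (λ γ → foldr-concatMap (λ x → f · (γ , x)) (xs · γ))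
  where
  c = deg (poly-size (arr f) (poly f))
  bound′ : ∀ γ M ys → siz (list A) ys ≤ M →
           siz (list B) (foldr (λ x acc → f · (γ , x) ++ acc) [] ys) ≤
           suc (length ys * suc (suc (siz Γ γ + M)) ^ c)
  bound′ γ M []       h = ≤-refl
  bound′ γ M (y ∷ ys) h = ≤-trans (siz-++≤ (f · (γ , y)) _)
    (≤-trans (+-mono-≤
      (≤-trans (bnd (poly-size (arr f) (poly f)) (γ , y))
        (^-monoˡ-≤ c (s≤s (s≤s (+-monoʳ-≤ (siz Γ γ) (≤-trans (m≤n⇒m≤1+n (m≤m+n (siz A y) _)) h))))))
      (bound′ γ M ys (≤-trans (m≤n⇒m≤1+n (m≤n+m _ (siz A y))) h)))
      (≤-reflexive (+-suc (suc (suc (siz Γ γ + M)) ^ c) _)))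
  bound : ∀ γ ys → siz (list B) (foldr (λ x acc → f · (γ , x) ++ acc) [] ys) ≤
           suc (siz (Γ ⊗ list A) (γ , ys) * suc (siz (Γ ⊗ list A) (γ , ys)) ^ c)
  bound γ ys = ≤-trans (bound′ γ _ ys ≤-refl)
    (s≤s (*-monoˡ-≤ _ (≤-trans (length≤siz ys) (≤-trans (m≤n+m _ (siz Γ γ)) (n≤1+n _)))))

concatMap-[_] : ∀ {X Y : Set} (f : X → Y) xs → concatMap (λ x → [ f x ]) xs ≡ map f xs
concatMap-[ f ] []       = refl
concatMap-[ f ] (x ∷ xs) = cong (f x ∷_) (concatMap-[ f ] xs)

mapₐ : Γ ⟶ list A → Γ ⊗ A ⟶ B → Γ ⟶ list B
mapₐ xs f = as (concatMapₐ xs (consₐ f (constₐ [])))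
  (λ γ → map (λ x → f · (γ , x)) (xs · γ)) (λ γ → concatMap-[ (λ x → f · (γ , x)) ] (xs · γ))

-- Unary numbers

-- Since a unary number is the same tree as a list of units, recursion on numbers is a fold over a
-- list.
enc-replicate : ∀ n → enc nat n ≡ enc (list unit) (replicate n tt)
enc-replicate zero    = refl
enc-replicate (suc n) = cong (nil ∙_) (enc-replicate n)

enc-length : ∀ us → enc (list unit) us ≡ enc nat (length us)
enc-length []       = refl
enc-length (_ ∷ us) = cong (nil ∙_) (enc-length us)

siz-nat : ∀ n → siz nat n ≡ suc (n + n)
siz-nat zero    = refl
siz-nat (suc n) = cong suc (trans (cong suc (siz-nat n)) (cong suc (sym (+-suc n n))))

n≤siz-nat : ∀ n → n ≤ siz nat n
n≤siz-nat n = ≤-trans (m≤n⇒m≤1+n (m≤m+n n n)) (≤-reflexive (sym (siz-nat n)))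

pb-natat : (f : A ⟶ nat) → PB A (f ·_)
pb-natat f = pb-≤ (λ x → n≤siz-nat _) (pb-sizeat f)

lengthₐ : Γ ⟶ list A → Γ ⟶ nat
lengthₐ xs = as (cast length enc-length ⊚ mapₐ xs (constₐ tt)) (λ γ → length (xs · γ))
  (λ γ → trans (cong length (map-const (xs · γ))) (length-replicate (length (xs · γ))))
  where
  map-const : ∀ {X : Set} (xs : List X) → map (λ _ → tt) xs ≡ replicate (length xs) tt
  map-const []       = refl
  map-const (x ∷ xs) = cong (tt ∷_) (map-const xs)

unitListₐ : Γ ⟶ nat → Γ ⟶ list unit
unitListₐ n = cast (λ n → replicate n tt) enc-replicate ⊚ n

natFoldₐ : (n : Γ ⟶ nat) (z : Γ ⟶ B) (f : Γ ⊗ B ⟶ B) →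
           PB (Γ ⊗ nat) (λ (γ , n) → siz B (fold (z · γ) (λ b → f · (γ , b)) n)) → Γ ⟶ B
natFoldₐ {Γ} {B} n z f growth = as
  (foldrₐ (f ⊚ (π₁ ,ₐ (π₂ ⊚ π₂))) (unitListₐ n) z
    (pb-≤ (λ (γ , us) → ≤-reflexive (cong (siz B) (eq γ us)))
      (pb-at (π₁ ,ₐ lengthₐ {Γ ⊗ list unit} π₂) growth)))
  (λ γ → fold (z · γ) (λ b → f · (γ , b)) (n · γ))
  (λ γ → trans (eq γ (replicate (n · γ) tt)) (cong (fold (z · γ) _) (length-replicate (n · γ))))
  where
  eq : ∀ γ us → foldr (λ _ b → f · (γ , b)) (z · γ) us ≡ fold (z · γ) (λ b → f · (γ , b)) (length us)
  eq γ []       = refl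
  eq γ (_ ∷ us) = cong (λ b → f · (γ , b)) (eq γ us)

sucₐ predₐ : Γ ⟶ nat → Γ ⟶ nat
sucₐ n = cast (λ (_ , n) → suc n) (λ _ → refl) ⊚ (constₐ tt ,ₐ n)
predₐ n = tlₐ pred (λ { zero → refl ; (suc _) → refl }) ⊚ n

fold-suc : ∀ m n → fold m suc n ≡ n + m
fold-suc m zero    = refl
fold-suc m (suc n) = cong suc (fold-suc m n)

fold-pred : ∀ m n → fold m pred n ≡ m ∸ n
fold-pred m zero    = refl
fold-pred m (suc n) = trans (cong pred (fold-pred m n)) (pred[m∸n]≡m∸[1+n] m n)

plusₐ monusₐ : Γ ⟶ nat → Γ ⟶ nat → Γ ⟶ nat
plusₐ {Γ} m n = as
  (natFoldₐ m n (sucₐ π₂) (pb-≤ (λ (γ , k) →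
    ≤-trans (≤-reflexive (trans (cong (siz nat) (fold-suc (n · γ) k)) (siz-nat (k + n · γ)))) ≤-refl)
    (pb-suc (pb-+ (pb-+ p q) (pb-+ p q)))))
  (λ γ → m · γ + n · γ) (λ γ → fold-suc (n · γ) (m · γ))
  where
  p : PB (Γ ⊗ nat) proj₂
  p = pb-natat {A = Γ ⊗ nat} π₂
  q = pb-natat {A = Γ ⊗ nat} (n ⊚ π₁)
monusₐ {Γ} m n = as
  (natFoldₐ n m (predₐ π₂) (pb-≤ (λ (γ , k) →
    ≤-trans (≤-reflexive (trans (cong (siz nat) (fold-pred (m · γ) k)) (siz-nat (m · γ ∸ k))))
            (s≤s (+-mono-≤ (m∸n≤m (m · γ) k) (m∸n≤m (m · γ) k))))
    (pb-suc (pb-+ q q))))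
  (λ γ → m · γ ∸ n · γ) (λ γ → fold-pred (m · γ) (n · γ))
  where
  q = pb-natat {A = Γ ⊗ nat} (m ⊚ π₁)

isZero : ℕ → Bool
isZero zero    = true
isZero (suc _) = false

isZeroₐ : Γ ⟶ nat → Γ ⟶ bool
isZeroₐ n = as (matchₐ (unitListₐ n) (constₐ true) (constₐ false)) (λ γ → isZero (n · γ)) (λ γ → eq (n · γ))
  where
  eq : ∀ k → elimList (replicate k tt) true (λ _ → false) ≡ isZero k
  eq zero    = refl
  eq (suc _) = refl

leₐ eqNatₐ : Γ ⟶ nat → Γ ⟶ nat → Γ ⟶ bool
leₐ m n = as (isZeroₐ (monusₐ m n)) (λ γ → m · γ ≤ᵇ n · γ) (λ γ → eq (m · γ) (n · γ))
  where
  eq : ∀ a b → isZero (a ∸ b) ≡ (a ≤ᵇ b)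
  eq zero          b             = cong isZero (0∸n≡0 b)
  eq (suc a)       zero          = refl
  eq (suc zero)    (suc b)       = cong isZero (0∸n≡0 b)
  eq (suc (suc a)) (suc b)       = eq (suc a) b
eqNatₐ m n = as (andₐ (isZeroₐ (monusₐ m n)) (isZeroₐ (monusₐ n m))) (λ γ → m · γ ≡ᵇ n · γ)
  (λ γ → eq (m · γ) (n · γ))
  where
  eq : ∀ a b → isZero (a ∸ b) ∧ isZero (b ∸ a) ≡ (a ≡ᵇ b)
  eq zero    zero    = refl
  eq zero    (suc b) = refl
  eq (suc a) zero    = refl
  eq (suc a) (suc b) = eq a b

siz-downFrom : ∀ n → siz (list nat) (downFrom n) ≤ suc (n * suc (suc (n + n)))
siz-downFrom zero    = ≤-refl
siz-downFrom (suc n) = s≤s (≤-trans (+-mono-≤ (≤-reflexive (siz-nat n)) (siz-downFrom n))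
  (≤-trans (≤-reflexive (+-suc (suc (n + n)) _)) (+-mono-≤ (s≤s (s≤s (+-mono-≤ (n≤1+n n) (n≤1+n n))))
    (*-monoʳ-≤ n (s≤s (s≤s (+-mono-≤ (n≤1+n n) (n≤1+n n))))))))

downFromₐ : Γ ⟶ nat → Γ ⟶ list nat
downFromₐ {Γ} n = as
  -- The length of the list built so far is the next number.
  (natFoldₐ n (constₐ []) (consₐ (lengthₐ π₂) π₂)
    (pb-≤ (λ (γ , k) → ≤-trans (≤-reflexive (cong (siz (list nat)) (eq k))) (siz-downFrom k))
      (pb-suc (pb-* p (pb-suc (pb-suc (pb-+ p p)))))))
  (λ γ → downFrom (n · γ)) (λ γ → eq (n · γ))
  where
  p : PB (Γ ⊗ nat) proj₂
  p = pb-natat {A = Γ ⊗ nat} π₂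
  eq : ∀ k → fold [] (λ xs → length xs ∷ xs) k ≡ downFrom k
  eq zero    = refl
  eq (suc k) = cong₂ _∷_ (trans (cong length (eq k)) (length-downFrom k)) (eq k)

dropₐ : Γ ⟶ nat → Γ ⟶ list A → Γ ⟶ list A
dropₐ {Γ} {A} n xs = as
  (natFoldₐ n xs (tlₐ (drop 1) (λ { [] → refl ; (_ ∷ _) → refl }) ⊚ π₂)
    (pb-≤ (λ (γ , k) → ≤-trans (≤-reflexive (cong (siz (list A)) (eq k (xs · γ)))) (siz-drop k (xs · γ)))
      (pb-sizeat {A = Γ ⊗ nat} (xs ⊚ π₁))))
  (λ γ → drop (n · γ) (xs · γ)) (λ γ → eq (n · γ) (xs · γ))
  where
  siz-drop : ∀ k ys → siz (list A) (drop k ys) ≤ siz (list A) ys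
  siz-drop zero    ys       = ≤-refl
  siz-drop (suc k) []       = ≤-refl
  siz-drop (suc k) (y ∷ ys) = ≤-trans (siz-drop k ys) (m≤n⇒m≤1+n (m≤n+m _ _))
  shift : ∀ k (ys : List ⟦ A ⟧) → drop 1 (drop k ys) ≡ drop (suc k) ys
  shift zero    ys       = refl
  shift (suc k) []       = refl
  shift (suc k) (y ∷ ys) = shift k ys
  eq : ∀ k ys → fold ys (drop 1) k ≡ drop k ys
  eq zero    ys = refl
  eq (suc k) ys = trans (cong (drop 1) (eq k ys)) (shift k ys)

length-units : ∀ ns → length (concatMap (λ n → replicate n tt) ns) ≡ sum ns
length-units []       = refl
length-units (n ∷ ns) = trans (length-++ (replicate n tt)) (cong₂ _+_ (length-replicate n) (length-units ns))

sumₐ : Γ ⟶ list nat → Γ ⟶ nat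
sumₐ ns = as (cast length enc-length ⊚ concatMapₐ ns (unitListₐ π₂)) (λ γ → sum (ns · γ))
  (λ γ → length-units (ns · γ))

timesₐ : Γ ⟶ nat → Γ ⟶ nat → Γ ⟶ nat
timesₐ m n = as (sumₐ (mapₐ (unitListₐ m) (n ⊚ π₁))) (λ γ → m · γ * n · γ) (λ γ → eq (m · γ) (n · γ))
  where
  eq : ∀ a b → sum (map (λ _ → b) (replicate a tt)) ≡ a * b
  eq zero    b = refl
  eq (suc a) b = cong (b +_) (eq a b)

-- Binary numbers

digitsᵇ : ℕᵇ → List Bool
digitsᵇ ℕᵇ.zero  = []
digitsᵇ 2[1+ n ] = false ∷ digitsᵇ n
digitsᵇ 1+[2 n ] = true ∷ digitsᵇ n

fromDigits : List Bool → ℕᵇ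
fromDigits []           = ℕᵇ.zero
fromDigits (false ∷ bs) = 2[1+ fromDigits bs ]
fromDigits (true ∷ bs)  = 1+[2 fromDigits bs ]

-- Least significant digit first; `true` is the digit 1 and `false` the digit 2. In bijective
-- notation every list of digits is a numeral, so `digits` and `value` are mutually inverse and
-- `bin` can be cast to `list bool` and back.
digits : ℕ → List Bool
digits n = digitsᵇ (ℕᵇ.fromℕ n)

value : List Bool → ℕ
value bs = ℕᵇ.toℕ (fromDigits bs)

enc-digitsᵇ : ∀ n → encodeᵇ n ≡ enc (list bool) (digitsᵇ n)
enc-digitsᵇ ℕᵇ.zero  = refl
enc-digitsᵇ 2[1+ n ] = cong (nil ∙_) (enc-digitsᵇ n)
enc-digitsᵇ 1+[2 n ] = cong ((nil ∙ nil) ∙_) (enc-digitsᵇ n)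

fromDigits-digits : ∀ n → fromDigits (digitsᵇ n) ≡ n
fromDigits-digits ℕᵇ.zero  = refl
fromDigits-digits 2[1+ n ] = cong 2[1+_] (fromDigits-digits n)
fromDigits-digits 1+[2 n ] = cong 1+[2_] (fromDigits-digits n)

digits-fromDigits : ∀ bs → digitsᵇ (fromDigits bs) ≡ bs
digits-fromDigits []           = refl
digits-fromDigits (false ∷ bs) = cong (false ∷_) (digits-fromDigits bs)
digits-fromDigits (true ∷ bs)  = cong (true ∷_) (digits-fromDigits bs)

value-digits : ∀ n → value (digits n) ≡ n
value-digits n = trans (cong ℕᵇ.toℕ (fromDigits-digits (ℕᵇ.fromℕ n))) (toℕ-fromℕ n)

digits-value : ∀ bs → digits (value bs) ≡ bs
digits-value bs = trans (cong digitsᵇ (fromℕ-toℕ (fromDigits bs))) (digits-fromDigits bs)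

enc-digits : ∀ n → enc bin n ≡ enc (list bool) (digits n)
enc-digits n = enc-digitsᵇ (ℕᵇ.fromℕ n)

enc-value : ∀ bs → enc (list bool) bs ≡ enc bin (value bs)
enc-value bs = sym (trans (enc-digits (value bs)) (cong (enc (list bool)) (digits-value bs)))

siz-bits : ∀ bs → siz (list bool) bs ≤ suc (4 * length bs)
siz-bits []       = ≤-refl
siz-bits (b ∷ bs) = s≤s (≤-trans (+-mono-≤ (bit b) (siz-bits bs)) (≤-reflexive (eq (length bs))))
  where
  bit : ∀ b → siz bool b ≤ 3
  bit true  = ≤-refl
  bit false = s≤s z≤n
  eq : ∀ l → 3 + suc (4 * l) ≡ 4 * suc l
  eq = solve-∀

-- The least number with l digits has all digits 1 and equals 2 ^ l - 1.
2^length≤ : ∀ bs → 2 ^ length bs ≤ suc (value bs)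
2^length≤ []           = ≤-refl
2^length≤ (false ∷ bs) = ≤-trans (*-monoʳ-≤ 2 (2^length≤ bs)) (n≤1+n _)
2^length≤ (true ∷ bs)  = ≤-trans (*-monoʳ-≤ 2 (2^length≤ bs)) (≤-reflexive (eq (value bs)))
  where
  eq : ∀ v → 2 * suc v ≡ suc (suc (2 * v))
  eq = solve-∀

value<2^siz : ∀ bs → value bs < 2 ^ siz (list bool) bs
value<2^siz []           = s≤s z≤n
value<2^siz (b ∷ bs) = ≤-trans (step b) (≤-trans (*-monoʳ-≤ 2 (*-monoʳ-≤ 2 (value<2^siz bs)))
    (^-mono {2} {2} (s≤s z≤n) ≤-refl (s≤s (+-monoˡ-≤ _ (size>0 (encodeBool b))))))
  where
  eq : ∀ v → suc (2 * suc v) + suc (2 * v) ≡ 2 * (2 * suc v)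
  eq = solve-∀
  step : ∀ b → value (b ∷ bs) < 2 * (2 * suc (value bs))
  step false = ≤-trans (m≤m+n _ (suc (2 * value bs))) (≤-reflexive (eq (value bs)))
  step true  = ≤-trans (s≤s (s≤s (*-monoʳ-≤ 2 (n≤1+n _))))
    (≤-trans (≤-trans (≤-reflexive (+-comm 1 _)) (+-monoʳ-≤ (suc (2 * suc (value bs))) (s≤s z≤n)))
    (≤-reflexive (eq (value bs))))

siz-bin≤ : ∀ n e → n < 2 ^ e → siz bin n ≤ suc (4 * e)
siz-bin≤ n e n<2^e = ≤-trans (≤-reflexive (cong size (enc-digits n)))
  (≤-trans (siz-bits (digits n)) (s≤s (*-monoʳ-≤ 4 ℓ≤e)))
  where
  ℓ≤e : length (digits n) ≤ e
  ℓ≤e with length (digits n) ≤? e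
  ... | yes p = p
  ... | no ¬p = contradiction
    (≤-trans (^-monoʳ-< 2 (s≤s (s≤s z≤n)) (≰⇒> ¬p))
      (≤-trans (2^length≤ (digits n)) (≤-trans (s≤s (≤-reflexive (value-digits n))) n<2^e)))
    (<-irrefl refl)

n<2^siz-bin : ∀ n → n < 2 ^ siz bin n
n<2^siz-bin n = subst₂ (λ a b → a < 2 ^ b) (value-digits n) (cong size (sym (enc-digits n)))
  (value<2^siz (digits n))

bitsₐ : bin ⟶ list bool
bitsₐ = cast digits enc-digits

unbitsₐ : list bool ⟶ bin
unbitsₐ = cast value enc-value

sucBits doubleBits : List Bool → List Bool
sucBits []           = [ true ]
sucBits (false ∷ bs) = true ∷ sucBits bs
sucBits (true ∷ bs)  = false ∷ bs
doubleBits []           = []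
-- Here 2 * (2 + 2 * v) = 2 + 2 * (1 + 2 * v), which ends the recursion; for the digit 1, 2 * (1 + 2
-- * v) = 2 + 2 * (2 * v), and doubling continues.
doubleBits (false ∷ bs) = false ∷ true ∷ bs
doubleBits (true ∷ bs)  = false ∷ doubleBits bs

value-suc : ∀ bs → value (sucBits bs) ≡ suc (value bs)
value-suc []           = refl
value-suc (false ∷ bs) = cong (λ v → suc (2 * v)) (value-suc bs)
value-suc (true ∷ bs)  = eq (value bs)
  where
  eq : ∀ v → 2 * suc v ≡ suc (suc (2 * v))
  eq = solve-∀

value-double : ∀ bs → value (doubleBits bs) ≡ 2 * value bs
value-double []           = refl
value-double (false ∷ bs) = cong (2 *_) (eq (value bs))
  where
  eq : ∀ v → suc (suc (2 * v)) ≡ 2 * suc v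
  eq = solve-∀
value-double (true ∷ bs)  = cong (λ v → 2 * suc v) (value-double bs)

-- Primitive recursion with access to the tail, obtained from a fold that rebuilds the list beside
-- the result.
paraBitsₐ : (z : List Bool) (s : bool ⊗ (list bool ⊗ list bool) ⟶ list bool) (f : List Bool → List Bool) →
            f [] ≡ z → (∀ b bs → f (b ∷ bs) ≡ s · (b , bs , f bs)) →
            (∀ bs → length (f bs) ≤ suc (length bs)) → list bool ⟶ list bool
paraBitsₐ z s f f[] f∷ len = as
  (π₂ ⊚ foldrₐ {B = list bool ⊗ list bool} (consₐ (π₁ ⊚ π₂) (π₁ ⊚ π₂ ⊚ π₂) ,ₐ (s ⊚ π₂)) idₐ (constₐ ([] , z))
    (pb-≤ (λ (_ , bs) → ≤-trans (≤-reflexive (cong (siz (list bool ⊗ list bool)) (eq bs)))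
        (s≤s (+-monoʳ-≤ (siz (list bool) bs) (≤-trans (siz-bits (f bs))
          (s≤s (*-monoʳ-≤ 4 (≤-trans (len bs) (s≤s (length≤siz bs)))))))))
      (pb-suc (pb-+ p (pb-suc (pb-* (pb-const 4) (pb-suc p)))))))
  f (λ bs → cong proj₂ (eq bs))
  where
  p : PB (list bool ⊗ list bool) (λ x → siz (list bool) (proj₂ x))
  p = pb-sizeat π₂
  eq : ∀ bs → foldr (λ b (x , y) → b ∷ x , s · (b , x , y)) ([] , z) bs ≡ (bs , f bs)
  eq []       = cong ([] ,_) (sym f[])
  eq (b ∷ bs) = trans (cong (λ (x , y) → b ∷ x , s · (b , x , y)) (eq bs)) (cong (b ∷ bs ,_) (sym (f∷ b bs)))

sucBinₐ doubleBinₐ : bin ⟶ bin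
sucBinₐ = as (unbitsₐ ⊚ sucBitsₐ ⊚ bitsₐ) suc
  (λ n → trans (value-suc (digits n)) (cong suc (value-digits n)))
  where
  len : ∀ bs → length (sucBits bs) ≤ suc (length bs)
  len []           = ≤-refl
  len (false ∷ bs) = s≤s (len bs)
  len (true ∷ bs)  = n≤1+n _
  sucBitsₐ : list bool ⟶ list bool
  sucBitsₐ = paraBitsₐ [ true ]
    (ifₐ π₁ (consₐ (constₐ false) (π₁ ⊚ π₂)) (consₐ (constₐ true) (π₂ ⊚ π₂)))
    sucBits refl (λ { true _ → refl ; false _ → refl }) len
doubleBinₐ = as (unbitsₐ ⊚ doubleBitsₐ ⊚ bitsₐ) (2 *_)
  (λ n → trans (value-double (digits n)) (cong (2 *_) (value-digits n)))
  where
  len : ∀ bs → length (doubleBits bs) ≤ suc (length bs)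
  len []           = z≤n
  len (false ∷ bs) = ≤-refl
  len (true ∷ bs)  = s≤s (len bs)
  doubleBitsₐ : list bool ⟶ list bool
  doubleBitsₐ = paraBitsₐ []
    (consₐ (constₐ false) (ifₐ π₁ (π₂ ⊚ π₂) (consₐ (constₐ true) (π₁ ⊚ π₂))))
    doubleBits refl (λ { true _ → refl ; false _ → refl }) len

addBinₐ shiftBinₐ : Γ ⟶ nat → Γ ⟶ bin → Γ ⟶ bin
addBinₐ {Γ} n b = as
  (natFoldₐ n b (sucBinₐ ⊚ π₂) (pb-≤ (λ (γ , k) →
    ≤-trans (≤-reflexive (cong (siz bin) (fold-suc (b · γ) k)))
      (siz-bin≤ (k + b · γ) (suc (k + siz bin (b · γ))) (bound k (b · γ))))
    (pb-suc (pb-* (pb-const 4) (pb-suc (pb-+ (pb-natat {A = Γ ⊗ nat} π₂)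
      (pb-sizeat {A = Γ ⊗ nat} (b ⊚ π₁))))))))
  (λ γ → n · γ + b · γ) (λ γ → fold-suc (b · γ) (n · γ))
  where
  bound : ∀ k m → k + m < 2 ^ suc (k + siz bin m)
  bound k m = ≤-trans (≤-reflexive (sym (+-suc k m)))
    (≤-trans (+-mono-≤ (≤-trans (n≤2^n k) (^-mono {2} {2} (s≤s z≤n) ≤-refl (m≤m+n k (siz bin m))))
                       (≤-trans (n<2^siz-bin m) (^-mono {2} {2} (s≤s z≤n) ≤-refl (m≤n+m (siz bin m) k))))
             (≤-reflexive (cong (2 ^ (k + siz bin m) +_) (sym (+-identityʳ _)))))
shiftBinₐ {Γ} n b = as
  (natFoldₐ n b (doubleBinₐ ⊚ π₂) (pb-≤ (λ (γ , k) →
    ≤-trans (≤-reflexive (cong (siz bin) (eq (b · γ) k)))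
      (siz-bin≤ (2 ^ k * b · γ) (k + siz bin (b · γ)) (bound k (b · γ))))
    (pb-suc (pb-* (pb-const 4) (pb-+ (pb-natat {A = Γ ⊗ nat} π₂) (pb-sizeat {A = Γ ⊗ nat} (b ⊚ π₁)))))))
  (λ γ → 2 ^ (n · γ) * b · γ) (λ γ → eq (b · γ) (n · γ))
  where
  eq : ∀ m k → fold m (2 *_) k ≡ 2 ^ k * m
  eq m zero    = sym (*-identityˡ m)
  eq m (suc k) = trans (cong (2 *_) (eq m k)) (sym (*-assoc 2 (2 ^ k) m))
  bound : ∀ k m → 2 ^ k * m < 2 ^ (k + siz bin m)
  bound k m = ≤-trans (*-monoʳ-< (2 ^ k) {{m^n≢0 2 k}} (n<2^siz-bin m))
    (≤-reflexive (sym (^-distribˡ-+-* 2 k (siz bin m))))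

-- Digits in base 2 ^ L, least significant first. With L and the digits in unary, the value may be
-- exponential but has polynomially many bits, and Horner's scheme only takes increments and
-- doublings.
num : ℕ → List ℕ → ℕ
num L []       = 0
num L (x ∷ xs) = x + 2 ^ L * num L xs

numₐ : Γ ⟶ nat → Γ ⟶ list nat → Γ ⟶ bin
numₐ {Γ} L xs = as
  (foldrₐ (addBinₐ (π₁ ⊚ π₂) (shiftBinₐ (L ⊚ π₁) (π₂ ⊚ π₂))) xs (constₐ 0)
    (pb-≤ (λ (γ , ys) → ≤-trans (≤-reflexive (cong (siz bin) (eq (L · γ) ys)))
        (siz-bin≤ (num (L · γ) ys) (sum (map (_+ L · γ) ys)) (bound (L · γ) ys)))
      (pb-suc (pb-* (pb-const 4) (pb-natat {A = Γ ⊗ list nat} (sumₐ (mapₐ π₂ (plusₐ π₂ (L ⊚ π₁ ⊚ π₁)))))))))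
  (λ γ → num (L · γ) (xs · γ)) (λ γ → eq (L · γ) (xs · γ))
  where
  eq : ∀ l ys → foldr (λ x acc → x + 2 ^ l * acc) 0 ys ≡ num l ys
  eq l []       = refl
  eq l (y ∷ ys) = cong (λ n → y + 2 ^ l * n) (eq l ys)
  bound : ∀ l ys → num l ys < 2 ^ sum (map (_+ l) ys)
  bound l []       = s≤s z≤n
  bound l (y ∷ ys) = begin
    suc (y + 2 ^ l * num l ys)                 ≤⟨ s≤s (+-monoˡ-≤ _ (m≤m*n y (2 ^ l) {{m^n≢0 2 l}})) ⟩
    suc (y * 2 ^ l + 2 ^ l * num l ys)         ≡⟨ cong suc
      (trans (cong (_+ 2 ^ l * num l ys) (*-comm y (2 ^ l))) (sym (*-distribˡ-+ (2 ^ l) y _))) ⟩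
    suc (2 ^ l * (y + num l ys))               ≤⟨ *-monoʳ-< (2 ^ l) {{m^n≢0 2 l}} (n<1+n (y + num l ys)) ⟩
    2 ^ l * suc (y + num l ys)                 ≤⟨ *-monoʳ-≤ (2 ^ l) (≤-trans (≤-reflexive (sym (+-suc y _)))
                                                   (≤-trans (+-mono-≤ (≤-reflexive refl) (bound l ys))
                                                     (y+m≤2^y*m y _ (m^n>0 2 (sum (map (_+ l) ys)))))) ⟩
    2 ^ l * (2 ^ y * 2 ^ sum (map (_+ l) ys))  ≡⟨ cong (2 ^ l *_)
      (sym (^-distribˡ-+-* 2 y (sum (map (_+ l) ys)))) ⟩
    2 ^ l * 2 ^ (y + sum (map (_+ l) ys))      ≡⟨ sym (^-distribˡ-+-* 2 l _) ⟩
    2 ^ (l + (y + sum (map (_+ l) ys)))        ≡⟨ cong (2 ^_)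
      (trans (sym (+-assoc l y _)) (cong (_+ sum (map (_+ l) ys)) (+-comm l y))) ⟩
    2 ^ sum (map (_+ l) (y ∷ ys))              ∎
    where
    open ≤-Reasoning
    y+m≤2^y*m : ∀ y m → 1 ≤ m → y + m ≤ 2 ^ y * m
    y+m≤2^y*m zero    m _ = ≤-reflexive (sym (*-identityˡ m))
    y+m≤2^y*m (suc y) m h = ≤-trans (+-mono-≤ (≤-trans h (m≤m*n′ y)) (y+m≤2^y*m y m h))
      (≤-reflexive (trans (cong (2 ^ y * m +_) (sym (+-identityʳ _))) (sym (*-assoc 2 (2 ^ y) m))))
      where
      m≤m*n′ : ∀ y → m ≤ 2 ^ y * m
      m≤m*n′ y = ≤-trans (≤-reflexive (sym (*-identityˡ m))) (*-monoˡ-≤ m (m^n>0 2 y))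

-- Subsets as lists of selected elements

select : ∀ {n} → Subset n → (Fin n → X) → List X
select []          F = []
select (true ∷ E)  F = F zero ∷ select E (F ∘ suc)
select (false ∷ E) F = select E (F ∘ suc)

map-select : ∀ (g : X → Y) {n} (E : Subset n) (F : Fin n → X) → map g (select E F) ≡ select E (g ∘ F)
map-select g []          F = refl
map-select g (true ∷ E)  F = cong (g (F zero) ∷_) (map-select g E (F ∘ suc))
map-select g (false ∷ E) F = map-select g E (F ∘ suc)

filter-suc : ∀ {n} b (E : Subset n) xs → filter (_∈? (b ∷ E)) (map suc xs) ≡ map suc (filter (_∈? E) xs)
filter-suc b E []       = refl
filter-suc b E (x ∷ xs) with does (x ∈? E)
... | true  = cong (suc x ∷_) (filter-suc b E xs)
... | false = filter-suc b E xs

filter-allFin : ∀ {n} (E : Subset n) (F : Fin n → X) → map F (filter (_∈? E) (allFin n)) ≡ select E F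
filter-allFin []      F = refl
filter-allFin (b ∷ E) F = trans (cong (λ xs → map F (filter (_∈? (b ∷ E)) (zero ∷ xs)))
  (sym (map-tabulate id suc))) (go b)
  where
  rest : ∀ b → map F (filter (_∈? (b ∷ E)) (map suc (allFin _))) ≡ select E (F ∘ suc)
  rest b = trans (cong (map F) (filter-suc b E (allFin _)))
    (trans (sym (map-∘ (filter (_∈? E) (allFin _)))) (filter-allFin E (F ∘ suc)))
  go : ∀ b → map F (filter (_∈? (b ∷ E)) (zero ∷ map suc (allFin _))) ≡ select (b ∷ E) F
  go true  = cong (F zero ∷_) (rest true)
  go false = rest false

select-All : ∀ {P : X → Set} {n} (E : Subset n) (F : Fin n → X) →
             (∀ {j} → j ∈ˢ E → P (F j)) → All P (select E F)
select-All []          F h = []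
select-All (true ∷ E)  F h = h here ∷ select-All E (F ∘ suc) (h ∘ there)
select-All (false ∷ E) F h = select-All E (F ∘ suc) (h ∘ there)

All-select : ∀ {P : X → Set} {n} (E : Subset n) (F : Fin n → X) →
             All P (select E F) → ∀ {j} → j ∈ˢ E → P (F j)
All-select (true ∷ E)  F (p ∷ ps) here      = p
All-select (true ∷ E)  F (p ∷ ps) (there i) = All-select E (F ∘ suc) ps i
All-select (false ∷ E) F ps       (there i) = All-select E (F ∘ suc) ps i

select-AllPairs : ∀ {R : X → X → Set} {n} (E : Subset n) (F : Fin n → X) →
                  (∀ {j j′} → j ∈ˢ E → j′ ∈ˢ E → j ≢ j′ → R (F j) (F j′)) → AllPairs R (select E F)
select-AllPairs []          F h = []
select-AllPairs (true ∷ E)  F h =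
  select-All E (F ∘ suc) (λ i → h here (there i) λ ()) ∷
  select-AllPairs E (F ∘ suc) (λ i i′ ne → h (there i) (there i′) (λ { refl → ne refl }))
select-AllPairs (false ∷ E) F h =
  select-AllPairs E (F ∘ suc) (λ i i′ ne → h (there i) (there i′) (λ { refl → ne refl }))

AllPairs-select : ∀ {R : X → X → Set} → (∀ {x y} → R x y → R y x) → ∀ {n} (E : Subset n) (F : Fin n → X) →
                  AllPairs R (select E F) → ∀ {j j′} → j ∈ˢ E → j′ ∈ˢ E → j ≢ j′ → R (F j) (F j′)
AllPairs-select s (true ∷ E)  F (_ ∷ rs) here      here       ne = ⊥-elim (ne refl)
AllPairs-select s (true ∷ E)  F (r ∷ rs) here      (there i′) ne = All-select E (F ∘ suc) r i′
AllPairs-select s (true ∷ E)  F (r ∷ rs) (there i) here       ne = s (All-select E (F ∘ suc) r i)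
AllPairs-select s (true ∷ E)  F (_ ∷ rs) (there i) (there i′) ne = AllPairs-select s E
  (F ∘ suc) rs i i′ (ne ∘ cong suc)
AllPairs-select s (false ∷ E) F rs       (there i) (there i′) ne = AllPairs-select s E
  (F ∘ suc) rs i i′ (ne ∘ cong suc)

-- Intervals are given by their start and their length.
Disjoint : ℕ × ℕ → ℕ × ℕ → Set
Disjoint (s , p) (s′ , p′) = s + p ≤ s′ ⊎ s′ + p′ ≤ s

sum-filter : ∀ (f : X → ℕ) {P : X → Set} (P? : Decidable P) xs →
             sum (map f xs) ≡ sum (map f (filter P? xs)) + sum (map f (filter (¬? ∘ P?) xs))
sum-filter f P? []       = refl
sum-filter f P? (x ∷ xs) with does (P? x)
... | true  = trans (cong (f x +_) (sum-filter f P? xs)) (sym (+-assoc (f x) _ _))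
... | false = trans (cong (f x +_) (sum-filter f P? xs)) (trans (sym (+-assoc (f x) _ _))
                (trans (cong (_+ sum (map f (filter (¬? ∘ P?) xs))) (+-comm (f x) _))
                  (+-assoc (sum (map f (filter P? xs))) (f x) _)))

-- As in quicksort, the first interval splits the others into those to its
-- left and those to its right.
packing : ∀ fuel xs A D → length xs ≤ fuel → A ≤ D → AllPairs Disjoint xs →
          All (λ (s , p) → A ≤ s × s + p ≤ D) xs → A + sum (map proj₂ xs) ≤ D
packing fuel       []             A D _ A≤D _ _ = ≤-trans (≤-reflexive (+-identityʳ A)) A≤D
packing (suc fuel) ((s , p) ∷ xs) A D (s≤s len) A≤D (dis ∷ diss) ((A≤s , s+p≤D) ∷ inside) = begin
  A + (p + sum (map proj₂ xs))    ≡⟨ cong (λ z → A + (p + z)) (sum-filter proj₂ left? xs) ⟩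
  A + (p + (l + r))               ≡⟨ eq A p l r ⟩
  (A + l) + (p + r)               ≤⟨ +-monoˡ-≤ (p + r)
    (packing fuel (filter left? xs) A s (≤-trans (length-filter left? xs) len) A≤s
                                       (AllPairs.filter⁺ left? diss)
                                       (All.zipWith (λ { (h , (A≤ , _)) → A≤ , h }) (All.all-filter left? xs , All.filter⁺ left? inside))) ⟩
  s + (p + r)                     ≡⟨ sym (+-assoc s p r) ⟩
  (s + p) + r                     ≤⟨ packing fuel (filter (¬? ∘ left?) xs) (s + p) D
    (≤-trans (length-filter (¬? ∘ left?) xs) len) s+p≤D
                                       (AllPairs.filter⁺ (¬? ∘ left?) diss)
                                       (All.zipWith right (All.all-filter (¬? ∘ left?) xs ,
                                         All.filter⁺ (¬? ∘ left?) (All.zip (dis , inside)))) ⟩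
  D                               ∎
  where
  open ≤-Reasoning
  left? : Decidable (λ ((s′ , p′) : ℕ × ℕ) → s′ + p′ ≤ s)
  left? (s′ , p′) = s′ + p′ ≤? s
  l = sum (map proj₂ (filter left? xs))
  r = sum (map proj₂ (filter (¬? ∘ left?) xs))
  eq : ∀ A p l r → A + (p + (l + r)) ≡ (A + l) + (p + r)
  eq = solve-∀
  right : ∀ {y : ℕ × ℕ} →
          (¬ (proj₁ y + proj₂ y ≤ s)) × (Disjoint (s , p) y × (A ≤ proj₁ y × proj₁ y + proj₂ y ≤ D)) →
          s + p ≤ proj₁ y × proj₁ y + proj₂ y ≤ D
  right (nl , inj₁ h , _ , h′) = h , h′
  right (nl , inj₂ h , _ , h′) = contradiction h nl

prefix : ∀ {n} → Subset n → (Fin n → ℕ) → Fin n → ℕ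
prefix (b ∷ E)     f zero    = 0
prefix (true ∷ E)  f (suc j) = f zero + prefix E (f ∘ suc) j
prefix (false ∷ E) f (suc j) = prefix E (f ∘ suc) j

prefix-≤sum : ∀ {n} (E : Subset n) f {j} → j ∈ˢ E → prefix E f j + f j ≤ sum (select E f)
prefix-≤sum (true ∷ E)  f here      = m≤m+n _ _
prefix-≤sum (true ∷ E)  f (there i) = ≤-trans (≤-reflexive (+-assoc (f zero) _ _))
  (+-monoʳ-≤ (f zero) (prefix-≤sum E (f ∘ suc) i))
prefix-≤sum (false ∷ E) f (there i) = prefix-≤sum E (f ∘ suc) i

prefix-disjoint : ∀ {n} (E : Subset n) f {j j′} → j ∈ˢ E → j′ ∈ˢ E → j ≢ j′ →
                  prefix E f j + f j ≤ prefix E f j′ ⊎ prefix E f j′ + f j′ ≤ prefix E f j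
prefix-disjoint (true ∷ E)  f here      here       ne = ⊥-elim (ne refl)
prefix-disjoint (true ∷ E)  f here      (there i′) ne = inj₁ (m≤m+n _ _)
prefix-disjoint (true ∷ E)  f (there i) here       ne = inj₂ (m≤m+n _ _)
prefix-disjoint (true ∷ E)  f (there i) (there i′) ne with prefix-disjoint E (f ∘ suc) i i′ (ne ∘ cong suc)
... | inj₁ h = inj₁ (≤-trans (≤-reflexive (+-assoc (f zero) _ _)) (+-monoʳ-≤ (f zero) h))
... | inj₂ h = inj₂ (≤-trans (≤-reflexive (+-assoc (f zero) _ _)) (+-monoʳ-≤ (f zero) h))
prefix-disjoint (false ∷ E) f (there i) (there i′) ne = prefix-disjoint E (f ∘ suc) i i′ (ne ∘ cong suc)

-- Schedules with unit times on the second machine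

module _ (I : FlowShop 2) (unit₂ : UnitOnSecondMachine I) (E : Subset (FlowShop.#jobs I)) where
  open FlowShop I

  p₁ : Fin #jobs → ℕ
  p₁ j = p j zero

  totalWeight-select : totalWeight E ≡ sum (select E w)
  totalWeight-select = cong sum (filter-allFin E w)

  -- A job in time starts its unit on the second machine at its due date minus one, hence has left
  -- the first machine by D. The disjoint intervals on the first machine thus lie between 0 and D.
  schedule-packs : JITSchedule E → ∀ D → (∀ j → d j ≤ suc D) → sum (select E p₁) ≤ D
  schedule-packs S D due≤ = ≤-trans (≤-reflexive (cong sum
    (sym (map-select proj₂ E (λ j → start j zero , p₁ j)))))
    (packing _ (select E (λ j → start j zero , p₁ j)) 0 D ≤-refl z≤n
      (select-AllPairs E _ (λ i i′ ne → capacity i i′ ne zero))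
      (select-All E _ (λ {j} i → z≤n , inD j i)))
    where
    open JITSchedule S
    inD : ∀ j → j ∈ˢ E → start j zero + p₁ j ≤ D
    inD j i = ≤-trans (route i {zero} {suc zero} refl) (s≤s⁻¹ (≤-trans (≤-reflexive
      (trans (+-comm 1 (start j (suc zero))) (trans (cong (start j (suc zero) +_) (sym (unit₂ j)))
        (jit i {suc zero} refl)))) (due≤ j)))

  -- The first machine processes the selected jobs back to back and is done by D, before any of them
  -- has to start on the second machine. There, different due dates make the unit intervals
  -- disjoint.
  schedule-from : ∀ D → sum (select E p₁) ≤ D → (∀ j → D < d j) →
                  (∀ {j j′} → j ∈ˢ E → j′ ∈ˢ E → j ≢ j′ → d j ≢ d j′) → JITSchedule E
  schedule-from D Σ≤D D<d d≢ = record
    { start    = st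
    ; route    = λ { i {zero} {suc zero} refl → ≤-trans (prefix-≤sum E p₁ i) (≤-trans Σ≤D (D≤ _)) }
    ; capacity = λ { i i′ ne zero → prefix-disjoint E p₁ i i′ ne
                   ; i i′ ne (suc zero) → second (d≢ i i′ ne) }
    ; jit      = λ { {j} i {suc zero} refl → done j } }
    where
    st : Fin #jobs → Fin 2 → ℕ
    st j zero       = prefix E p₁ j
    st j (suc zero) = pred (d j)
    D≤ : ∀ j → D ≤ pred (d j)
    D≤ j = s≤s⁻¹ (≤-trans (D<d j) (suc-pred≤ (d j)))
      where
      suc-pred≤ : ∀ n → n ≤ suc (pred n)
      suc-pred≤ zero    = z≤n
      suc-pred≤ (suc n) = ≤-refl
    done : ∀ j → pred (d j) + p j (suc zero) ≡ d j
    done j = trans (cong (pred (d j) +_) (unit₂ j)) (trans (+-comm _ 1)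
      (suc-pred (d j) {{>-nonZero (≤-trans (s≤s z≤n) (D<d j))}}))
    second : ∀ {j j′} → d j ≢ d j′ → st j (suc zero) + p j (suc zero) ≤ st j′ (suc zero) ⊎ st j′
      (suc zero) + p j′ (suc zero) ≤ st j (suc zero)
    second {j} {j′} ne with <-cmp (d j) (d j′)
    ... | tri< lt _ _ = inj₁ (≤-trans (≤-reflexive (done j)) (<⇒≤pred lt))
    ... | tri≈ _ e _  = ⊥-elim (ne e)
    ... | tri> _ _ gt = inj₂ (≤-trans (≤-reflexive (done j′)) (<⇒≤pred gt))

𝟙 : Bool → ℕ
𝟙 true  = 1
𝟙 false = 0

-- Positional numbers without carries

lex : ∀ {B x y m n} → x + B * m ≤ y + B * n → y < B → m ≤ n
lex {B} {x} {y} {m} {n} h y<B with m ≤? n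
... | yes p = p
... | no ¬p = contradiction (begin-strict
      y + B * n   <⟨ +-monoˡ-< (B * n) y<B ⟩
      B + B * n   ≡⟨ sym (*-suc B n) ⟩
      B * suc n   ≤⟨ *-monoʳ-≤ B (≰⇒> ¬p) ⟩
      B * m       ≤⟨ m≤n+m (B * m) x ⟩
      x + B * m   ≤⟨ h ⟩
      y + B * n   ∎) (<-irrefl refl)
  where open ≤-Reasoning

num-injective : ∀ L xs ys → length xs ≡ length ys → All (_< 2 ^ L) xs → All (_< 2 ^ L) ys →
                num L xs ≡ num L ys → xs ≡ ys
num-injective L []       []       _   _        _        _  = refl
num-injective L (x ∷ xs) (y ∷ ys) len (px ∷ pxs) (py ∷ pys) eq =
  cong₂ _∷_ (+-cancelʳ-≡ (2 ^ L * num L xs) x y (trans eq (cong (λ n → y + 2 ^ L * n) (sym same))))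
            (num-injective L xs ys (suc-injective len) pxs pys same)
  where
  same : num L xs ≡ num L ys
  same = ≤-antisym (lex {2 ^ L} {x} (≤-reflexive eq) py) (lex {2 ^ L} {y} (≤-reflexive (sym eq)) px)

Row : Set
Row = List ℕ

colsum : ℕ → List Row → Row
colsum w = foldr (zipWith _+_) (replicate w 0)

length-colsum : ∀ w rs → All (λ r → length r ≡ w) rs → length (colsum w rs) ≡ w
length-colsum w []       _        = length-replicate w
length-colsum w (r ∷ rs) (p ∷ ps) = trans (length-zipWith _+_ r (colsum w rs))
  (trans (cong₂ _⊓_ p (length-colsum w rs ps)) (⊓-idem w))

num-zipWith : ∀ L xs ys → length xs ≡ length ys → num L (zipWith _+_ xs ys) ≡ num L xs + num L ys
num-zipWith L []       []       _   = refl
num-zipWith L (x ∷ xs) (y ∷ ys) len = trans (cong (λ n → x + y + 2 ^ L * n)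
  (num-zipWith L xs ys (suc-injective len)))
  (eq x y (2 ^ L) (num L xs) (num L ys))
  where
  eq : ∀ x y b m n → x + y + b * (m + n) ≡ x + b * m + (y + b * n)
  eq = solve-∀

num-replicate : ∀ L w → num L (replicate w 0) ≡ 0
num-replicate L zero    = refl
num-replicate L (suc w) = trans (cong (2 ^ L *_) (num-replicate L w)) (*-zeroʳ (2 ^ L))

-- `num` is linear whatever the size of the digits; carries are an issue only in `num-injective`,
-- where digits are read back.
num-colsum : ∀ L w rs → All (λ r → length r ≡ w) rs → num L (colsum w rs) ≡ sum (map (num L) rs)
num-colsum L w []       _        = num-replicate L w
num-colsum L w (r ∷ rs) (p ∷ ps) = trans
  (num-zipWith L r (colsum w rs) (trans p (sym (length-colsum w rs ps))))
  (cong (num L r +_) (num-colsum L w rs ps))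

colsum-map : ∀ {C : Set} (φ : X → C → ℕ) cols xs →
             colsum (length cols) (map (λ x → map (φ x) cols) xs) ≡ map (λ c → sum (map (λ x → φ x c) xs)) cols
colsum-map φ []         []       = refl
colsum-map φ (c ∷ cols) []       = cong (0 ∷_) (colsum-map φ cols [])
colsum-map φ cols       (x ∷ xs) = trans (cong (zipWith _+_ (map (φ x) cols)) (colsum-map φ cols xs)) (go cols)
  where
  go : ∀ cs → zipWith _+_ (map (φ x) cs) (map (λ c → sum (map (λ x → φ x c) xs)) cs) ≡
              map (λ c → φ x c + sum (map (λ x → φ x c) xs)) cs
  go []       = refl
  go (c ∷ cs) = cong (_ ∷_) (go cs)

colsum-∷ : ∀ w (f : X → ℕ) (g : X → Row) xs → colsum (suc w) (map (λ x → f x ∷ g x) xs) ≡ sum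
  (map f xs) ∷ colsum w (map g xs)
colsum-∷ w f g []       = refl
colsum-∷ w f g (x ∷ xs) = cong (zipWith _+_ (f x ∷ g x)) (colsum-∷ w f g xs)

colsum-++ : ∀ v w (f g : X → Row) xs → All (λ x → length (f x) ≡ v) xs →
            colsum (v + w) (map (λ x → f x ++ g x) xs) ≡ colsum v (map f xs) ++ colsum w (map g xs)
colsum-++ v w f g []       _        = replicate-++ v
  where
  replicate-++ : ∀ v → replicate (v + w) 0 ≡ replicate v 0 ++ replicate w 0
  replicate-++ zero    = refl
  replicate-++ (suc v) = cong (0 ∷_) (replicate-++ v)
colsum-++ v w f g (x ∷ xs) (p ∷ ps) = trans (cong (zipWith _+_ (f x ++ g x)) (colsum-++ v w f g xs ps))
  (zip-++ (f x) (colsum v (map f xs)) (trans p (sym (length-colsum v (map f xs) (All.map⁺ ps)))))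
  where
  zip-++ : ∀ as bs {cs ds} → length as ≡ length bs →
           zipWith _+_ (as ++ cs) (bs ++ ds) ≡ zipWith _+_ as bs ++ zipWith _+_ cs ds
  zip-++ []       []       _ = refl
  zip-++ (a ∷ as) (b ∷ bs) e = cong (a + b ∷_) (zip-++ as bs (suc-injective e))

++-splits : ∀ (as bs : List X) {cs ds} → length as ≡ length bs → as ++ cs ≡ bs ++ ds → as ≡ bs × cs ≡ ds
++-splits []       []       _ e    = refl , e
++-splits (a ∷ as) (b ∷ bs) l e with cong (Data.List.Base.head) e
... | refl with ++-splits as bs (suc-injective l) (cong (Data.List.Base.drop 1) e)
... | refl , e′ = refl , e′

colsum≤sum : ∀ w rs → All (_≤ sum (map sum rs)) (colsum w rs)
colsum≤sum w []       = All.replicate⁺ w ≤-refl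
colsum≤sum w (r ∷ rs) = go r (colsum w rs) (colsum≤sum w rs)
  where
  S = sum (map sum rs)
  go : ∀ r xs → All (_≤ S) xs → All (_≤ sum r + S) (zipWith _+_ r xs)
  go []      _        _        = []
  go (_ ∷ _) []       _        = []
  go (a ∷ r) (x ∷ xs) (p ∷ ps) =
    +-mono-≤ (m≤m+n a (sum r)) p ∷ All.map (λ h → ≤-trans h (+-monoˡ-≤ S (m≤n+m (sum r) a))) (go r xs ps)

all≤sum : ∀ xs → All (_≤ sum xs) xs
all≤sum []       = []
all≤sum (x ∷ xs) = m≤m+n x _ ∷ All.map (λ h → ≤-trans h (m≤n+m (sum xs) x)) (all≤sum xs)

-- Selections from a list

pick : (xs : List X) → Subset (length xs) → List X
pick []       Vec.[]            = []
pick (x ∷ xs) (true Vec.∷ E)  = x ∷ pick xs E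
pick (x ∷ xs) (false Vec.∷ E) = pick xs E

pick-⊆ : ∀ (xs : List X) E → pick xs E ⊆ xs
pick-⊆ []       Vec.[]          = []
pick-⊆ (x ∷ xs) (true Vec.∷ E)  = refl ∷ pick-⊆ xs E
pick-⊆ (x ∷ xs) (false Vec.∷ E) = x ∷ʳ pick-⊆ xs E

⊆-pick : ∀ {xs ys : List X} → ys ⊆ xs → ∃[ E ] pick xs E ≡ ys
⊆-pick []       = Vec.[] , refl
⊆-pick (x ∷ʳ s) with ⊆-pick s
... | E , e = false Vec.∷ E , e
⊆-pick {xs = x ∷ _} (refl ∷ s) with ⊆-pick s
... | E , e = true Vec.∷ E , cong (x ∷_) e

select-lookup : ∀ (mk : X → Y) {Z : Set} (F : Y → Z) xs E →
                select E (λ j → F (lookup (Vec.map mk (fromList xs)) j)) ≡ map (λ x → F (mk x)) (pick xs E)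
select-lookup mk F []       Vec.[]          = refl
select-lookup mk F (x ∷ xs) (true Vec.∷ E)  = cong (F (mk x) ∷_) (select-lookup mk F xs E)
select-lookup mk F (x ∷ xs) (false Vec.∷ E) = select-lookup mk F xs E

lookup-All : ∀ (mk : X → Y) {P : Y → Set} {xs} → All (λ x → P (mk x)) xs → ∀ j → P
  (lookup (Vec.map mk (fromList xs)) j)
lookup-All mk {P} (p ∷ ps) zero    = p
lookup-All mk {P} (p ∷ ps) (suc j) = lookup-All mk {P} ps j

⊆-split : ∀ {zs : List X} xs {ys} → zs ⊆ xs ++ ys → ∃[ as ] ∃[ bs ] zs ≡ as ++ bs × as ⊆ xs × bs ⊆ ys
⊆-split []       s          = [] , _ , refl , [] , s
⊆-split (x ∷ xs) (.x ∷ʳ s)  with ⊆-split xs s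
... | as , bs , e , s₁ , s₂ = as , bs , e , x ∷ʳ s₁ , s₂
⊆-split (x ∷ xs) (refl ∷ s) with ⊆-split xs s
... | as , bs , e , s₁ , s₂ = x ∷ as , bs , cong (x ∷_) e , refl ∷ s₁ , s₂

sum-⊆ : ∀ (f : X → ℕ) {xs ys} → xs ⊆ ys → sum (map f xs) ≤ sum (map f ys)
sum-⊆ f []         = z≤n
sum-⊆ f (y ∷ʳ s)   = ≤-trans (sum-⊆ f s) (m≤n+m _ (f y))
sum-⊆ f (refl ∷ s) = +-monoʳ-≤ (f _) (sum-⊆ f s)

-- The label of a class is the number of classes after it, so removing the first class does not
-- change the other labels, which suits induction.
enum : List X → List (ℕ × X)
enum []       = []
enum (x ∷ xs) = (length xs , x) ∷ enum xs

items : List (List X) → List (ℕ × X)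
items cs = concatMap (λ (l , c) → map (l ,_) c) (enum cs)

items-label : ∀ (cs : List (List X)) → All (λ (l , _) → l < length cs) (items cs)
items-label []       = []
items-label (c ∷ cs) = All.++⁺ (All.map⁺ (All.universal (λ _ → ≤-refl) c)) (All.map m≤n⇒m≤1+n (items-label cs))

items-∈ : ∀ (cs : List (List X)) → All (λ (_ , x) → ∃[ c ] c ∈ cs × x ∈ c) (items cs)
items-∈ []       = []
items-∈ (c ∷ cs) = All.++⁺ (All.map⁺ (All.tabulate λ i → c , here refl , i))
  (All.map (λ (c′ , i , j) → c′ , there i , j) (items-∈ cs))

≡ᵇ-refl : ∀ n → (n ≡ᵇ n) ≡ true
≡ᵇ-refl zero    = refl
≡ᵇ-refl (suc n) = ≡ᵇ-refl n

≡ᵇ-< : ∀ {m n} → m < n → (m ≡ᵇ n) ≡ false × (n ≡ᵇ m) ≡ false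
≡ᵇ-< {zero}  {suc n} _       = refl , refl
≡ᵇ-< {suc m} {suc n} (s≤s h) = ≡ᵇ-< h

count : ℕ → List (ℕ × X) → ℕ
count l xs = sum (map (λ x → 𝟙 (l ≡ᵇ proj₁ x)) xs)

count-++ : ∀ l (xs ys : List (ℕ × X)) → count l (xs ++ ys) ≡ count l xs + count l ys
count-++ l xs ys = trans (cong sum (map-++ _ xs ys)) (sum-++ (map _ xs) (map _ ys))

count-all : ∀ l (xs : List (ℕ × X)) → All (λ x → proj₁ x ≡ l) xs → count l xs ≡ length xs
count-all l []       _           = refl
count-all l (x ∷ xs) (refl ∷ ps) = cong₂ _+_ (cong 𝟙 (≡ᵇ-refl l)) (count-all l xs ps)

count-none : ∀ l (xs : List (ℕ × X)) → All (λ x → (l ≡ᵇ proj₁ x) ≡ false) xs → count l xs ≡ 0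
count-none l []       _        = refl
count-none l (x ∷ xs) (p ∷ ps) = cong₂ _+_ (cong 𝟙 p) (count-none l xs ps)

-- The largest label occurs in the first class only, so its count is the number of items selected
-- there; the remaining counts concern the remaining classes.
one-per-class : ∀ (cs : List (List X)) {sel} → sel ⊆ items cs → (∀ l → l < length cs → count l sel ≡ 1) →
                Pointwise _∈_ (map proj₂ sel) cs
one-per-class []       []  h = []
one-per-class (c ∷ cs) s h with ⊆-split (map (length cs ,_) c) s
... | as , bs , refl , s₁ , s₂ = go as s₁ (trans (sym (trans (count-++ (length cs) as bs)
        (trans (cong₂ _+_ (count-all (length cs) as aslab)
          (count-none (length cs) bs (All.map (proj₂ ∘ ≡ᵇ-<) bslab))) (+-identityʳ _))))
        (h (length cs) ≤-refl))
  where
  aslab : All (λ x → proj₁ x ≡ length cs) as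
  aslab = Sublist.All-resp-⊆ s₁ (All.map⁺ (All.universal (λ _ → refl) c))
  bslab : All (λ x → proj₁ x < length cs) bs
  bslab = Sublist.All-resp-⊆ s₂ (items-label cs)
  rest : Pointwise _∈_ (map proj₂ bs) cs
  rest = one-per-class cs s₂ λ l l< → trans
    (sym (trans (count-++ l as bs) (cong (_+ count l bs) (count-none l as (All.map (λ { refl → proj₁ (≡ᵇ-< l<) }) aslab)))))
    (h l (m≤n⇒m≤1+n l<))
  go : ∀ as → as ⊆ map (length cs ,_) c → length as ≡ 1 → Pointwise _∈_ (map proj₂ (as ++ bs)) (c ∷ cs)
  go (a ∷ []) sa _ = All.lookup (All.map⁺ {P = λ x → proj₂ x ∈ c} (All.tabulate id)) (to∈ sa) ∷ rest

choose : ∀ {rs} (cs : List (List X)) → Pointwise _∈_ rs cs →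
         ∃[ sel ] sel ⊆ items cs × map proj₂ sel ≡ rs × map proj₁ sel ≡ downFrom (length cs)
choose []       []       = [] , [] , refl , refl
choose (c ∷ cs) (i ∷ is) with choose cs is
... | sel , s , refl , e = (length cs , _) ∷ sel , Sublist.++⁺
  (from∈ (∈-map⁺ (length cs ,_) i)) s , refl , cong (length cs ∷_) e

sum-indicator : ∀ l n → l < n → sum (map (λ k → 𝟙 (l ≡ᵇ k)) (downFrom n)) ≡ 1
sum-indicator l (suc n) l<1+n with m≤n⇒m<n∨m≡n (s≤s⁻¹ l<1+n)
... | inj₁ l<n  = cong₂ _+_ (cong 𝟙 (proj₁ (≡ᵇ-< l<n))) (sum-indicator l n l<n)
... | inj₂ refl = cong₂ _+_ (cong 𝟙 (≡ᵇ-refl l)) (none l ≤-refl)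
  where
  none : ∀ m → m ≤ l → sum (map (λ k → 𝟙 (l ≡ᵇ k)) (downFrom m)) ≡ 0
  none zero    _ = refl
  none (suc m) h = cong₂ _+_ (cong 𝟙 (proj₂ (≡ᵇ-< h))) (none m (≤-trans (n≤1+n m) h))

map-≡⇒ : ∀ {f g : X → ℕ} {xs} → map f xs ≡ map g xs → ∀ {x} → x ∈ xs → f x ≡ g x
map-≡⇒ {xs = _ ∷ _} e (here refl) = proj₁ (∷-injective e)
map-≡⇒ {xs = _ ∷ _} e (there i)   = map-≡⇒ (proj₂ (∷-injective e)) i

⇒map-≡ : ∀ {f g : X → Y} xs → All (λ x → f x ≡ g x) xs → map f xs ≡ map g xs
⇒map-≡ []       []       = refl
⇒map-≡ (x ∷ xs) (p ∷ ps) = cong₂ _∷_ p (⇒map-≡ xs ps)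

-- The pigeonhole principle: each element of `xs` uses up an occurrence in `ys`. It serves to bound
-- the number of due dates by the number of labels.
unique-length : ∀ (xs ys : List ℕ) → AllPairs _≢_ xs → All (_∈ ys) xs → length xs ≤ length ys
unique-length []       ys _          _        = z≤n
unique-length (x ∷ xs) ys (d ∷ ds) (i ∷ is) with ∈-∃++ i
... | as , bs , refl = ≤-trans (s≤s (unique-length xs (as ++ bs) ds (All.zipWith without (d , is))))
    (≤-reflexive (trans (cong suc (length-++ as)) (trans (sym (+-suc (length as) (length bs)))
      (sym (length-++ as)))))
  where
  without : ∀ {y} → x ≢ y × y ∈ as ++ x ∷ bs → y ∈ as ++ bs
  without (x≢y , j) with ∈-++⁻ as j
  ... | inj₁ j′           = ∈-++⁺ˡ j′
  ... | inj₂ (here refl)  = ⊥-elim (x≢y refl)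
  ... | inj₂ (there j′)   = ∈-++⁺ʳ as j′

-- Multiple-choice vector sums as flow shops

Choice : ℕ → List (List Row) → Row → Set
Choice w cs T = ∃[ rs ] Pointwise _∈_ rs cs × colsum w rs ≡ T

module Choose (cs : List (List Row)) (T : Row) where

  N : ℕ
  N = length cs

  ones : Row
  ones = map (λ _ → 1) (downFrom N)

  body : ℕ × Row → Row
  body (l , r) = r ++ map (λ k → 𝟙 (k ≡ᵇ l)) (downFrom N)

  -- `L` bounds all that has to fit into one digit: the slack `N + N` of the due dates, every column
  -- sum of selected rows, the number of selected jobs, and the digits of the target. As x < 2 ^ x,
  -- all of these are below the base 2 ^ L.
  L V : ℕ
  L = N + N + (sum (map (λ x → sum (1 ∷ body x)) (items cs)) + sum (T ++ ones))
  V = num L (T ++ ones)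

  -- The lowest digit 1 makes processing times positive; the lowest digits of the
  -- due dates make them distinct without affecting the other digits.
  weightOf dueOf : ℕ × Row → ℕ
  weightOf x = num L (1 ∷ body x)
  dueOf (l , _) = num L (N + suc l ∷ T ++ ones)

  mkJob : ℕ × Row → Job 2
  mkJob x = record
    { processing   = weightOf x Vec.∷ 1 Vec.∷ Vec.[]
    ; due          = dueOf x
    ; weight       = weightOf x
    ; processing>0 = λ { zero → s≤s z≤n ; (suc zero) → s≤s z≤n }
    ; due>0        = ≤-trans (≤-trans (s≤s z≤n) (m≤n+m _ N)) (m≤m+n _ _)
    ; weight>0     = s≤s z≤n
    }

  instance′ : FlowShop 2
  instance′ = record
    { #jobs  = length (items cs)
    ; jobs   = Vec.map mkJob (fromList (items cs))
    -- The lowest digit of a total weight is the number of selected jobs; with 0 in the target it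
    -- does not affect the comparison of the higher digits.
    ; target = ℤ.+ num L (0 ∷ T ++ ones)
    }

  open FlowShop instance′ using (JITSchedule; totalWeight; #dueDates; target; #jobs)

  unit₂ : UnitOnSecondMachine instance′
  unit₂ = lookup-All mkJob {λ J → lookup (Job.processing J) (suc zero) ≡ 1}
    (All.universal (λ _ → refl) (items cs))

  weights : ∀ E → sum (select E (p₁ instance′ unit₂ E)) ≡ sum (map weightOf (pick (items cs) E))
  weights E = cong sum (select-lookup mkJob (λ J → lookup (Job.processing J) zero) (items cs) E)

  total : ∀ E → totalWeight E ≡ sum (map weightOf (pick (items cs) E))
  total E = trans (totalWeight-select instance′ unit₂ E)
    (cong sum (select-lookup mkJob Job.weight (items cs) E))

  -- `dueOf` depends on the label only, and the labels are the numbers below `N`.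
  #dueDates≤ : #dueDates ≤ N
  #dueDates≤ = ≤-trans
    (unique-length _ (map (λ l → dueOf (l , [])) (downFrom N)) (deduplicate-! _)
      (All.tabulate λ i → within (∈-deduplicate⁻ _≟_ _ i)))
    (≤-reflexive (trans (length-map (λ l → dueOf (l , [])) (downFrom N)) (length-downFrom N)))
    where
    within : ∀ {x} → x ∈ map (FlowShop.d instance′) (allFin #jobs) → x ∈ map (λ l → dueOf (l , [])) (downFrom N)
    within i with ∈-map⁻ (FlowShop.d instance′) i
    ... | j , _ , refl = lookup-All mkJob {λ J → Job.due J ∈ map (λ l → dueOf (l , [])) (downFrom N)}
          (All.map (λ h → ∈-map⁺ _ (∈-downFrom⁺ h)) (items-label cs)) j

  length-ones : length ones ≡ length (downFrom N)
  length-ones = length-map _ (downFrom N)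

  Base : ℕ
  Base = 2 ^ L

  ≤L⇒<Basease : ∀ {x} → x ≤ L → x < Base
  ≤L⇒<Basease h = ≤-trans (s≤s h) (n<2^n L)

  module _ (w : ℕ) (widths : All (All (λ r → length r ≡ w)) cs) (width : length T ≡ w) where

    K = length (downFrom N)

    item-width : All (λ (_ , r) → length r ≡ w) (items cs)
    item-width = All.map (λ (c , i , j) → All.lookup (All.lookup widths i) j) (items-∈ cs)

    body-width : All (λ x → length (body x) ≡ w + K) (items cs)
    body-width = All.map (λ {x} p → trans (length-++ (proj₂ x)) (cong₂ _+_ p (length-map _ (downFrom N)))) item-width

    ones-width : length (T ++ ones) ≡ w + K
    ones-width = trans (length-++ T) (cong₂ _+_ width length-ones)

    module Selected {sel} (s : sel ⊆ items cs) where

      U : ℕ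
      U = num L (colsum (w + K) (map body sel))

      weight-sum : sum (map weightOf sel) ≡ length sel + Base * U
      weight-sum = begin
        sum (map weightOf sel)                                   ≡⟨ cong sum (map-∘ sel) ⟩
        sum (map (num L) (map (λ x → 1 ∷ body x) sel))           ≡⟨ sym
          (num-colsum L (suc (w + K)) _ (All.map⁺ (All.map (cong suc)
          (Sublist.All-resp-⊆ s body-width)))) ⟩
        num L (colsum (suc (w + K)) (map (λ x → 1 ∷ body x) sel)) ≡⟨ cong (num L)
          (colsum-∷ (w + K) (λ _ → 1) body sel) ⟩
        sum (map (λ _ → 1) sel) + Base * U                          ≡⟨ cong (_+ Base * U) (ones-length sel) ⟩
        length sel + Base * U                                       ∎
        where
        open ≡-Reasoning
        ones-length : ∀ (xs : List (ℕ × Row)) → sum (map (λ _ → 1) xs) ≡ length xs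
        ones-length []       = refl
        ones-length (_ ∷ xs) = cong suc (ones-length xs)

      rowsum≤L : sum (map (λ x → sum (1 ∷ body x)) sel) ≤ L
      rowsum≤L = ≤-trans (sum-⊆ (λ x → sum (1 ∷ body x)) s) (≤-trans (m≤m+n _ _) (m≤n+m _ (N + N)))

      length≤L : length sel ≤ L
      length≤L = ≤-trans (go sel) rowsum≤L
        where
        go : ∀ xs → length xs ≤ sum (map (λ x → sum (1 ∷ body x)) xs)
        go []       = z≤n
        go (x ∷ xs) = s≤s (≤-trans (go xs) (m≤n+m _ (sum (body x))))

      columns-bounded : All (_< Base) (colsum (w + K) (map body sel))
      columns-bounded = All.map (λ h → ≤L⇒<Basease (≤-trans h (≤-trans (go sel) rowsum≤L)))
        (colsum≤sum (w + K) (map body sel))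
        where
        go : ∀ xs → sum (map sum (map body xs)) ≤ sum (map (λ x → sum (1 ∷ body x)) xs)
        go []       = z≤n
        go (x ∷ xs) = +-mono-≤ (n≤1+n _) (go xs)

      columns-split : colsum (w + K) (map body sel) ≡
                      colsum w (map proj₂ sel) ++ map (λ k → count k sel) (downFrom N)
      columns-split = trans (colsum-++ w K proj₂ _ sel (Sublist.All-resp-⊆ s item-width))
        (cong (colsum w (map proj₂ sel) ++_) (colsum-map (λ x k → 𝟙 (k ≡ᵇ proj₁ x)) (downFrom N) sel))

      proj-width : length (colsum w (map proj₂ sel)) ≡ length T
      proj-width = trans (length-colsum w _ (All.map⁺ (Sublist.All-resp-⊆ s item-width))) (sym width)

    yes⇒choice : (∃[ E ] JITSchedule E × target ℤ.≤ ℤ.+ totalWeight E) → Choice w cs T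
    yes⇒choice (E , S , W≤) = map proj₂ sel , one-per-class cs s counts , proj₁ split
      where
      sel = pick (items cs) E
      s = pick-⊆ (items cs) E
      open Selected s
      short : length sel + Base * U ≤ N + N + Base * V
      short = subst (_≤ N + N + Base * V) (trans (weights E) weight-sum)
        (schedule-packs instance′ unit₂ E S (N + N + Base * V)
          (lookup-All mkJob {λ J → Job.due J ≤ suc (N + N + Base * V)}
          (All.map (λ h → ≤-trans (+-monoˡ-≤ (Base * V) (+-monoʳ-≤ N h)) (n≤1+n _)) (items-label cs))))
      heavy : 0 + Base * V ≤ length sel + Base * U
      heavy = ≤-trans (ℤ.drop‿+≤+ W≤) (≤-reflexive (trans (total E) weight-sum))
      same : colsum (w + K) (map body sel) ≡ T ++ ones
      same = num-injective L _ _ (trans (length-colsum (w + K) _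
        (All.map⁺ (Sublist.All-resp-⊆ s body-width))) (sym ones-width))
        columns-bounded (All.map (λ h → ≤L⇒<Basease (≤-trans h
          (≤-trans (m≤n+m _ _) (m≤n+m _ (N + N))))) (all≤sum (T ++ ones)))
        -- `short` and `heavy` compare numbers whose lowest digits are below the base; discarding
        -- these digits leaves `U ≤ V` and `V ≤ U`.
        (≤-antisym (lex {Base} {length sel} short (≤L⇒<Basease (m≤m+n (N + N) _)))
          (lex {Base} {0} heavy (≤L⇒<Basease length≤L)))
      split : colsum w (map proj₂ sel) ≡ T × map (λ k → count k sel) (downFrom N) ≡ ones
      split = ++-splits _ T proj-width (trans (sym columns-split) same)
      counts : ∀ l → l < N → count l sel ≡ 1
      counts l h = map-≡⇒ (proj₂ split) (∈-downFrom⁺ h)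

    choice⇒yes : Choice w cs T → ∃[ E ] JITSchedule E × target ℤ.≤ ℤ.+ totalWeight E
    choice⇒yes (rs , is , e) with choose cs is
    ... | sel , s , refl , labels with ⊆-pick s
    ... | E , refl = E , schedule , ℤ.+≤+ (≤-trans (m≤n+m (Base * V) (length sel))
      (≤-reflexive (sym (trans (total E) weighs))))
      where
      open Selected s
      length-sel : length sel ≡ N
      length-sel = trans (sym (length-map proj₁ sel)) (trans (cong length labels) (length-downFrom N))
      same : colsum (w + K) (map body sel) ≡ T ++ ones
      same = trans columns-split (cong₂ _++_ e (⇒map-≡ (downFrom N) (All.tabulate (λ i → one (∈-downFrom⁻ i)))))
        where
        one : ∀ {l} → l < N → count l sel ≡ 1
        one {l} h = trans (cong sum (map-∘ sel)) (trans
          (cong (λ ls → sum (map (λ k → 𝟙 (l ≡ᵇ k)) ls)) labels) (sum-indicator l N h))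
      weighs : sum (map weightOf sel) ≡ length sel + Base * V
      weighs = trans weight-sum (cong (λ z → length sel + Base * num L z) same)
      schedule : JITSchedule E
      -- The `N` selected jobs, each with lowest digit 1, fill the first machine exactly up to
      -- `N + Base * V`; the due date with label l lies `suc l` later.
      schedule = schedule-from instance′ unit₂ E (N + Base * V)
        (≤-reflexive (trans (weights E) (trans weighs (cong (_+ Base * V) length-sel))))
        (lookup-All mkJob {λ J → N + Base * V < Job.due J} (All.universal
          (λ (l , _) → ≤-trans (s≤s (+-monoˡ-≤ (Base * V) (m≤m+n N l)))
            (≤-reflexive (cong (_+ Base * V) (sym (+-suc N l))))) (items cs)))
        (AllPairs-select (λ ne e → ne (sym e)) E (FlowShop.d instance′)
          (subst (AllPairs _≢_) (sym (select-lookup mkJob Job.due (items cs) E))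
            (AllPairs.map⁺ (AllPairs.map (λ ne e → ne
              (suc-injective (+-cancelˡ-≡ N _ _ (+-cancelʳ-≡ (Base * V) _ _ e))))
              (AllPairs.map⁻ (subst (AllPairs _≢_) (sym labels) (Unique.downFrom⁺ N)))))))

-- A perfect binary tree of depth d with numbers at its leaves stands for a
-- monomial of degree 2 ^ d, or for a tuple of 2 ^ d slots.
MonoT PathT : ℕ → Ty
MonoT zero    = nat
MonoT (suc d) = MonoT d ⊗ MonoT d
PathT zero    = unit
PathT (suc d) = bool ⊗ PathT d

Mono Path : ℕ → Set
Mono d = ⟦ MonoT d ⟧
Path d = ⟦ PathT d ⟧

leaf : ∀ d → Mono d → Path d → ℕ
leaf zero    m       _           = m
leaf (suc d) (a , b) (true , q)  = leaf d a q
leaf (suc d) (a , b) (false , q) = leaf d b q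

paths : ∀ d → List (Path d)
paths zero    = [ tt ]
paths (suc d) = map (true ,_) (paths d) ++ map (false ,_) (paths d)

tuples : ∀ d → ℕ → List (Mono d)
tuples zero    n = downFrom n
tuples (suc d) n = cartesianProduct (tuples d n) (tuples d n)

eqM : ∀ d → Mono d → Mono d → Bool
eqM zero    m       n       = m ≡ᵇ n
eqM (suc d) (a , b) (x , y) = eqM d a x ∧ eqM d b y

mapM : ∀ d → (ℕ → ℕ) → Mono d → Mono d
mapM zero    f m       = f m
mapM (suc d) f (a , b) = mapM d f a , mapM d f b

∈-paths : ∀ d q → q ∈ paths d
∈-paths zero    _           = here refl
∈-paths (suc d) (true , q)  = ∈-++⁺ˡ (∈-map⁺ (true ,_) (∈-paths d q))
∈-paths (suc d) (false , q) = ∈-++⁺ʳ (map (true ,_) (paths d)) (∈-map⁺ (false ,_) (∈-paths d q))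

leaf-ext : ∀ d {a b : Mono d} → (∀ q → leaf d a q ≡ leaf d b q) → a ≡ b
leaf-ext zero    h = h tt
leaf-ext (suc d) h = cong₂ _,_ (leaf-ext d (λ q → h (true , q))) (leaf-ext d (λ q → h (false , q)))

leaf-mapM : ∀ d f m q → leaf d (mapM d f m) q ≡ f (leaf d m q)
leaf-mapM zero    f m       q           = refl
leaf-mapM (suc d) f (a , b) (true , q)  = leaf-mapM d f a q
leaf-mapM (suc d) f (a , b) (false , q) = leaf-mapM d f b q

∈-tuples⁺ : ∀ d {n m} → (∀ q → leaf d m q < n) → m ∈ tuples d n
∈-tuples⁺ zero    h = ∈-downFrom⁺ (h tt)
∈-tuples⁺ (suc d) h = ∈-cartesianProduct⁺ (∈-tuples⁺ d (λ q → h (true , q))) (∈-tuples⁺ d (λ q → h (false , q)))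

∈-tuples⁻ : ∀ d {n m} → m ∈ tuples d n → ∀ q → leaf d m q < n
∈-tuples⁻ zero    i q = ∈-downFrom⁻ i
∈-tuples⁻ (suc d) {n} i (true , q)  = ∈-tuples⁻ d (proj₁ (∈-cartesianProduct⁻ (tuples d n) (tuples d n) i)) q
∈-tuples⁻ (suc d) {n} i (false , q) = ∈-tuples⁻ d (proj₂ (∈-cartesianProduct⁻ (tuples d n) (tuples d n) i)) q

tuples-unique : ∀ d n → Unique (tuples d n)
tuples-unique zero    n = Unique.downFrom⁺ n
tuples-unique (suc d) n = Unique.cartesianProduct⁺ (tuples-unique d n) (tuples-unique d n)

eqM-refl : ∀ d m → eqM d m m ≡ true
eqM-refl zero    m       = ≡ᵇ-refl m
eqM-refl (suc d) (a , b) = cong₂ _∧_ (eqM-refl d a) (eqM-refl d b)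

eqM-sound : ∀ d {m m′} → eqM d m m′ ≡ true → m ≡ m′
eqM-sound zero    {m} {m′} e = ≡ᵇ⇒≡ m m′ (subst T (sym e) tt)
eqM-sound (suc d) {a , b} {x , y} e with eqM d a x in e₁ | eqM d b y in e₂
... | true | true = cong₂ _,_ (eqM-sound d e₁) (eqM-sound d e₂)

eqM-≢ : ∀ d {m m′} → m ≢ m′ → eqM d m m′ ≡ false
eqM-≢ d {m} {m′} ne with eqM d m m′ in e
... | true  = ⊥-elim (ne (eqM-sound d e))
... | false = refl

-- Finite sums

Σ[_] : List X → (X → ℕ) → ℕ
Σ[ xs ] f = sum (map f xs)

Σ-++ : ∀ (xs ys : List X) f → Σ[ xs ++ ys ] f ≡ Σ[ xs ] f + Σ[ ys ] f
Σ-++ xs ys f = trans (cong sum (map-++ f xs ys)) (sum-++ (map f xs) (map f ys))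

Σ-map : ∀ (xs : List X) (g : X → Y) f → Σ[ map g xs ] f ≡ Σ[ xs ] (f ∘ g)
Σ-map xs g f = cong sum (sym (map-∘ xs))

Σ-cong : ∀ (xs : List X) {f g : X → ℕ} → (∀ {x} → x ∈ xs → f x ≡ g x) → Σ[ xs ] f ≡ Σ[ xs ] g
Σ-cong xs h = cong sum (⇒map-≡ xs (All.tabulate h))

Σ-zero : ∀ (xs : List X) → Σ[ xs ] (λ _ → 0) ≡ 0
Σ-zero []       = refl
Σ-zero (x ∷ xs) = Σ-zero xs

Σ-const : ∀ (xs : List X) c → Σ[ xs ] (λ _ → c) ≡ length xs * c
Σ-const []       c = refl
Σ-const (x ∷ xs) c = cong (c +_) (Σ-const xs c)

Σ-+ : ∀ (xs : List X) f g → Σ[ xs ] (λ x → f x + g x) ≡ Σ[ xs ] f + Σ[ xs ] g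
Σ-+ []       f g = refl
Σ-+ (x ∷ xs) f g = trans (cong (f x + g x +_) (Σ-+ xs f g)) (eq (f x) (g x) (Σ[ xs ] f) (Σ[ xs ] g))
  where
  eq : ∀ a b c d → a + b + (c + d) ≡ a + c + (b + d)
  eq = solve-∀

Σ-*ˡ : ∀ (xs : List X) c f → Σ[ xs ] (λ x → c * f x) ≡ c * Σ[ xs ] f
Σ-*ˡ []       c f = sym (*-zeroʳ c)
Σ-*ˡ (x ∷ xs) c f = trans (cong (c * f x +_) (Σ-*ˡ xs c f)) (sym (*-distribˡ-+ c (f x) _))

Σ-swap : ∀ (xs : List X) (ys : List Y) (f : X → Y → ℕ) → Σ[ xs ] (λ x → Σ[ ys ] (f x)) ≡ Σ[ ys ]
  (λ y → Σ[ xs ] (λ x → f x y))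
Σ-swap []       ys f = sym (Σ-zero ys)
Σ-swap (x ∷ xs) ys f = trans (cong (Σ[ ys ] (f x) +_) (Σ-swap xs ys f)) (sym (Σ-+ ys (f x) _))

Σ-product : ∀ (xs : List X) (ys : List Y) f g →
            Σ[ cartesianProduct xs ys ] (λ (x , y) → f x * g y) ≡ Σ[ xs ] f * Σ[ ys ] g
Σ-product []       ys f g = refl
Σ-product (x ∷ xs) ys f g = begin
  Σ[ map (x ,_) ys ++ cartesianProduct xs ys ] (λ (x , y) → f x * g y)
    ≡⟨ Σ-++ (map (x ,_) ys) _ _ ⟩
  Σ[ map (x ,_) ys ] (λ (x , y) → f x * g y) + Σ[ cartesianProduct xs ys ] (λ (x , y) → f x * g y)
    ≡⟨ cong₂ _+_ (trans (Σ-map ys (x ,_) _) (Σ-*ˡ ys (f x) g)) (Σ-product xs ys f g) ⟩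
  f x * Σ[ ys ] g + Σ[ xs ] f * Σ[ ys ] g
    ≡⟨ sym (*-distribʳ-+ (Σ[ ys ] g) (f x) _) ⟩
  (f x + Σ[ xs ] f) * Σ[ ys ] g ∎
  where open ≡-Reasoning

𝟙-∧ : ∀ a b → 𝟙 (a ∧ b) ≡ 𝟙 a * 𝟙 b
𝟙-∧ true  b = sym (+-identityʳ (𝟙 b))
𝟙-∧ false b = refl

𝟙-not : ∀ b → 𝟙 (not b) + 𝟙 b ≡ 1
𝟙-not true  = refl
𝟙-not false = refl

-- A weight-k set {v₁ < … < v_k} of positive numbers is represented by its gaps
-- v_k − v_{k−1}, …, v₁ − v₀, where v₀ = 0 stands for the constant true.

slot : List ℕ → ℕ → ℕ
slot []       s = 0
-- The first gap lies between slot `length δs` and the next one, so it only counts for slots beyond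
-- `length δs`.
slot (δ ∷ δs) s = (if s ≤ᵇ length δs then 0 else δ) + slot δs s

member : List ℕ → ℕ → Bool
member []       x = x ≡ᵇ 0
member (δ ∷ δs) x = (x ≡ᵇ δ + sum δs) ∨ member δs x

mval : (ℕ → Bool) → ∀ d → Mono d → ℕ
mval S zero    v       = 𝟙 (S v)
mval S (suc d) (a , b) = mval S d a * mval S d b

≤ᵇ-true : ∀ {m n} → m ≤ n → (m ≤ᵇ n) ≡ true
≤ᵇ-true {m} {n} h with m ≤ᵇ n | ≤⇒≤ᵇ h
... | true | _ = refl

≤ᵇ-false : ∀ {m n} → n < m → (m ≤ᵇ n) ≡ false
≤ᵇ-false {m} {n} h with m ≤ᵇ n in e
... | false = refl
... | true  = contradiction (≤ᵇ⇒≤ m n (subst T (sym e) tt)) (<⇒≱ h)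

slot-beyond : ∀ δs s → length δs ≤ s → slot δs s ≡ sum δs
slot-beyond []       s h = refl
slot-beyond (δ ∷ δs) s h = cong₂ _+_ (cong (λ b → if b then 0 else δ) (≤ᵇ-false h))
  (slot-beyond δs s (≤-trans (n≤1+n _) h))

slot-within : ∀ δ δs s → s ≤ length δs → slot (δ ∷ δs) s ≡ slot δs s
slot-within δ δs s h = cong (λ b → (if b then 0 else δ) + slot δs s) (≤ᵇ-true h)

slot≤sum : ∀ δs s → slot δs s ≤ sum δs
slot≤sum []       s = z≤n
slot≤sum (δ ∷ δs) s = +-mono-≤ (le (s ≤ᵇ length δs)) (slot≤sum δs s)
  where
  le : ∀ b → (if b then 0 else δ) ≤ δ
  le true  = z≤n
  le false = ≤-refl

member≤sum : ∀ δs x → member δs x ≡ true → x ≤ sum δs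
member≤sum []       x e = ≤-reflexive (≡ᵇ⇒≡ x 0 (subst T (sym e) tt))
member≤sum (δ ∷ δs) x e with x ≡ᵇ δ + sum δs in e₁
... | true  = ≤-reflexive (≡ᵇ⇒≡ x _ (subst T (sym e₁) tt))
... | false = ≤-trans (member≤sum δs x e) (m≤n+m _ δ)

-- Positive gaps make the slots strictly increasing, so a number occurs in at most one of them.
slots-member : ∀ δs → All (1 ≤_) δs → ∀ x → Σ[ downFrom (suc (length δs)) ]
  (λ s → 𝟙 (x ≡ᵇ slot δs s)) ≡ 𝟙 (member δs x)
slots-member []       _        x = +-identityʳ _
slots-member (δ ∷ δs) (p ∷ ps) x = begin
  𝟙 (x ≡ᵇ slot (δ ∷ δs) (suc (length δs))) + Σ[ downFrom (suc (length δs)) ] (λ s → 𝟙 (x ≡ᵇ slot (δ ∷ δs) s))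
    ≡⟨ cong₂ _+_ (cong (λ v → 𝟙 (x ≡ᵇ v)) (slot-beyond (δ ∷ δs) _ ≤-refl))
        (Σ-cong (downFrom (suc (length δs))) (λ i → cong (λ v → 𝟙 (x ≡ᵇ v))
          (slot-within δ δs _ (s≤s⁻¹ (∈-downFrom⁻ i))))) ⟩
  𝟙 (x ≡ᵇ δ + sum δs) + Σ[ downFrom (suc (length δs)) ] (λ s → 𝟙 (x ≡ᵇ slot δs s))
    ≡⟨ cong (𝟙 (x ≡ᵇ δ + sum δs) +_) (slots-member δs ps x) ⟩
  𝟙 (x ≡ᵇ δ + sum δs) + 𝟙 (member δs x)
    ≡⟨ disjoint ⟩
  𝟙 ((x ≡ᵇ δ + sum δs) ∨ member δs x) ∎
  where
  open ≡-Reasoning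
  disjoint : 𝟙 (x ≡ᵇ δ + sum δs) + 𝟙 (member δs x) ≡ 𝟙 ((x ≡ᵇ δ + sum δs) ∨ member δs x)
  disjoint with x ≡ᵇ δ + sum δs in e₁ | member δs x in e₂
  ... | true  | true  = contradiction (≤-trans (+-monoˡ-≤ (sum δs) p)
    (≤-trans (≤-reflexive (sym (≡ᵇ⇒≡ x _ (subst T (sym e₁) tt)))) (member≤sum δs x e₂))) (<-irrefl refl)
  ... | true  | false = refl
  ... | false | _     = refl

-- Summing over all tuples of slots evaluates a monomial.
tuples-mval : ∀ d δs → All (1 ≤_) δs → ∀ m →
              Σ[ tuples d (suc (length δs)) ] (λ I → 𝟙 (eqM d m (mapM d (slot δs) I))) ≡ mval (member δs) d m
tuples-mval zero    δs ps m       = slots-member δs ps m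
tuples-mval (suc d) δs ps (a , b) = begin
  Σ[ cartesianProduct Is Is ] (λ (x , y) → 𝟙 (eqM d a (mapM d (slot δs) x) ∧ eqM d b (mapM d (slot δs) y)))
    ≡⟨ Σ-cong (cartesianProduct Is Is) (λ {(x , y)} _ → 𝟙-∧ (eqM d a (mapM d (slot δs) x)) (eqM d b (mapM d (slot δs) y))) ⟩
  Σ[ cartesianProduct Is Is ] (λ (x , y) → 𝟙 (eqM d a (mapM d (slot δs) x)) * 𝟙 (eqM d b (mapM d (slot δs) y)))
    ≡⟨ Σ-product Is Is (λ x → 𝟙 (eqM d a (mapM d (slot δs) x))) (λ y → 𝟙 (eqM d b (mapM d (slot δs) y))) ⟩
  _ ≡⟨ cong₂ _*_ (tuples-mval d δs ps a) (tuples-mval d δs ps b) ⟩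
  mval (member δs) d a * mval (member δs) d b ∎
  where
  open ≡-Reasoning
  Is = tuples d (suc (length δs))

-- A polynomial is the difference of two sums of monomials.
SPoly : ℕ → Set
SPoly d = List (Mono d) × List (Mono d)

Vanishes : ∀ d → SPoly d → List ℕ → Set
Vanishes d (P , Q) δs = Σ[ P ] (mval (member δs) d) ≡ Σ[ Q ] (mval (member δs) d)

-- Vanishing of a polynomial as a choice of rows

module Encoding (d n k : ℕ) (P Q : List (Mono d)) where

  Col : Set
  Col = Mono d × Path d

  Is : List (Mono d)
  Is = tuples d (suc k)

  cols : List Col
  cols = cartesianProduct Is (paths d)

  -- The coefficient of m in P - Q, shifted by `length Q` to be non-negative. Over all tuples the
  -- shifts add up to the first entry of `target`.
  coef : Mono d → ℕ
  coef m = Σ[ P ] (λ m′ → 𝟙 (eqM d m′ m)) + Σ[ Q ] (λ m′ → 𝟙 (not (eqM d m′ m)))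

  Entry : Set
  Entry = ℕ × (Col → ℕ)

  row : Entry → Row
  row (c , φ) = c ∷ map φ cols

  slotE : ℕ → ℕ → Entry
  slotE i δ = 0 , λ (I , q) → if leaf d I q ≤ᵇ i then 0 else δ

  -- Rows can only be added, so a leaf enters through its complement: in the column of a tuple and a
  -- path, the sum n says that the leaf of the chosen monomial equals the slot.
  tupleE : Mono d → Mono d → Entry
  tupleE I m = coef m , λ (I′ , q) → if eqM d I′ I then n ∸ leaf d m q else 0

  slotClasses tupleClasses classes : List (List Row)
  slotClasses  = map (λ i → map (λ δ → row (slotE i (suc δ))) (downFrom n)) (downFrom k)
  tupleClasses = map (λ I → map (λ m → row (tupleE I m)) (tuples d (suc n))) Is
  classes      = slotClasses ++ tupleClasses

  target : Row
  target = length Is * length Q ∷ map (λ _ → n) cols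

  w : ℕ
  w = suc (length cols)

  target-width : length target ≡ w
  target-width = cong suc (length-map _ cols)

  widths : All (All (λ r → length r ≡ w)) classes
  widths = All.++⁺
    (All.map⁺ (All.universal (λ i → All.map⁺ (All.universal (λ δ → row-width (slotE i (suc δ)))
      (downFrom n))) (downFrom k)))
    (All.map⁺ (All.universal (λ I → All.map⁺ (All.universal (λ m → row-width (tupleE I m))
      (tuples d (suc n)))) Is))
    where
    row-width : ∀ e → length (row e) ≡ w
    row-width e = cong suc (length-map _ cols)

  colsum-rows : ∀ es → colsum w (map row es) ≡ Σ[ es ] proj₁ ∷ map (λ c → Σ[ es ] (λ e → proj₂ e c)) cols
  colsum-rows es = trans (colsum-∷ (length cols) proj₁ (λ e → map (proj₂ e) cols) es)
    (cong (Σ[ es ] proj₁ ∷_) (colsum-map proj₂ cols es))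

  slotEs : List ℕ → List Entry
  slotEs []       = []
  slotEs (δ ∷ δs) = slotE (length δs) δ ∷ slotEs δs

  tupleEs : List (Mono d × Mono d) → List Entry
  tupleEs = map (λ (I , m) → tupleE I m)

  slotEs-head : ∀ δs → Σ[ slotEs δs ] proj₁ ≡ 0
  slotEs-head []       = refl
  slotEs-head (δ ∷ δs) = slotEs-head δs

  slotEs-col : ∀ δs I q → Σ[ slotEs δs ] (λ e → proj₂ e (I , q)) ≡ slot δs (leaf d I q)
  slotEs-col []       I q = refl
  slotEs-col (δ ∷ δs) I q = cong ((if leaf d I q ≤ᵇ length δs then 0 else δ) +_) (slotEs-col δs I q)

  tupleEs-col : ∀ ps → Unique (map proj₁ ps) → ∀ {I m} q → (I , m) ∈ ps →
                Σ[ tupleEs ps ] (λ e → proj₂ e (I , q)) ≡ n ∸ leaf d m q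
  tupleEs-col ((I , m) ∷ ps) (ne ∷ _) q (here refl) = trans
    (cong₂ _+_ (cong (λ b → if b then n ∸ leaf d m q else 0) (eqM-refl d I)) (others ps (All.map⁻ ne)))
    (+-identityʳ _)
    where
    others : ∀ ps → All (λ p → I ≢ proj₁ p) ps → Σ[ tupleEs ps ] (λ e → proj₂ e (I , q)) ≡ 0
    others []       _          = refl
    others (p ∷ ps) (ne ∷ nes) = cong₂ _+_ (cong (λ b → if b then n ∸ leaf d (proj₂ p) q else 0)
      (eqM-≢ d ne)) (others ps nes)
  tupleEs-col ((J , m′) ∷ ps) (ne ∷ u) {I} q (there i) = trans
    (cong (_+ Σ[ tupleEs ps ] (λ e → proj₂ e (I , q)))
      (cong (λ b → if b then n ∸ leaf d m′ q else 0) (eqM-≢ d (λ e → All.lookup (All.map⁻ ne) i (sym e)))))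
    (tupleEs-col ps u q i)

  -- After exchanging the sums, `tuples-mval` applies to each monomial. A monomial of Q is counted
  -- at the tuples that miss it, that is, `length Is` times minus its value.
  coef-sum : ∀ δs → length δs ≡ k → All (1 ≤_) δs →
             Σ[ Is ] (λ I → coef (mapM d (slot δs) I)) + Σ[ Q ] (mval (member δs) d) ≡
             Σ[ P ] (mval (member δs) d) + length Is * length Q
  coef-sum δs refl ps = begin
    Σ[ Is ] (λ I → coef (v I)) + Σ[ Q ] mv
      ≡⟨ cong (_+ Σ[ Q ] mv) (Σ-+ Is (λ I → Σ[ P ] (λ m → eq m I)) (λ I → Σ[ Q ] (λ m → ne m I))) ⟩
    Σ[ Is ] (λ I → Σ[ P ] (λ m → eq m I)) + Σ[ Is ] (λ I → Σ[ Q ] (λ m → ne m I)) + Σ[ Q ] mv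
      ≡⟨ cong₂ (λ a b → a + b + Σ[ Q ] mv) (Σ-swap Is P (λ I m → eq m I)) (Σ-swap Is Q (λ I m → ne m I)) ⟩
    Σ[ P ] (λ m → Σ[ Is ] (eq m)) + Σ[ Q ] (λ m → Σ[ Is ] (ne m)) + Σ[ Q ] mv
      ≡⟨ cong (λ z → z + Σ[ Q ] (λ m → Σ[ Is ] (ne m)) + Σ[ Q ] mv) (Σ-cong P (λ {m} _ → tuples-mval d δs ps m)) ⟩
    Σ[ P ] mv + Σ[ Q ] (λ m → Σ[ Is ] (ne m)) + Σ[ Q ] mv
      ≡⟨ +-assoc (Σ[ P ] mv) _ _ ⟩
    Σ[ P ] mv + (Σ[ Q ] (λ m → Σ[ Is ] (ne m)) + Σ[ Q ] mv)
      ≡⟨ cong (Σ[ P ] mv +_) (sym (Σ-+ Q (λ m → Σ[ Is ] (ne m)) mv)) ⟩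
    Σ[ P ] mv + Σ[ Q ] (λ m → Σ[ Is ] (ne m) + mv m)
      ≡⟨ cong (Σ[ P ] mv +_) (Σ-cong Q (λ {m} _ → all m)) ⟩
    Σ[ P ] mv + Σ[ Q ] (λ _ → length Is)
      ≡⟨ cong (Σ[ P ] mv +_) (trans (Σ-const Q (length Is)) (*-comm (length Q) (length Is))) ⟩
    Σ[ P ] mv + length Is * length Q ∎
    where
    open ≡-Reasoning
    mv = mval (member δs) d
    v = mapM d (slot δs)
    eq ne : Mono d → Mono d → ℕ
    eq m I = 𝟙 (eqM d m (v I))
    ne m I = 𝟙 (not (eqM d m (v I)))
    all : ∀ m → Σ[ Is ] (ne m) + mv m ≡ length Is
    all m = trans (cong (Σ[ Is ] (ne m) +_) (sym (tuples-mval d δs ps m)))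
      (trans (sym (Σ-+ Is (ne m) (eq m)))
        (trans (Σ-cong Is (λ {I} _ → 𝟙-not (eqM d m (v I)))) (trans (Σ-const Is 1) (*-identityʳ _))))

  Gaps : List ℕ → Set
  Gaps δs = length δs ≡ k × All (1 ≤_) δs × sum δs ≤ n

  graph : List ℕ → List (Mono d × Mono d)
  graph δs = map (λ I → I , mapM d (slot δs) I) Is

  graph-head : ∀ δs → Σ[ tupleEs (graph δs) ] proj₁ ≡ Σ[ Is ] (λ I → coef (mapM d (slot δs) I))
  graph-head δs = trans (Σ-map (graph δs) (λ (I , m) → tupleE I m) proj₁)
    (Σ-map Is (λ I → I , mapM d (slot δs) I) (coef ∘ proj₂))

  graph-fst : ∀ δs → map proj₁ (graph δs) ≡ Is
  graph-fst δs = trans (sym (map-∘ Is)) (map-id Is)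

  head-sum : ∀ δs ps → Σ[ slotEs δs ++ tupleEs ps ] proj₁ ≡ Σ[ tupleEs ps ] proj₁
  head-sum δs ps = trans (Σ-++ (slotEs δs) _ proj₁) (cong (_+ Σ[ tupleEs ps ] proj₁) (slotEs-head δs))

  col-sum : ∀ δs ps I q → Σ[ slotEs δs ++ tupleEs ps ] (λ e → proj₂ e (I , q)) ≡
            slot δs (leaf d I q) + Σ[ tupleEs ps ] (λ e → proj₂ e (I , q))
  col-sum δs ps I q = trans (Σ-++ (slotEs δs) _ _) (cong (_+ Σ[ tupleEs ps ] (λ e → proj₂ e (I , q)))
    (slotEs-col δs I q))

  encode : ∀ δs → Gaps δs → Vanishes d (P , Q) δs → Choice w classes target
  encode δs (refl , pos , ≤n) van = map row es , chosen , trans (colsum-rows es) (cong₂ _∷_ head (⇒map-≡ cols (All.tabulate (λ {c} i → column c i))))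
    where
    es = slotEs δs ++ tupleEs (graph δs)
    slots∈ : ∀ δs → All (1 ≤_) δs → sum δs ≤ n →
             Pointwise _∈_ (map row (slotEs δs)) (map
               (λ i → map (λ δ → row (slotE i (suc δ))) (downFrom n)) (downFrom (length δs)))
    slots∈ []           _             _ = []
    slots∈ (suc δ ∷ δs) (s≤s _ ∷ ps) h =
      ∈-map⁺ _ (∈-downFrom⁺ (≤-trans (m≤m+n (suc δ) _) h)) ∷ slots∈ δs ps (≤-trans (m≤n+m _ (suc δ)) h)
    tuples∈ : ∀ Is → Pointwise _∈_ (map row (tupleEs (map (λ I → I , mapM d (slot δs) I) Is)))
                       (map (λ I → map (λ m → row (tupleE I m)) (tuples d (suc n))) Is)
    tuples∈ []       = []
    tuples∈ (I ∷ Is) = ∈-map⁺ (λ m → row (tupleE I m))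
      (∈-tuples⁺ d (λ q → s≤s (≤-trans (≤-reflexive (leaf-mapM d (slot δs) I q))
      (≤-trans (slot≤sum δs _) ≤n)))) ∷ tuples∈ Is
    chosen : Pointwise _∈_ (map row es) classes
    chosen = subst (λ rs → Pointwise _∈_ rs classes) (sym (map-++ row (slotEs δs) _))
      (Pointwise.++⁺ (slots∈ δs pos ≤n) (tuples∈ Is))
    head : Σ[ es ] proj₁ ≡ length Is * length Q
    head = +-cancelˡ-≡ (Σ[ Q ] (mval (member δs) d)) _ _ (begin
      Σ[ Q ] mv + Σ[ es ] proj₁    ≡⟨ +-comm (Σ[ Q ] mv) _ ⟩
      Σ[ es ] proj₁ + Σ[ Q ] mv    ≡⟨ cong (_+ Σ[ Q ] mv) (trans (head-sum δs (graph δs)) (graph-head δs)) ⟩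
      Σ[ Is ] (λ I → coef (mapM d (slot δs) I)) + Σ[ Q ] mv ≡⟨ coef-sum δs refl pos ⟩
      Σ[ P ] mv + length Is * length Q ≡⟨ cong (_+ length Is * length Q) van ⟩
      Σ[ Q ] mv + length Is * length Q ∎)
      where
      open ≡-Reasoning
      mv = mval (member δs) d
    column : ∀ c → c ∈ cols → Σ[ es ] (λ e → proj₂ e c) ≡ n
    column (I , q) i = trans (col-sum δs (graph δs) I q) (trans (cong (slot δs (leaf d I q) +_)
      (trans (tupleEs-col (graph δs) (subst Unique (sym (graph-fst δs)) (tuples-unique d (suc k))) q
          (∈-map⁺ (λ I → I , mapM d (slot δs) I) (proj₁ (∈-cartesianProduct⁻ Is (paths d) i))))
        (cong (n ∸_) (leaf-mapM d (slot δs) I q))))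
      (m+[n∸m]≡n (≤-trans (slot≤sum δs _) ≤n)))

  decode : Choice w classes target → ∃[ δs ] Gaps δs × Vanishes d (P , Q) δs
  decode (rs , is , e) with splitᵖ slotClasses is
    where
    splitᵖ : ∀ {rs : List Row} cs {ds} → Pointwise _∈_ rs (cs ++ ds) →
             ∃[ as ] ∃[ bs ] rs ≡ as ++ bs × Pointwise _∈_ as cs × Pointwise _∈_ bs ds
    splitᵖ []       ps       = [] , _ , refl , [] , ps
    splitᵖ (c ∷ cs) (p ∷ ps) with splitᵖ cs ps
    ... | as , bs , refl , qs , qs′ = _ ∷ as , bs , refl , p ∷ qs , qs′
  ... | as , bs , refl , sl , tu with slotsOf k sl | tuplesOf Is tu
    where
    slotsOf : ∀ k {as} → Pointwise _∈_ as (map (λ i → map (λ δ → row (slotE i (suc δ))) (downFrom n))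
      (downFrom k)) →
              ∃[ δs ] length δs ≡ k × All (1 ≤_) δs × as ≡ map row (slotEs δs)
    slotsOf zero    []       = [] , refl , [] , refl
    slotsOf (suc k) (p ∷ ps) with slotsOf k ps | ∈-map⁻ (λ δ → row (slotE k (suc δ))) p
    ... | δs , refl , pos , refl | δ , _ , refl = suc δ ∷ δs , refl , s≤s z≤n ∷ pos , refl
    tuplesOf : ∀ Js {bs} → Pointwise _∈_ bs (map (λ I → map (λ m → row (tupleE I m)) (tuples d (suc n))) Js) →
               ∃[ ps ] map proj₁ ps ≡ Js × All (λ p → proj₂ p ∈ tuples d (suc n)) ps × bs ≡ map row (tupleEs ps)
    tuplesOf []       []       = [] , refl , [] , refl
    tuplesOf (I ∷ Js) (p ∷ ps) with tuplesOf Js ps | ∈-map⁻ (λ m → row (tupleE I m)) p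
    ... | qs , refl , ms , refl | m , m∈ , refl = (I , m) ∷ qs , refl , m∈ ∷ ms , refl
  ... | δs , len , pos , refl | ps , fsts , ms , refl = δs , (len , pos , sum≤n) , van
    where
    es = slotEs δs ++ tupleEs ps
    sums : Σ[ es ] proj₁ ∷ map (λ c → Σ[ es ] (λ e → proj₂ e c)) cols ≡ target
    sums = trans (sym (colsum-rows es)) (trans (cong (colsum w) (map-++ row (slotEs δs) (tupleEs ps))) e)
    column : ∀ {I m} q → (I , m) ∈ ps → slot δs (leaf d I q) + (n ∸ leaf d m q) ≡ n
    column {I} {m} q i = trans
      (sym (trans (col-sum δs ps I q) (cong (slot δs (leaf d I q) +_)
        (tupleEs-col ps (subst Unique (sym fsts) (tuples-unique d (suc k))) q i))))
      (map-≡⇒ (proj₂ (∷-injective sums)) (∈-cartesianProduct⁺ (subst (I ∈_) fsts (∈-map⁺ proj₁ i))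
        (∈-paths d q)))
    leaf≤n : ∀ {I m} q → (I , m) ∈ ps → leaf d m q ≤ n
    leaf≤n q i = s≤s⁻¹ (∈-tuples⁻ d (All.lookup ms i) q)
    agree : ∀ {I m} q → (I , m) ∈ ps → slot δs (leaf d I q) ≡ leaf d m q
    agree {I} {m} q i = +-cancelʳ-≡ (n ∸ leaf d m q) _ _ (trans (column q i) (sym (m+[n∸m]≡n (leaf≤n q i))))
    is-graph : ∀ qs → All (λ (I , m) → m ≡ mapM d (slot δs) I) qs → qs ≡ map
      (λ I → I , mapM d (slot δs) I) (map proj₁ qs)
    is-graph []       []         = refl
    is-graph (_ ∷ qs) (refl ∷ h) = cong (_ ∷_) (is-graph qs h)
    ps≡ : ps ≡ graph δs
    ps≡ = trans (is-graph ps (All.tabulate (λ {(I , m)} i → leaf-ext d (λ q → trans (sym (agree q i)) (sym (leaf-mapM d (slot δs) I q))))))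
      (cong (map (λ I → I , mapM d (slot δs) I)) fsts)
    constM : ∀ d → Mono d
    constM zero    = k
    constM (suc d) = constM d , constM d
    leaf-const : ∀ d q → leaf d (constM d) q ≡ k
    leaf-const zero    q           = refl
    leaf-const (suc d) (true , q)  = leaf-const d q
    leaf-const (suc d) (false , q) = leaf-const d q
    somePath : ∀ d → Path d
    somePath zero    = tt
    somePath (suc d) = true , somePath d
    sum≤n : sum δs ≤ n
    -- The classes bound each gap by n, but not their sum. The tuple with slot k at every leaf does:
    -- slot k is the sum of all gaps, and it agrees with a leaf, which is at most n.
    sum≤n with ∈-map⁻ proj₁ (subst (constM d ∈_) (sym fsts)
      (∈-tuples⁺ d {suc k} (λ q → s≤s (≤-reflexive (leaf-const d q)))))
    ... | (I , m) , i , eq = ≤-trans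
      (≤-reflexive (trans (sym (slot-beyond δs (leaf d I (somePath d))
        (≤-reflexive (trans len (trans (sym (leaf-const d (somePath d)))
        (cong (λ J → leaf d J (somePath d)) eq))))))
        (agree (somePath d) i))) (leaf≤n (somePath d) i)
    van : Vanishes d (P , Q) δs
    van = sym (+-cancelˡ-≡ (length Is * length Q) _ _ (begin
      length Is * length Q + Σ[ Q ] mv ≡⟨ cong (_+ Σ[ Q ] mv) (sym (proj₁ (∷-injective sums))) ⟩
      Σ[ es ] proj₁ + Σ[ Q ] mv        ≡⟨ cong (_+ Σ[ Q ] mv)
        (trans (head-sum δs ps) (trans (cong (λ z → Σ[ tupleEs z ] proj₁) ps≡) (graph-head δs))) ⟩
      Σ[ Is ] (λ I → coef (mapM d (slot δs) I)) + Σ[ Q ] mv ≡⟨ coef-sum δs len pos ⟩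
      Σ[ P ] mv + length Is * length Q ≡⟨ +-comm (Σ[ P ] mv) _ ⟩
      length Is * length Q + Σ[ P ] mv ∎))
      where
      open ≡-Reasoning
      mv = mval (member δs) d

-- Every gate has the form out ⊕ ⋀ⱼ (inn ⊕ xⱼ); the components are a flag for
-- inputs, inn, out and the operands.
NGate : Set
NGate = Bool × Bool × Bool × List ℕ

normalise : Maybe (Gate ℕ) → NGate
normalise nothing          = true , false , false , []
normalise (just (notᵍ i))  = false , true , false , [ i ]
normalise (just (andᵍ is)) = false , false , false , is
normalise (just (orᵍ is))  = false , true , true , is

nodes : ∀ {n m} → Circuit n m → List (Maybe (Gate ℕ))
nodes {n} inputs = replicate n nothing
nodes (C ▷ g)    = just (mapGate toℕ g) ∷ nodes C

normalised : ∀ {n m} → Circuit n m → List NGate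
normalised C = map normalise (nodes C)

-- The monomial 1, as the number 0 stands for the constant true; it pads variables to full degree.
topM : ∀ d → Mono d
topM zero    = 0
topM (suc d) = topM d , topM d

varM : ∀ d → ℕ → Mono d
varM zero    v = v
varM (suc d) v = varM d v , topM d

oneP : ∀ d → SPoly d
oneP d = [ topM d ] , []

varP : ∀ d → ℕ → SPoly d
varP d v = [ varM d v ] , []

-- 1 - (P - Q) = (1 + Q) - P.
negIf : ∀ d → Bool → SPoly d → SPoly d
negIf d b (P , Q) = if b then (topM d ∷ Q , P) else (P , Q)

addP : ∀ {d} → SPoly d → SPoly d → SPoly d
addP (P , Q) (P′ , Q′) = P ++ P′ , Q ++ Q′

mulP : ∀ {d} → SPoly d → SPoly d → SPoly (suc d)
mulP (P , Q) (P′ , Q′) =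
  cartesianProduct P P′ ++ cartesianProduct Q Q′ , cartesianProduct P Q′ ++ cartesianProduct Q P′

-- The value of the first node of a circuit of depth at most d without large
-- gates.
valueP : ∀ d → List NGate → SPoly d
-- At depth 0 the first node is an input, and its number is the length of the list that starts with
-- it.
valueP zero    C = varP zero (length C)
valueP (suc d) C = elimList C (oneP (suc d)) λ ((isInput , inn , out , js) , C′) →
  -- A missing operand counts as 1, which is neutral for conjunctions.
  let arg = λ js → elimList js (oneP d) (λ (j , _) → negIf d inn (valueP d (drop j C′)))
  in if isInput then varP (suc d) (suc (length C′))
     else negIf (suc d) out (mulP (arg js) (arg (drop 1 js)))

large : List ℕ → Bool
large js = 3 ≤ᵇ length js

-- Polynomials with non-negative values, one of which vanishes if and only if
-- the first node of the circuit of depth at most e has value b.  Each of them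
-- counts the false ones among some literals.
dnf : ∀ D → ℕ → List NGate → Bool → List (SPoly D)
dnf D zero    C b = [ negIf D b (valueP D C) ]
dnf D (suc e) C b = elimList C [] λ ((isInput , inn , out , js) , C′) →
  -- The literal `inn xor x` is true if and only if x is `not inn`. A missing operand contributes
  -- the zero polynomial, which always vanishes.
  let arg = λ js → elimList js [ ([] , []) ] (λ (j , _) → dnf D e (drop j C′) (not inn))
      -- Each polynomial is 1 if its literal is false and 0 otherwise.
      all = map (λ j → negIf D (not inn) (valueP D (drop j C′))) js
  in if isInput then [ negIf D b (valueP D C) ]
     -- The conjunction must have the value `b xor out`. If it is to be true and large, weft 1
     -- leaves no large gates below, so one sum of literals does; if small, the alternatives of its
     -- operands are added in pairs. If it is to be false, some operand has the value `inn`, and the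
     -- alternatives are joined.
     else (if b xor out
           then (if large js then [ concatMap proj₁ all , concatMap proj₂ all ]
                 else map (λ (p , q) → addP p q) (cartesianProduct (arg js) (arg (drop 1 js))))
           else concatMap (λ j → dnf D e (drop j C′) inn) js)

-- Values of polynomials under an assignment

module Semantics (A : ℕ → Bool) (A0 : A 0 ≡ true) where

  Counts : ∀ d → SPoly d → ℕ → Set
  Counts d (P , Q) y = Σ[ P ] (mval A d) ≡ Σ[ Q ] (mval A d) + y

  mval-top : ∀ d → mval A d (topM d) ≡ 1
  mval-top zero    = cong 𝟙 A0
  mval-top (suc d) = cong₂ _*_ (mval-top d) (mval-top d)

  mval-var : ∀ d v → mval A d (varM d v) ≡ 𝟙 (A v)
  mval-var zero    v = refl
  mval-var (suc d) v = trans (cong₂ _*_ (mval-var d v) (mval-top d)) (*-identityʳ _)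

  counts-one : ∀ d → Counts d (oneP d) 1
  counts-one d = trans (+-identityʳ _) (mval-top d)

  counts-var : ∀ d v → Counts d (varP d v) (𝟙 (A v))
  counts-var d v = trans (+-identityʳ _) (mval-var d v)

  counts-neg : ∀ d b p {v} → Counts d p (𝟙 v) → Counts d (negIf d b p) (𝟙 (b xor v))
  counts-neg d false p       h = h
  counts-neg d true  (P , Q) {v} h = trans (cong (_+ Σ[ Q ] (mval A d)) (mval-top d))
    (trans (+-comm 1 _) (trans (cong (Σ[ Q ] (mval A d) +_) (sym (trans (+-comm (𝟙 v) _) (𝟙-not v))))
      (trans (sym (+-assoc (Σ[ Q ] (mval A d)) (𝟙 v) _)) (cong (_+ 𝟙 (not v)) (sym h)))))

  counts-mul : ∀ d p q {u v} → Counts d p (𝟙 u) → Counts d q (𝟙 v) → Counts (suc d) (mulP p q) (𝟙 (u ∧ v))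
  counts-mul d (P , Q) (P′ , Q′) {u} {v} h h′ = begin
    Σ[ cartesianProduct P P′ ++ cartesianProduct Q Q′ ] (mval A (suc d))
      ≡⟨ both P P′ Q Q′ ⟩
    Σ[ P ] m * Σ[ P′ ] m + Σ[ Q ] m * Σ[ Q′ ] m
      ≡⟨ cong₂ (λ a b → a * b + Σ[ Q ] m * Σ[ Q′ ] m) h h′ ⟩
    (Σ[ Q ] m + 𝟙 u) * (Σ[ Q′ ] m + 𝟙 v) + Σ[ Q ] m * Σ[ Q′ ] m
      ≡⟨ eq (Σ[ Q ] m) (Σ[ Q′ ] m) (𝟙 u) (𝟙 v) ⟩
    (Σ[ Q ] m + 𝟙 u) * Σ[ Q′ ] m + Σ[ Q ] m * (Σ[ Q′ ] m + 𝟙 v) + 𝟙 u * 𝟙 v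
      ≡⟨ cong₂ _+_ (cong₂ (λ a b → a * Σ[ Q′ ] m + Σ[ Q ] m * b) (sym h) (sym h′)) (sym (𝟙-∧ u v)) ⟩
    Σ[ P ] m * Σ[ Q′ ] m + Σ[ Q ] m * Σ[ P′ ] m + 𝟙 (u ∧ v)
      ≡⟨ cong (_+ 𝟙 (u ∧ v)) (sym (both P Q′ Q P′)) ⟩
    Σ[ cartesianProduct P Q′ ++ cartesianProduct Q P′ ] (mval A (suc d)) + 𝟙 (u ∧ v) ∎
    where
    open ≡-Reasoning
    m = mval A d
    both : ∀ P P′ Q Q′ → Σ[ cartesianProduct P P′ ++ cartesianProduct Q Q′ ]
      (mval A (suc d)) ≡ Σ[ P ] m * Σ[ P′ ] m + Σ[ Q ] m * Σ[ Q′ ] m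
    both P P′ Q Q′ = trans (Σ-++ (cartesianProduct P P′) _ _)
      (cong₂ _+_ (Σ-product P P′ m m) (Σ-product Q Q′ m m))
    eq : ∀ q q′ u v → (q + u) * (q′ + v) + q * q′ ≡ (q + u) * q′ + q * (q′ + v) + u * v
    eq = solve-∀

  counts-add : ∀ d p q {y z} → Counts d p y → Counts d q z → Counts d (addP p q) (y + z)
  counts-add d (P , Q) (P′ , Q′) {y} {z} h h′ = trans (Σ-++ P P′ (mval A d)) (trans (cong₂ _+_ h h′)
    (trans (eq (Σ[ Q ] (mval A d)) y (Σ[ Q′ ] (mval A d)) z) (cong (_+ (y + z)) (sym (Σ-++ Q Q′ (mval A d))))))
    where
    eq : ∀ a b c d → a + b + (c + d) ≡ a + c + (b + d)
    eq = solve-∀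

  counts-all : ∀ d (f : X → SPoly d) (v : X → Bool) js → All (λ j → Counts d (f j) (𝟙 (v j))) js →
               Counts d (concatMap proj₁ (map f js) , concatMap proj₂ (map f js)) (Σ[ js ] (𝟙 ∘ v))
  counts-all d f v []       []       = refl
  counts-all d f v (j ∷ js) (h ∷ hs) = counts-add d (f j) (_ , _) h (counts-all d f v js hs)

  counts-unique : ∀ d p {y z} → Counts d p y → Counts d p z → y ≡ z
  counts-unique d (P , Q) h h′ = +-cancelˡ-≡ (Σ[ Q ] (mval A d)) _ _ (trans (sym h) h′)

  -- `natural` says that no value is negative. This is what makes a sum of two polynomials vanish
  -- only if both do, as `decides-sums` requires.
  record Decides d (ps : List (SPoly d)) (c : Bool) : Set where
    field
      natural  : All (λ p → ∃[ y ] Counts d p y) ps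
      complete : c ≡ true → Any (λ p → Counts d p 0) ps
      sound    : Any (λ p → Counts d p 0) ps → c ≡ true

  open Decides public

  decides-one : ∀ {d p y c} → Counts d p y → (c ≡ true → y ≡ 0) → (y ≡ 0 → c ≡ true) → Decides d [ p ] c
  decides-one {d} {p} h to from = record
    { natural  = (_ , h) ∷ []
    ; complete = λ e → here (subst (Counts d p) (to e) h)
    ; sound    = λ { (here h′) → from (counts-unique d p h h′) } }

  decides-literal : ∀ {d p v} → Counts d p (𝟙 v) → Decides d [ p ] (not v)
  decides-literal {v = v} h = decides-one h (to v) (from v)
    where
    to : ∀ v → not v ≡ true → 𝟙 v ≡ 0
    to false _ = refl
    from : ∀ v → 𝟙 v ≡ 0 → not v ≡ true
    from false _ = refl

  decides-sums : ∀ {d ps qs c c′} → Decides d ps c → Decides d qs c′ →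
                 Decides d (map (λ (p , q) → addP p q) (cartesianProduct ps qs)) (c ∧ c′)
  decides-sums {d} {ps} {qs} {c} {c′} h h′ = record
    { natural  = naturals ps (natural h)
    ; complete = comp c c′ refl refl
    ; sound    = λ a → let a₁ , a₂ = snd ps (natural h) a in cong₂ _∧_ (sound h a₁) (sound h′ a₂) }
    where
    sums : List (SPoly d) → List (SPoly d)
    sums ps = map (λ (p , q) → addP p q) (cartesianProduct ps qs)
    split : ∀ p ps → sums (p ∷ ps) ≡ map (addP p) qs ++ sums ps
    split p ps = trans (map-++ _ (map (p ,_) qs) _) (cong (_++ sums ps) (sym (map-∘ qs)))
    naturals : ∀ ps → All (λ p → ∃[ y ] Counts d p y) ps → All (λ p → ∃[ y ] Counts d p y) (sums ps)
    naturals []       _              = []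
    naturals (p ∷ ps) ((_ , k) ∷ ks) = subst (All _) (sym (split p ps))
      (All.++⁺ (All.map⁺ (All.map (λ {q} (_ , k′) → _ , counts-add d p q k k′) (natural h′))) (naturals ps ks))
    comp : ∀ a b → c ≡ a → c′ ≡ b → a ∧ b ≡ true → Any (λ p → Counts d p 0) (sums ps)
    comp true true e e′ _ = go ps (complete h e)
      where
      go : ∀ ps → Any (λ p → Counts d p 0) ps → Any (λ p → Counts d p 0) (sums ps)
      go (p ∷ ps) (here k)  = subst (Any _) (sym (split p ps)) (Any.++⁺ˡ (Any.map⁺ (Any.map (λ {q} k′ → counts-add d p q k k′) (complete h′ e′))))
      go (p ∷ ps) (there a) = subst (Any _) (sym (split p ps)) (Any.++⁺ʳ (map (addP p) qs) (go ps a))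
    snd : ∀ ps → All (λ p → ∃[ y ] Counts d p y) ps → Any (λ p → Counts d p 0) (sums ps) →
          Any (λ p → Counts d p 0) ps × Any (λ p → Counts d p 0) qs
    snd (p ∷ ps) ((y , k) ∷ ks) a with Any.++⁻ (map (addP p) qs) (subst (Any _) (split p ps) a)
    ... | inj₂ a′ = let a₁ , a₂ = snd ps ks a′ in there a₁ , a₂
    ... | inj₁ a′ = both qs (natural h′) (Any.map⁻ a′)
      where
      both : ∀ qs → All (λ p → ∃[ y ] Counts d p y) qs → Any (λ q → Counts d (addP p q) 0) qs →
             Any (λ p → Counts d p 0) (p ∷ ps) × Any (λ p → Counts d p 0) qs
      both (q ∷ qs) ((z , k′) ∷ _) (here e) =
        let y+z≡0 = counts-unique d (addP p q) (counts-add d p q k k′) e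
        in here (subst (Counts d p) (m+n≡0⇒m≡0 y y+z≡0) k) , here (subst (Counts d q) (m+n≡0⇒n≡0 y y+z≡0) k′)
      both (q ∷ qs) (_ ∷ ks) (there a) = let a₁ , a₂ = both qs ks a in a₁ , there a₂

  decides-concat : ∀ {d} (f : X → List (SPoly d)) c js → All (λ j → Decides d (f j) (c j)) js →
                   Decides d (concatMap f js) (or (map c js))
  decides-concat f c []       []       = record { natural = [] ; complete = λ () ; sound = λ () }
  decides-concat {d = d} f c (j ∷ js) (h ∷ hs) = record
    { natural  = All.++⁺ (natural h) (natural rest)
    ; complete = comp (c j) refl
    ; sound    = λ a → snd (Any.++⁻ (f j) a) }
    where
    rest = decides-concat f c js hs
    comp : ∀ b → c j ≡ b → b ∨ or (map c js) ≡ true → Any (λ p → Counts d p 0) (f j ++ concatMap f js)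
    comp true  e _  = Any.++⁺ˡ (complete h e)
    comp false e e′ = Any.++⁺ʳ (f j) (complete rest e′)
    snd : Any (λ p → Counts d p 0) (f j) ⊎ Any (λ p → Counts d p 0) (concatMap f js) → c j ∨ or
      (map c js) ≡ true
    snd (inj₁ a) = cong (_∨ or (map c js)) (sound h a)
    snd (inj₂ a) with c j | sound rest a
    ... | true  | _ = refl
    ... | false | e = e

-- Correctness of the expansion of a circuit

operands-mapGate : ∀ {V W : Set} (f : V → W) g → operands (mapGate f g) ≡ map f (operands g)
operands-mapGate f (notᵍ w)  = refl
operands-mapGate f (andᵍ ws) = refl
operands-mapGate f (orᵍ ws)  = refl

inn out : ∀ {W : Set} → Gate W → Bool
inn (notᵍ _) = true
inn (andᵍ _) = false
inn (orᵍ _)  = true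
out (notᵍ _) = false
out (andᵍ _) = false
out (orᵍ _)  = true

normalise-gate : ∀ {m} (g : Gate (Fin m)) →
                 normalise (just (mapGate toℕ g)) ≡ (false , inn g , out g , map toℕ (operands g))
normalise-gate (notᵍ w)  = refl
normalise-gate (andᵍ ws) = refl
normalise-gate (orᵍ ws)  = refl

eval-gate : ∀ {W : Set} (f : W → Bool) g →
            evalGate (mapGate f g) ≡ out g xor and (map (λ j → inn g xor f j) (operands g))
eval-gate f (notᵍ w)  = sym (∧-identityʳ (not (f w)))
eval-gate f (andᵍ ws) = refl
eval-gate f (orᵍ ws)  = deMorgan ws
  where
  deMorgan : ∀ ws → or (map f ws) ≡ not (and (map (λ j → not (f j)) ws))
  deMorgan []       = refl
  deMorgan (w ∷ ws) with f w
  ... | true  = refl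
  ... | false = deMorgan ws

all≤maximum : ∀ xs → All (_≤ maximum xs) xs
all≤maximum []       = []
all≤maximum (x ∷ xs) = m≤m⊔n x _ ∷ All.map (λ h → ≤-trans h (m≤n⊔m x _)) (all≤maximum xs)

operands≤ : ∀ {W : Set} (f : W → ℕ) g {b} → maximum (operands (mapGate f g)) ≤ b → All (λ j → f j ≤ b)
  (operands g)
operands≤ f g h = All.map (λ p → ≤-trans p h)
  (All.map⁻ (subst (λ xs → All (_≤ maximum (operands (mapGate f g))) xs) (operands-mapGate f g)
    (all≤maximum (operands (mapGate f g)))))

isLarge-large : ∀ {m} (f : Fin m → ℕ) g → isLarge (mapGate f g) ≡ large (map toℕ (operands g))
isLarge-large f (notᵍ w)  = refl
isLarge-large f (andᵍ ws) = cong (3 ≤ᵇ_) (trans (length-map f ws) (sym (length-map toℕ ws)))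
isLarge-large f (orᵍ ws)  = cong (3 ≤ᵇ_) (trans (length-map f ws) (sym (length-map toℕ ws)))

drop-inputs : ∀ n (i : Fin n) → ∃[ C ] drop (toℕ i) (map normalise
  (replicate n nothing)) ≡ normalise nothing ∷ C ×
              suc (length C) ≡ n ∸ toℕ i
drop-inputs (suc n) zero    = _ , refl , cong suc (trans (length-map normalise (replicate n nothing))
  (length-replicate n))
drop-inputs (suc n) (suc i) = drop-inputs n i

module Correct {n} (S : Subset n) (A : ℕ → Bool) (A0 : A 0 ≡ true)
  (agrees : ∀ j → A (n ∸ toℕ j) ≡ lookup S j) where

  open Semantics A A0

  input-value : ∀ d i → Counts d (valueP d (drop (toℕ i) (map normalise (replicate n nothing))))
    (𝟙 (lookup S i))
  input-value d i with drop-inputs n i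
  ... | C , e , l = subst₂ (λ C′ b → Counts d (valueP d C′) (𝟙 b)) (sym e) (trans (cong A l) (agrees i)) (go d)
    where
    go : ∀ d → Counts d (valueP d (normalise nothing ∷ C)) (𝟙 (A (suc (length C))))
    go zero    = counts-var zero _
    go (suc d) = counts-var (suc d) _

  gate-value : ∀ d inn out {m} (os : List (Fin m)) C (v : Fin m → Bool) → large (map toℕ os) ≡ false →
               All (λ j → Counts d (valueP d (drop (toℕ j) C)) (𝟙 (v j))) os →
               Counts (suc d) (valueP (suc d) ((false , inn , out , map toℕ os) ∷ C))
                 (𝟙 (out xor and (map (λ j → inn xor v j) os)))
  gate-value d inn out {m} os C v = go os
    where
    val lit : Fin m → SPoly d
    val j = valueP d (drop (toℕ j) C)
    lit j = negIf d inn (val j)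
    counts-lit : ∀ {j} → Counts d (val j) (𝟙 (v j)) → Counts d (lit j) (𝟙 (inn xor v j))
    counts-lit {j} = counts-neg d inn (val j) {v j}
    counts-product : ∀ p q {u u′} → Counts d p (𝟙 u) → Counts d q (𝟙 u′) →
                     Counts (suc d) (negIf (suc d) out (mulP p q)) (𝟙 (out xor (u ∧ u′)))
    counts-product p q {u} {u′} h h′ = counts-neg (suc d) out (mulP p q) {u ∧ u′}
      (counts-mul d p q {u} {u′} h h′)
    go : ∀ os → large (map toℕ os) ≡ false → All (λ j → Counts d (val j) (𝟙 (v j))) os →
         Counts (suc d) (valueP (suc d) ((false , inn , out , map toℕ os) ∷ C))
           (𝟙 (out xor and (map (λ j → inn xor v j) os)))
    go []           _ _             = counts-product (oneP d) (oneP d) {true} {true} (counts-one d)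
      (counts-one d)
    go (a ∷ [])     _ (h ∷ [])      = counts-product (lit a) (oneP d) {inn xor v a} {true}
      (counts-lit h) (counts-one d)
    go (a ∷ b ∷ []) _ (h ∷ h′ ∷ []) = counts-product (lit a)
      (lit b) {inn xor v a} {(inn xor v b) ∧ true} (counts-lit h)
      (subst (λ x → Counts d (lit b) (𝟙 x)) (sym (∧-identityʳ (inn xor v b))) (counts-lit h′))

  valueP-correct : ∀ d {m} (C : Circuit n m) i → depth C i ≤ d → weft C i ≤ 0 →
                   Counts d (valueP d (drop (toℕ i) (normalised C))) (𝟙 (evaluate C S i))
  valueP-correct d inputs  i       _ _ = input-value d i
  valueP-correct d (C ▷ g) (suc i) h h′ = valueP-correct d C i h h′
  valueP-correct (suc d) (C ▷ g) zero (s≤s h) h′ =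
    subst₂ (λ G b → Counts (suc d) (valueP (suc d) (G ∷ normalised C)) (𝟙 b)) (sym (normalise-gate g))
      (sym (eval-gate (evaluate C S) g))
      (gate-value d (inn g) (out g) (operands g) (normalised C) (evaluate C S) small
        (All.zipWith (λ {j} (p , q) → valueP-correct d C j p q) (operands≤ (depth C) g h , operands≤ (weft C) g (≤-trans (m≤n+m _ (if isLarge (mapGate (weft C) g) then 1 else 0)) h′))))
    where
    small : large (map toℕ (operands g)) ≡ false
    -- A large gate would have weft at least 1, contrary to `h′`.
    small with isLarge (mapGate (weft C) g) in e
    ... | false = trans (sym (isLarge-large (weft C) g)) e

  not-inn : ∀ a b → not (not a xor b) ≡ a xor b
  not-inn true  b = refl
  not-inn false true  = refl
  not-inn false false = refl

  not-and : ∀ {W : Set} (f : W → Bool) ws → not (and (map f ws)) ≡ or (map (not ∘ f) ws)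
  not-and f []       = refl
  not-and f (w ∷ ws) with f w
  ... | true  = not-and f ws
  ... | false = refl

  count-false : ∀ inn {W : Set} (v : W → Bool) ws →
                (and (map (λ j → inn xor v j) ws) ≡ true → Σ[ ws ] (λ j → 𝟙 (not inn xor v j)) ≡ 0) ×
                (Σ[ ws ] (λ j → 𝟙 (not inn xor v j)) ≡ 0 → and (map (λ j → inn xor v j) ws) ≡ true)
  count-false inn v []       = (λ _ → refl) , (λ _ → refl)
  count-false inn v (w ∷ ws) with inn | v w | count-false inn v ws
  ... | true  | true  | _  = (λ ()) , (λ { e → e′ e })
    where
    e′ : _ → _
    e′ ()
  ... | true  | false | ih = ih
  ... | false | true  | ih = ih
  ... | false | false | _  = (λ ()) , (λ ())

  -- The values of the operands as polynomials are demanded at large gates alone, since large gates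
  -- may still occur below a small one.
  gate-dnf : ∀ D e b inn out {m} (os : List (Fin m)) C (v : Fin m → Bool) →
             All (λ j → ∀ b → Decides D (dnf D e (drop (toℕ j) C) b) (not (b xor v j))) os →
             (large (map toℕ os) ≡ true → All (λ j → Counts D (valueP D (drop (toℕ j) C)) (𝟙 (v j))) os) →
             Decides D (dnf D (suc e) ((false , inn , out , map toℕ os) ∷ C) b)
               (not (b xor (out xor and (map (λ j → inn xor v j) os))))
  gate-dnf D e b inn out os C v hd hl rewrite sym (xor-assoc b out
    (and (map (λ j → inn xor v j) os))) with b xor out
  ... | false = subst₂ (Decides D) (concat-map os) (sym (not-and (λ j → inn xor v j) os))
        (decides-concat (λ j → dnf D e (drop (toℕ j) C) inn) (λ j → not (inn xor v j)) os
          (All.map (λ h → h inn) hd))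
    where
    concat-map : ∀ os → concatMap (λ j → dnf D e (drop (toℕ j) C) inn) os ≡ concatMap
      (λ j → dnf D e (drop j C) inn) (map toℕ os)
    concat-map []       = refl
    concat-map (o ∷ os) = cong (dnf D e (drop (toℕ o) C) inn ++_) (concat-map os)
  ... | true = subst (Decides D _) (sym (not-involutive _)) (go os hd hl)
    where
    one : ∀ {j} → (∀ b → Decides D (dnf D e (drop (toℕ j) C) b) (not (b xor v j))) →
          Decides D (dnf D e (drop (toℕ j) C) (not inn)) (inn xor v j)
    one {j} h = subst (Decides D _) (not-inn inn (v j)) (h (not inn))
    trivial : Decides D [ ([] , []) ] true
    trivial = decides-one {y = 0} refl (λ _ → refl) (λ _ → refl)
    go : ∀ os → All (λ j → ∀ b → Decides D (dnf D e (drop (toℕ j) C) b) (not (b xor v j))) os →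
         (large (map toℕ os) ≡ true → All (λ j → Counts D (valueP D (drop (toℕ j) C)) (𝟙 (v j))) os) →
         Decides D (dnf D (suc e) ((false , inn , true , map toℕ os) ∷ C) false)
           (and (map (λ j → inn xor v j) os))
    go []               _              _  = decides-sums trivial trivial
    go (i ∷ [])         (h ∷ [])       _  = decides-sums (one h) trivial
    go (i ∷ j ∷ [])     (h ∷ h′ ∷ [])  _  = decides-sums (one h)
      (subst (Decides D _) (sym (∧-identityʳ _)) (one h′))
    go os@(_ ∷ _ ∷ _ ∷ _) _ hl = subst (λ as → Decides D [ concatMap proj₁ as , concatMap proj₂ as ]
      (and (map (λ j → inn xor v j) os)))
      (map-∘ {g = λ j → negIf D (not inn) (valueP D (drop j C))} {f = toℕ} os)
      (decides-one (counts-all D (λ j → negIf D (not inn) (valueP D (drop (toℕ j) C)))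
        (λ j → not inn xor v j) os
          (All.map (λ {j} h → counts-neg D (not inn) (valueP D (drop (toℕ j) C)) {v j} h) (hl refl)))
        (proj₁ (count-false inn v os)) (proj₂ (count-false inn v os)))

  -- The degree is governed by D, which stays fixed while the depth e decreases, because polynomials
  -- from different depths are added.
  dnf-correct : ∀ D e {m} (C : Circuit n m) i → e ≤ D → depth C i ≤ e → weft C i ≤ 1 → ∀ b →
                Decides D (dnf D e (drop (toℕ i) (normalised C)) b) (not (b xor evaluate C S i))
  dnf-correct D e inputs i _ _ _ b = subst (λ ps → Decides D ps _) (sym (shape e))
    (decides-literal {v = b xor lookup S i} (counts-neg D b
      (valueP D (drop (toℕ i) (map normalise (replicate n nothing)))) {lookup S i} (input-value D i)))
    where
    shape : ∀ e → dnf D e (drop (toℕ i) (map normalise (replicate n nothing))) b ≡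
                  [ negIf D b (valueP D (drop (toℕ i) (map normalise (replicate n nothing)))) ]
    shape zero    = refl
    shape (suc e) with drop-inputs n i
    ... | C , eq , _ rewrite eq = refl
  dnf-correct D e (C ▷ g) (suc i) e≤D h h′ b = dnf-correct D e C i e≤D h h′ b
  dnf-correct D (suc e) (C ▷ g) zero e≤D (s≤s h) h′ b =
    subst₂ (λ G c → Decides D (dnf D (suc e) (G ∷ normalised C) b) (not (b xor c)))
      (sym (normalise-gate g)) (sym (eval-gate (evaluate C S) g))
      (gate-dnf D e b (inn g) (out g) (operands g) (normalised C) (evaluate C S)
        (All.zipWith (λ {j} (p , q) → dnf-correct D e C j (<⇒≤ e≤D) p q) (operands≤ (depth C) g h , operands≤ (weft C) g (≤-trans (m≤n+m _ (if isLarge (mapGate (weft C) g) then 1 else 0)) h′)))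
        (λ l → All.zipWith (λ {j} (p , q) → valueP-correct D C j (≤-trans p (<⇒≤ e≤D)) q)
          (operands≤ (depth C) g h , operands≤ (weft C) g (light l))))
    where
    light : large (map toℕ (operands g)) ≡ true → maximum (operands (mapGate (weft C) g)) ≤ 0
    -- The large gate itself uses up the weft 1, so nothing is left for its operands.
    light l = s≤s⁻¹ (subst (λ b → (if b then 1 else 0) + maximum (operands (mapGate (weft C) g)) ≤ 1)
      (trans (isLarge-large (weft C) g) l) h′)

-- Input j of n has the positive number n − j.
data GapsOf : ∀ {n} → Subset n → List ℕ → Set where
  []   : GapsOf [] []
  skip : ∀ {n} {S : Subset n} {δs} → GapsOf S δs → GapsOf (false ∷ S) δs
  take : ∀ {n} {S : Subset n} {δs} δ → GapsOf S δs → 1 ≤ δ → δ + sum δs ≡ suc n → GapsOf (true ∷ S) (δ ∷ δs)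

gaps-sum : ∀ {n} {S : Subset n} {δs} → GapsOf S δs → sum δs ≤ n
gaps-sum []             = z≤n
gaps-sum (skip r)       = m≤n⇒m≤1+n (gaps-sum r)
gaps-sum (take δ r _ e) = ≤-reflexive e

gaps-length : ∀ {n} {S : Subset n} {δs} → GapsOf S δs → length δs ≡ ∣ S ∣
gaps-length []             = refl
gaps-length (skip r)       = gaps-length r
gaps-length (take δ r _ _) = cong suc (gaps-length r)

gaps-positive : ∀ {n} {S : Subset n} {δs} → GapsOf S δs → All (1 ≤_) δs
gaps-positive []             = []
gaps-positive (skip r)       = gaps-positive r
gaps-positive (take δ r p _) = p ∷ gaps-positive r

gaps-member : ∀ {n} {S : Subset n} {δs} → GapsOf S δs → ∀ j → member δs (n ∸ toℕ j) ≡ lookup S j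
gaps-member {suc n} {δs = δs} (skip r) zero with member δs (suc n) in e
... | true  = contradiction (≤-trans (member≤sum δs (suc n) e) (gaps-sum r)) (<-irrefl refl)
... | false = refl
gaps-member (skip r) (suc j) = gaps-member r j
gaps-member {suc n} (take {δs = δs} δ r p e) zero =
  cong (_∨ member δs (suc n)) (trans (cong (suc n ≡ᵇ_) e) (≡ᵇ-refl n))
gaps-member {suc n} (take {δs = δs} δ r p e) (suc j) = trans
  (cong (_∨ member δs (n ∸ toℕ j)) (trans (cong (n ∸ toℕ j ≡ᵇ_) e) (proj₁ (≡ᵇ-< (s≤s (m∸n≤m n (toℕ j)))))))
  (gaps-member r j)

gapsOf : ∀ {n} (S : Subset n) → ∃[ δs ] GapsOf S δs
gapsOf []          = [] , []
gapsOf (false ∷ S) with gapsOf S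
... | δs , r = δs , skip r
gapsOf {suc n} (true ∷ S) with gapsOf S
... | δs , r = suc n ∸ sum δs ∷ δs ,
      take _ r (m<n⇒0<n∸m (s≤s (gaps-sum r))) (m∸n+n≡m (m≤n⇒m≤1+n (gaps-sum r)))

-- The sum of the gaps is the largest number of the set, and the first of `suc n` inputs has the
-- number `suc n`. So this input is taken exactly if the sum is `suc n`.
subsetOf : ∀ n δs → All (1 ≤_) δs → sum δs ≤ n → ∃[ S ] GapsOf {n} S δs
subsetOf zero    []       _        _ = [] , []
subsetOf zero    (δ ∷ δs) (p ∷ ps) h = contradiction (≤-trans p (≤-trans (m≤m+n δ _) h)) λ ()
subsetOf (suc n) []       ps       _ with subsetOf n [] [] z≤n
... | S , r = false ∷ S , skip r
subsetOf (suc n) (δ ∷ δs) (p ∷ ps) h with δ + sum δs ≟ suc n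
... | no ne with subsetOf n (δ ∷ δs) (p ∷ ps) (s≤s⁻¹ (≤∧≢⇒< h ne))
...   | S , r = false ∷ S , skip r
subsetOf (suc n) (δ ∷ δs) (p ∷ ps) h | yes e with subsetOf n δs ps (s≤s⁻¹ (≤-trans (+-monoˡ-≤ (sum δs) p) h))
...   | S , r = true ∷ S , take δ r p e

member-0 : ∀ δs → member δs 0 ≡ true
member-0 []       = refl
member-0 (δ ∷ δs) = trans (cong ((0 ≡ᵇ δ + sum δs) ∨_) (member-0 δs)) (∨-zeroʳ (0 ≡ᵇ δ + sum δs))

-- Satisfiability as solvability of one of the polynomials

Solvable : ∀ d → ℕ → ℕ → SPoly d → Set
Solvable d n k p = ∃[ δs ] Encoding.Gaps d n k (proj₁ p) (proj₂ p) δs × Vanishes d p δs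

module _ {n m} (D k : ℕ) (C : Circuit n m) (o : Fin m) (depth≤ : depth C o ≤ D) (weft≤ : weft C o ≤ 1) where

  polynomials : List (SPoly D)
  polynomials = dnf D D (drop (toℕ o) (normalised C)) true

  module _ (S : Subset n) δs (r : GapsOf S δs) where
    open Semantics (member δs) (member-0 δs)

    decides : Decides D polynomials (not (true xor evaluate C S o))
    decides = Correct.dnf-correct S (member δs) (member-0 δs) (gaps-member r) D D C o ≤-refl depth≤ weft≤ true

    vanishing : ∀ p → (Counts D p 0 → Vanishes D p δs) × (Vanishes D p δs → Counts D p 0)
    vanishing p = (λ h → trans h (+-identityʳ _)) , (λ h → trans h (sym (+-identityʳ _)))

  satisfiable⇒ : ∃[ S ] ∣ S ∣ ≡ k × evaluate C S o ≡ true → Any (Solvable D n k) polynomials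
  satisfiable⇒ (S , size , e) with gapsOf S
  ... | δs , r = Any.map (λ {p} h → δs , (trans (gaps-length r) size , gaps-positive r , gaps-sum r) , proj₁ (vanishing S δs r p) h)
    (Semantics.complete (decides S δs r) (cong (not ∘ not) e))

  satisfiable⇐ : Any (Solvable D n k) polynomials → ∃[ S ] ∣ S ∣ ≡ k × evaluate C S o ≡ true
  satisfiable⇐ a = go polynomials id a
    where
    go : ∀ ps → (∀ {δs} → Any (λ p → Vanishes D p δs) ps → Any (λ p → Vanishes D p δs) polynomials) →
         Any (Solvable D n k) ps → ∃[ S ] ∣ S ∣ ≡ k × evaluate C S o ≡ true
    go (p ∷ ps) emb (there a) = go ps (λ {δs} → emb {δs} ∘ there) a
    go (p ∷ ps) emb (here (δs , (len , pos , ≤n) , v)) with subsetOf n δs pos ≤n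
    ... | S , r = S , trans (sym (gaps-length r)) len ,
          trans (sym (not-involutive _)) (Semantics.sound (decides S δs r) (Any.map (λ {p} → proj₂ (vanishing S δs r p)) (emb {δs} (here v))))

-- For arrows defined by recursion on a degree or depth. `call` makes `f` the value by definition
-- and seals the program, so the terms do not unfold along the recursion.
record Impl {A B : Ty} (f : ⟦ A ⟧ → ⟦ B ⟧) : Set where
  constructor impl
  field
    by-arrow : A ⟶ B
    agrees   : ∀ x → by-arrow · x ≡ f x

call : {f : ⟦ A ⟧ → ⟦ B ⟧} → Impl {A} {B} f → A ⟶ B
call {f = f} (impl a e) = as a f e

cartₐ : Γ ⟶ list A → Γ ⟶ list B → Γ ⟶ list (A ⊗ B)
cartₐ xs ys = as (concatMapₐ xs (mapₐ (ys ⊚ π₁) (π₂ ⊚ π₁ ,ₐ π₂)))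
  (λ γ → cartesianProduct (xs · γ) (ys · γ)) (λ γ → eq (xs · γ) (ys · γ))
  where
  eq : ∀ {X Y : Set} (as : List X) (bs : List Y) → concatMap (λ a → map (a ,_) bs) as ≡ cartesianProduct as bs
  eq []       bs = refl
  eq (a ∷ as) bs = cong (map (a ,_) bs ++_) (eq as bs)

indicatorₐ : Γ ⟶ bool → Γ ⟶ nat
indicatorₐ b = as (ifₐ b (constₐ 1) (constₐ 0)) (λ γ → 𝟙 (b · γ)) (λ γ → eq (b · γ))
  where
  eq : ∀ b → (if b then 1 else 0) ≡ 𝟙 b
  eq true  = refl
  eq false = refl

-- Programs for the polynomials of a circuit

NGateT : Ty
NGateT = bool ⊗ bool ⊗ bool ⊗ list nat

normaliseₐ : gate ⟶ NGateT
normaliseₐ = as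
  (matchₐ (cast toList enc-toList)
    (constₐ (true , false , false , []))
    (constₐ false ,ₐ ifₐ (isZeroₐ kind)
      (constₐ true ,ₐ constₐ false ,ₐ consₐ (lengthₐ rest) (constₐ []))
      (ifₐ (leₐ kind (constₐ 1))
        (constₐ false ,ₐ constₐ false ,ₐ rest)
        (constₐ true ,ₐ constₐ true ,ₐ rest))))
  normalise
  (λ { nothing → refl ; (just (notᵍ i)) → cong (λ j → false , true , false , [ j ]) (length-replicate i)
     ; (just (andᵍ _)) → refl ; (just (orᵍ _)) → refl })
  where
  -- The code of a gate is reread as a list of numbers headed by its kind, 0, 1 or 2. The operand of
  -- a negation is a unary number, which reads as a list of zeros and is recovered as its length.
  toList : Maybe (Gate ℕ) → List ℕ
  toList nothing          = []
  toList (just (notᵍ i))  = 0 ∷ replicate i 0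
  toList (just (andᵍ is)) = 1 ∷ is
  toList (just (orᵍ is))  = 2 ∷ is
  enc-toList : ∀ g → enc gate g ≡ enc (list nat) (toList g)
  enc-toList nothing          = refl
  enc-toList (just (notᵍ i))  = cong (nil ∙_) (zeros i)
    where
    zeros : ∀ i → unary i ≡ enc (list nat) (replicate i 0)
    zeros zero    = refl
    zeros (suc i) = cong (nil ∙_) (zeros i)
  enc-toList (just (andᵍ is)) = refl
  enc-toList (just (orᵍ is))  = refl
  kind : gate ⊗ (nat ⊗ list nat) ⟶ nat
  kind = π₁ ⊚ π₂
  rest : gate ⊗ (nat ⊗ list nat) ⟶ list nat
  rest = π₂ ⊚ π₂

SPolyT : ℕ → Ty
SPolyT d = list (MonoT d) ⊗ list (MonoT d)

varMₐ : ∀ d → Γ ⟶ nat → Γ ⟶ MonoT d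
varMₐ d v = call (go d) ⊚ v
  where
  go : ∀ d → Impl {nat} {MonoT d} (varM d)
  go zero    = impl idₐ (λ _ → refl)
  go (suc d) = impl (call (go d) ,ₐ constₐ (topM d)) (λ _ → refl)

varPₐ : ∀ d → Γ ⟶ nat → Γ ⟶ SPolyT d
varPₐ d v = consₐ (varMₐ d v) (constₐ []) ,ₐ constₐ []

negIfₐ : ∀ d → Γ ⟶ bool → Γ ⟶ SPolyT d → Γ ⟶ SPolyT d
negIfₐ d b p = as (ifₐ b (consₐ (constₐ (topM d)) (π₂ ⊚ p) ,ₐ (π₁ ⊚ p)) p)
  (λ γ → negIf d (b · γ) (p · γ)) (λ _ → refl)

mulPₐ : ∀ d → Γ ⟶ SPolyT d → Γ ⟶ SPolyT d → Γ ⟶ SPolyT (suc d)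
mulPₐ d p q = as
  (appendₐ (cartₐ (π₁ ⊚ p) (π₁ ⊚ q)) (cartₐ (π₂ ⊚ p) (π₂ ⊚ q)) ,ₐ appendₐ (cartₐ (π₁ ⊚ p) (π₂ ⊚ q))
    (cartₐ (π₂ ⊚ p) (π₁ ⊚ q)))
  (λ γ → mulP {d} (p · γ) (q · γ)) (λ _ → refl)

tailₐ : Γ ⟶ list A → Γ ⟶ list A
tailₐ xs = dropₐ (constₐ 1) xs

valueI : ∀ d → Impl {list NGateT} {SPolyT d} (valueP d)
valueI zero    = impl (varPₐ zero (lengthₐ idₐ)) (λ _ → refl)
valueI (suc d) = impl
  (matchₐ idₐ (constₐ (oneP (suc d)))
    (ifₐ isInput (varPₐ (suc d) (sucₐ (lengthₐ rest)))
      (negIfₐ (suc d) outₐ (mulPₐ d (arg js) (arg (tailₐ js))))))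
  (λ { [] → refl ; (_ ∷ _) → refl })
  where
  Δ : Ty
  Δ = list NGateT ⊗ (NGateT ⊗ list NGateT)
  isInput innₐ outₐ : Δ ⟶ bool
  isInput = π₁ ⊚ π₁ ⊚ π₂
  innₐ    = π₁ ⊚ π₂ ⊚ π₁ ⊚ π₂
  outₐ    = π₁ ⊚ π₂ ⊚ π₂ ⊚ π₁ ⊚ π₂
  js : Δ ⟶ list nat
  js = π₂ ⊚ π₂ ⊚ π₂ ⊚ π₁ ⊚ π₂
  rest : Δ ⟶ list NGateT
  rest = π₂ ⊚ π₂
  arg : Δ ⟶ list nat → Δ ⟶ SPolyT d
  arg xs = matchₐ xs (constₐ (oneP d))
    (negIfₐ d (innₐ ⊚ π₁) (call (valueI d) ⊚ dropₐ (π₁ ⊚ π₂) (rest ⊚ π₁)))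

dnfI : ∀ D e → Impl {list NGateT ⊗ bool} {list (SPolyT D)} (λ (C , b) → dnf D e C b)
dnfI D zero    = impl (consₐ (negIfₐ D π₂ (call (valueI D) ⊚ π₁)) (constₐ [])) (λ _ → refl)
dnfI D (suc e) = impl
  (matchₐ π₁ (constₐ [])
    (ifₐ isInput (consₐ (negIfₐ D (π₂ ⊚ π₁) (call (valueI D) ⊚ π₁ ⊚ π₁)) (constₐ []))
      (ifₐ (xorₐ (π₂ ⊚ π₁) outₐ)
        (ifₐ (leₐ (constₐ 3) (lengthₐ js))
          (consₐ (concatMapₐ all (π₁ ⊚ π₂) ,ₐ concatMapₐ all (π₂ ⊚ π₂)) (constₐ []))
          (mapₐ (cartₐ (arg js) (arg (tailₐ js))) (appendₐ (π₁ ⊚ π₁ ⊚ π₂) (π₁ ⊚ π₂ ⊚ π₂) ,ₐ appendₐ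
            (π₂ ⊚ π₁ ⊚ π₂) (π₂ ⊚ π₂ ⊚ π₂))))
        (concatMapₐ js (call (dnfI D e) ⊚ (dropₐ π₂ (rest ⊚ π₁) ,ₐ (innₐ ⊚ π₁)))))))
  (λ { ([] , _) → refl ; (_ ∷ _ , _) → refl })
  where
  Δ : Ty
  Δ = (list NGateT ⊗ bool) ⊗ (NGateT ⊗ list NGateT)
  isInput innₐ outₐ : Δ ⟶ bool
  isInput = π₁ ⊚ π₁ ⊚ π₂
  innₐ    = π₁ ⊚ π₂ ⊚ π₁ ⊚ π₂
  outₐ    = π₁ ⊚ π₂ ⊚ π₂ ⊚ π₁ ⊚ π₂
  js : Δ ⟶ list nat
  js = π₂ ⊚ π₂ ⊚ π₂ ⊚ π₁ ⊚ π₂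
  rest : Δ ⟶ list NGateT
  rest = π₂ ⊚ π₂
  arg : Δ ⟶ list nat → Δ ⟶ list (SPolyT D)
  arg xs = matchₐ xs (constₐ [ ([] , []) ])
    (call (dnfI D e) ⊚ (dropₐ (π₁ ⊚ π₂) (rest ⊚ π₁) ,ₐ notₐ (innₐ ⊚ π₁)))
  all : Δ ⟶ list (SPolyT D)
  all = mapₐ js (negIfₐ D (notₐ (innₐ ⊚ π₁)) (call (valueI D) ⊚ dropₐ π₂ (rest ⊚ π₁)))

eqMₐ : ∀ d → Γ ⟶ MonoT d → Γ ⟶ MonoT d → Γ ⟶ bool
eqMₐ d a b = call (go d) ⊚ (a ,ₐ b)
  where
  go : ∀ d → Impl {MonoT d ⊗ MonoT d} {bool} (λ (a , b) → eqM d a b)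
  go zero    = impl (eqNatₐ π₁ π₂) (λ _ → refl)
  go (suc d) = impl (andₐ (call (go d) ⊚ (π₁ ⊚ π₁ ,ₐ π₁ ⊚ π₂)) (call (go d) ⊚ (π₂ ⊚ π₁ ,ₐ π₂ ⊚ π₂)))
    (λ _ → refl)

leafₐ : ∀ d → Γ ⟶ MonoT d → Γ ⟶ PathT d → Γ ⟶ nat
leafₐ d m q = call (go d) ⊚ (m ,ₐ q)
  where
  go : ∀ d → Impl {MonoT d ⊗ PathT d} {nat} (λ (m , q) → leaf d m q)
  go zero    = impl π₁ (λ _ → refl)
  go (suc d) = impl (ifₐ (π₁ ⊚ π₂) (call (go d) ⊚ (π₁ ⊚ π₁ ,ₐ π₂ ⊚ π₂)) (call (go d) ⊚ (π₂ ⊚ π₁ ,ₐ π₂ ⊚ π₂)))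
    (λ { (_ , true , _) → refl ; (_ , false , _) → refl })

tuplesₐ : ∀ d → Γ ⟶ nat → Γ ⟶ list (MonoT d)
tuplesₐ d n = call (go d) ⊚ n
  where
  go : ∀ d → Impl {nat} {list (MonoT d)} (tuples d)
  go zero    = impl (downFromₐ idₐ) (λ _ → refl)
  go (suc d) = impl (cartₐ (call (go d)) (call (go d))) (λ _ → refl)

module EncodingPrograms (d : ℕ) where

  Env : Ty
  Env = (nat ⊗ nat) ⊗ SPolyT d

  kₐ nₐ : Env ⟶ nat
  kₐ = π₁ ⊚ π₁
  nₐ = π₂ ⊚ π₁

  posₐ negₐ : Env ⟶ list (MonoT d)
  posₐ = π₁ ⊚ π₂
  negₐ = π₂ ⊚ π₂

  ColT : Ty
  ColT = MonoT d ⊗ PathT d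

  slotsₐ : Env ⟶ list (MonoT d)
  slotsₐ = tuplesₐ d (sucₐ kₐ)

  colsₐ : Env ⟶ list ColT
  colsₐ = cartₐ slotsₐ (constₐ (paths d))

  coefₐ : Env ⊗ MonoT d ⟶ nat
  coefₐ = plusₐ (sumₐ (mapₐ (posₐ ⊚ π₁) (indicatorₐ (eqMₐ d π₂ (π₂ ⊚ π₁)))))
                (sumₐ (mapₐ (negₐ ⊚ π₁) (indicatorₐ (notₐ (eqMₐ d π₂ (π₂ ⊚ π₁))))))

  slotRowₐ : (Env ⊗ nat) ⊗ nat ⟶ list nat
  slotRowₐ = consₐ (constₐ 0) (mapₐ (colsₐ ⊚ π₁ ⊚ π₁)
    (ifₐ (leₐ (leafₐ d (π₁ ⊚ π₂) (π₂ ⊚ π₂)) (π₂ ⊚ π₁ ⊚ π₁)) (constₐ 0) (sucₐ (π₂ ⊚ π₁))))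

  tupleRowₐ : (Env ⊗ MonoT d) ⊗ MonoT d ⟶ list nat
  tupleRowₐ = consₐ (coefₐ ⊚ (π₁ ⊚ π₁ ,ₐ π₂)) (mapₐ (colsₐ ⊚ π₁ ⊚ π₁)
    (ifₐ (eqMₐ d (π₁ ⊚ π₂) (π₂ ⊚ π₁ ⊚ π₁)) (monusₐ (nₐ ⊚ π₁ ⊚ π₁ ⊚ π₁) (leafₐ d (π₂ ⊚ π₁) (π₂ ⊚ π₂)))
      (constₐ 0)))

  classesₐ : Env ⟶ list (list (list nat))
  classesₐ = as
    (appendₐ (mapₐ (downFromₐ kₐ) (mapₐ (downFromₐ (nₐ ⊚ π₁)) slotRowₐ))
             (mapₐ slotsₐ (mapₐ (tuplesₐ d (sucₐ (nₐ ⊚ π₁))) tupleRowₐ)))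
    (λ ((k , n) , (P , Q)) → Encoding.classes d n k P Q) (λ _ → refl)

  targetₐ : Env ⟶ list nat
  targetₐ = as
    (consₐ (timesₐ (lengthₐ slotsₐ) (lengthₐ negₐ)) (mapₐ colsₐ (nₐ ⊚ π₁)))
    (λ ((k , n) , (P , Q)) → Encoding.target d n k P Q) (λ _ → refl)

-- Programs for the flow-shop instances

enumₐ : Γ ⟶ list A → Γ ⟶ list (nat ⊗ A)
enumₐ {Γ} {A} xs = as
  (foldrₐ (consₐ (lengthₐ (π₂ ⊚ π₂) ,ₐ (π₁ ⊚ π₂)) (π₂ ⊚ π₂)) xs (constₐ [])
    (pb-≤ (λ (γ , ys) → ≤-trans (≤-reflexive (cong (siz (list (nat ⊗ A))) (eq ys))) (bound ys))
      (pb-+ p (pb-* p (pb-+ (pb-const 3) (pb-+ p p))))))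
  (λ γ → enum (xs · γ)) (λ γ → eq (xs · γ))
  where
  p : PB (Γ ⊗ list A) (λ x → siz (list A) (proj₂ x))
  p = pb-sizeat π₂
  length-enum : ∀ (ys : List ⟦ A ⟧) → length (enum ys) ≡ length ys
  length-enum []       = refl
  length-enum (y ∷ ys) = cong suc (length-enum ys)
  eq : ∀ ys → foldr (λ x acc → (length acc , x) ∷ acc) [] ys ≡ enum ys
  eq []       = refl
  eq (y ∷ ys) = cong₂ (λ l acc → (l , y) ∷ acc) (trans (cong length (eq ys)) (length-enum ys)) (eq ys)
  bound′ : ∀ ys m → length ys ≤ m → siz (list (nat ⊗ A)) (enum ys) ≤ siz (list A) ys + length ys * (3 + (m + m))
  bound′ []       m _ = s≤s z≤n
  bound′ (y ∷ ys) m h = ≤-trans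
    (s≤s (+-mono-≤ (s≤s (+-monoˡ-≤ (siz A y) (≤-trans (≤-reflexive (siz-nat (length ys)))
      (s≤s (+-mono-≤ h′ h′))))) (bound′ ys m h′)))
    (≤-trans (n≤1+n _) (≤-reflexive (re (siz A y) (siz (list A) ys) (length ys * (3 + (m + m))) m)))
    where
    h′ = ≤-trans (n≤1+n _) h
    re : ∀ y l r m → 1 + (1 + (1 + (1 + (m + m)) + y + (l + r))) ≡ 1 + (y + l) + (3 + (m + m) + r)
    re = solve-∀
  bound : ∀ ys → siz (list (nat ⊗ A)) (enum ys) ≤ siz (list A) ys + siz (list A) ys *
    (3 + (siz (list A) ys + siz (list A) ys))
  bound ys = ≤-trans (bound′ ys _ (length≤siz ys)) (+-monoʳ-≤ (siz (list A) ys) (*-monoˡ-≤ _ (length≤siz ys)))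

RowT JobT InstanceT : Ty
RowT = list nat
JobT = list bin ⊗ bin ⊗ bin
InstanceT = list JobT ⊗ bool ⊗ bin

module ChoosePrograms where

  Env : Ty
  Env = list (list RowT) ⊗ RowT

  labelsₐ : Env ⟶ list nat
  labelsₐ = downFromₐ (lengthₐ π₁)

  itemsₐ : Env ⟶ list (nat ⊗ RowT)
  itemsₐ = as (concatMapₐ (enumₐ π₁) (mapₐ (π₂ ⊚ π₂) (π₁ ⊚ π₂ ⊚ π₁ ,ₐ π₂))) (λ (cs , T) → items cs) (λ _ → refl)

  targetₐ : Env ⟶ RowT
  targetₐ = appendₐ π₂ (mapₐ labelsₐ (constₐ 1))

  bodyₐ : Env ⊗ (nat ⊗ RowT) ⟶ RowT
  bodyₐ = as (appendₐ (π₂ ⊚ π₂) (mapₐ (labelsₐ ⊚ π₁) (indicatorₐ (eqNatₐ π₂ (π₁ ⊚ π₂ ⊚ π₁)))))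
    (λ ((cs , T) , x) → Choose.body cs T x) (λ _ → refl)

  Lₐ : Env ⟶ nat
  Lₐ = as (plusₐ (plusₐ (lengthₐ π₁) (lengthₐ π₁))
                 (plusₐ (sumₐ (mapₐ itemsₐ (sumₐ (consₐ (constₐ 1) bodyₐ)))) (sumₐ targetₐ)))
    (λ (cs , T) → Choose.L cs T) (λ _ → refl)

  weightₐ dueₐ : Env ⊗ (nat ⊗ RowT) ⟶ bin
  weightₐ = as (numₐ (Lₐ ⊚ π₁) (consₐ (constₐ 1) bodyₐ)) (λ ((cs , T) , x) → Choose.weightOf cs T x)
    (λ _ → refl)
  dueₐ = as (numₐ (Lₐ ⊚ π₁) (consₐ (plusₐ (lengthₐ (π₁ ⊚ π₁)) (sucₐ (π₁ ⊚ π₂))) (targetₐ ⊚ π₁)))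
    (λ ((cs , T) , x) → Choose.dueOf cs T x) (λ _ → refl)

  rawJob : (cs : List (List Row)) (T : Row) → ℕ × Row → ⟦ JobT ⟧
  rawJob cs T x = Choose.weightOf cs T x ∷ 1 ∷ [] , Choose.dueOf cs T x , Choose.weightOf cs T x

  rawInstance : (cs : List (List Row)) (T : Row) → ⟦ InstanceT ⟧
  rawInstance cs T = map (rawJob cs T) (items cs) , true , num (Choose.L cs T) (0 ∷ T ++ Choose.ones cs T)

  instanceₐ : Env ⟶ InstanceT
  instanceₐ = as
    (mapₐ itemsₐ (consₐ weightₐ (consₐ (constₐ 1) (constₐ [])) ,ₐ dueₐ ,ₐ weightₐ) ,ₐ
      constₐ true ,ₐ numₐ Lₐ (consₐ (constₐ 0) targetₐ))
    (λ (cs , T) → rawInstance cs T) (λ _ → refl)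

  enc-instance : ∀ cs T → enc InstanceT (rawInstance cs T) ≡ ParamProblem.code (JITFlowShop 2)
    (Choose.instance′ cs T)
  enc-instance cs T = cong (_∙ (encodeBool true ∙ encodeℕ
    (num (Choose.L cs T) (0 ∷ T ++ Choose.ones cs T)))) (jobs (items cs))
    where
    jobs : ∀ xs → enc (list JobT) (map (rawJob cs T) xs) ≡ encodeVec encodeJob
      (Vec.map (Choose.mkJob cs T) (fromList xs))
    jobs []       = refl
    jobs (x ∷ xs) = cong (enc JobT (rawJob cs T x) ∙_) (jobs xs)

module _ (d : ℕ) where
  open EncodingPrograms d

  shop : ⟦ Env ⟧ → FlowShop 2
  shop ((k , n) , (P , Q)) = Choose.instance′ (Encoding.classes d n k P Q) (Encoding.target d n k P Q)

  shopₐ : Env ⟶ InstanceT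
  shopₐ = ChoosePrograms.instanceₐ ⊚ (classesₐ ,ₐ targetₐ)

  enc-shop : ∀ x → enc InstanceT (shopₐ · x) ≡ ParamProblem.code (JITFlowShop 2) (shop x)
  enc-shop ((k , n) , (P , Q)) = ChoosePrograms.enc-instance (Encoding.classes d n k P Q)
    (Encoding.target d n k P Q)

-- Conversion of binary numbers to unary

siz-bin-linear : ∀ n → siz bin n ≤ suc (4 * n)
siz-bin-linear n = siz-bin≤ n n (n<2^n n)

module ToUnary where

  stepₐ : bin ⊗ (bool ⊗ nat) ⟶ nat
  stepₐ = ifₐ (π₁ ⊚ π₂) (sucₐ (plusₐ acc acc)) (sucₐ (sucₐ (plusₐ acc acc)))
    where
    acc : bin ⊗ (bool ⊗ nat) ⟶ nat
    acc = π₂ ⊚ π₂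

  module F = Foldr (arr stepₐ) (arr bitsₐ) (constᶜ {nat} {bin} 0)

  fold-value : ∀ k bs → F.result k bs ≡ value bs
  fold-value k []           = refl
  fold-value k (true ∷ bs)  = trans (cong (λ v → suc (v + v)) (fold-value k bs)) (eq (value bs))
    where
    eq : ∀ v → 1 + (v + v) ≡ 1 + 2 * v
    eq = solve-∀
  fold-value k (false ∷ bs) = trans (cong (λ v → suc (suc (v + v))) (fold-value k bs)) (eq (value bs))
    where
    eq : ∀ v → 2 + (v + v) ≡ 2 * (1 + v)
    eq = solve-∀

  unsealedᶜ : bin ⇀ nat
  unsealedᶜ = asᶜ F.foldrᶜ id (λ k → trans (fold-value k (digits k)) (value-digits k))

  pb-bin : PB nat (siz bin)
  pb-bin = pb-≤ siz-bin-linear (pb-suc (pb-* (pb-const 4) (pb-natat idₐ)))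

  pb-nat : PB nat id
  pb-nat = pb-natat idₐ

  S : ℕ → ℕ
  S k = siz bin k + siz bin k + suc (k + k)

  -- The remaining digits turn the accumulator into k, and no step decreases it, so it never exceeds
  -- k.
  main≤ : ∀ c → (∀ x → time (arr stepₐ) x ≤ suc (siz (bin ⊗ (bool ⊗ nat)) x) ^ c) → ∀ k →
          F.mainTime k ≤ loopBound (length (reverse (digits k))) (S k)
            (suc (suc (siz bin k + suc (3 + suc (k + k)))) ^ c)
  main≤ c step≤ k = L.loopTime≤ I (S k) (suc (suc (siz bin k + suc (3 + suc (k + k)))) ^ c) (λ { (e , h) → e , ≤-trans (m≤n⇒m≤1+n (m≤n+m _ _)) h })
    (λ {ys} {acc} (e , h) → +-mono-≤ (+-monoʳ-≤ (siz bin k) h) (acc-size ys e))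
    (λ {x} {xs} {acc} (e , h) → ≤-trans (step≤ (k , x , acc)) (^-monoˡ-≤ c
      (s≤s (s≤s (+-monoʳ-≤ (siz bin k) (s≤s (+-mono-≤ (bit x) (acc-size (x ∷ xs) e))))))))
    (reverse (digits k)) 0
    (trans (reverse-foldl L.step 0 (digits k)) (trans (fold-value k (digits k)) (value-digits k)) ,
     ≤-trans (≤-reflexive (siz-reverse (digits k))) (≤-reflexive (cong size (sym (enc-digits k)))))
    where
    module L = Loop (arr stepₐ) k
    I : List Bool → ℕ → Set
    I ys acc = foldl L.step acc ys ≡ k × siz (list bool) ys ≤ siz bin k
    bit : ∀ b → siz bool b ≤ 3
    bit true  = ≤-refl
    bit false = s≤s z≤n
    grows : ∀ acc b → acc ≤ L.step acc b
    grows acc true  = m≤n⇒m≤1+n (m≤m+n acc acc)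
    grows acc false = m≤n⇒m≤1+n (m≤n⇒m≤1+n (m≤m+n acc acc))
    acc≤ : ∀ ys acc → acc ≤ foldl L.step acc ys
    acc≤ []       acc = ≤-refl
    acc≤ (y ∷ ys) acc = ≤-trans (grows acc y) (acc≤ ys (L.step acc y))
    acc-size : ∀ ys {acc} → foldl L.step acc ys ≡ k → siz nat acc ≤ suc (k + k)
    acc-size ys {acc} e = ≤-trans (≤-reflexive (siz-nat acc)) (s≤s (+-mono-≤ acc≤k acc≤k))
      where
      acc≤k : acc ≤ k
      acc≤k = ≤-trans (acc≤ ys acc) (≤-reflexive e)

  -- The output is exponentially larger than the binary argument, so the time is measured in the
  -- number itself, as `PB nat` says. The decision procedure can afford it, since it converts only
  -- the weight, which is the parameter.
  cost : ∀ c → (∀ x → time (arr stepₐ) x ≤ suc (siz (bin ⊗ (bool ⊗ nat)) x) ^ c) → PB nat (time unsealedᶜ)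
  cost c step≤ = pb-≤ (λ k → ≤-trans (proj₂ (proj₂ total) k)
    (≤-reflexive (*-identityˡ (proj₁ total k)))) (proj₁ (proj₂ total))
    where
    module K = F.Cost {nat} id pb-bin pb-bin
    step M : ℕ → ℕ
    step k = suc (suc (siz bin k + suc (3 + suc (k + k)))) ^ c
    M k = loopBound (length (reverse (digits k))) (S k) (step k)
    pbS : PB nat S
    pbS = pb-+ (pb-+ pb-bin pb-bin) (pb-suc (pb-+ pb-nat pb-nat))
    pbF : PB nat step
    pbF = pb-^ c (pb-suc (pb-suc (pb-+ pb-bin (pb-suc (pb-+ (pb-const 3) (pb-suc (pb-+ pb-nat pb-nat)))))))
    pbM : PB nat M
    pbM = pb-loopBound
      (pb-≤ (λ k → ≤-trans (≤-reflexive (length-reverse (digits k)))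
        (≤-trans (length≤siz (digits k)) (≤-reflexive (cong size (sym (enc-digits k)))))) pb-bin)
      pbS pbF
    total : ∃[ t ] PB nat t × (∀ k → F.foldrTime k ≤ 1 * t k)
    total = K.total (pb-≤ (λ k → treeTime≤ nil (siz bin k)) (pb-* (pb-const 1) (pb-suc pb-bin)))
      (pb-≤ (λ k → ≤-reflexive (trans (cong (siz nat)
        (trans (fold-value k (digits k)) (value-digits k))) (siz-nat k))) (pb-suc (pb-+ pb-nat pb-nat)))
      (λ _ → 1) M (λ _ → ≤-refl) pbM
      (λ k → ≤-trans (main≤ c step≤ k) (≤-reflexive (sym (*-identityˡ (M k)))))

  abstract
    sealedᶜ : bin ⇀ nat
    sealedᶜ = unsealedᶜ

    sealed-fun : ∀ k → fun sealedᶜ k ≡ k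
    sealed-fun k = refl

    toUnary-cost : PB nat (time sealedᶜ)
    toUnary-cost = cost (deg (poly stepₐ)) (bnd (poly stepₐ))

  toUnaryᶜ : bin ⇀ nat
  toUnaryᶜ = asᶜ sealedᶜ id sealed-fun

open ToUnary using (toUnaryᶜ; toUnary-cost; pb-bin)

-- Computable functions on unary numbers

binₐ : nat ⟶ bin
binₐ = as (addBinₐ idₐ (constₐ 0)) id +-identityʳ

-- A factor depending on the parameter only has to be computable, so the cost of changing notation
-- is irrelevant here.
onUnary : ∀ {f} → Computable f → nat ⇀ nat
onUnary {f} (p , comp) = asᶜ (toUnaryᶜ ∘ᶜ onBinary ∘ᶜ arr binₐ) f (λ _ → refl)
  where
  onBinary : bin ⇀ bin
  onBinary = record { fun = f ; prog = p ; time = λ n → proj₁ (comp n) ; run = λ n → proj₂ (comp n) }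

computable : (f : nat ⇀ nat) → Computable (fun f)
computable f = prog g , λ n → time g n , run g n
  where
  g : bin ⇀ bin
  g = arr binₐ ∘ᶜ f ∘ᶜ toUnaryᶜ

plusᶜ timesᶜ : nat ⇀ nat → nat ⇀ nat → nat ⇀ nat
plusᶜ f g = arr (plusₐ {nat ⊗ nat} π₁ π₂) ∘ᶜ pairᶜ f g
timesᶜ f g = arr (timesₐ {nat ⊗ nat} π₁ π₂) ∘ᶜ pairᶜ f g

powᶜ : nat ⇀ nat → ℕ → nat ⇀ nat
powᶜ f zero    = constᶜ 1
powᶜ f (suc c) = timesᶜ f (powᶜ f c)

powᶜ-^ : ∀ f c n → fun (powᶜ f c) n ≡ fun f n ^ c
powᶜ-^ f zero    n = refl
powᶜ-^ f (suc c) n = cong (fun f n *_) (powᶜ-^ f c n)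

-- A computable majorant that applies to every argument up to n: the parameter of a constructed
-- instance is known only through an upper bound.
sumToᶜ : nat ⇀ nat → nat ⇀ nat
sumToᶜ f = asᶜ
  (foldrᶜ (plusᶜ′ (f ∘ᶜ arr (π₁ ⊚ π₂)) (arr (π₂ ⊚ π₂))) (arr (downFromₐ (sucₐ idₐ))) (constᶜ 0))
  (λ n → sum (map (fun f) (downFrom (suc n)))) (λ n → eq (downFrom (suc n)))
  where
  plusᶜ′ : nat ⊗ (nat ⊗ nat) ⇀ nat → nat ⊗ (nat ⊗ nat) ⇀ nat → nat ⊗ (nat ⊗ nat) ⇀ nat
  plusᶜ′ g h = arr (plusₐ {nat ⊗ nat} π₁ π₂) ∘ᶜ pairᶜ g h
  eq : ∀ is → foldr (λ i acc → fun f i + acc) 0 is ≡ sum (map (fun f) is)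
  eq []       = refl
  eq (i ∷ is) = cong (fun f i +_) (eq is)

≤sumTo : ∀ f {i n} → i ≤ n → fun f i ≤ fun (sumToᶜ f) n
≤sumTo f {i} {n} i≤n = All.lookup (all≤sum (map (fun f) (downFrom (suc n))))
  (∈-map⁺ (fun f) (∈-downFrom⁺ (s≤s i≤n)))

*-^ : ∀ m n o → (m * n) ^ o ≡ m ^ o * n ^ o
*-^ m n zero    = refl
*-^ m n (suc o) = trans (cong (m * n *_) (*-^ m n o)) (eq m n (m ^ o) (n ^ o))
  where
  eq : ∀ m n a b → m * n * (a * b) ≡ m * a * (n * b)
  eq = solve-∀

-- Composition with a parameterized reduction

compose-bound : ∀ c₁ c₂ {a b s t₁ t₂ j x} → 1 ≤ s → t₁ ≤ a * s ^ c₁ → j ≤ t₁ → t₂ ≤ x * j ^ c₂ → x ≤ b →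
        suc (t₁ + t₂) ≤ (1 + (a + b * a ^ c₂)) * s ^ (c₁ + c₁ * c₂)
compose-bound c₁ c₂ {a} {b} {s} {t₁} {t₂} {j} {x} 1≤s h₁ j≤ h₂ x≤ = begin
  1 + (t₁ + t₂)                                    ≤⟨ +-mono-≤
    (^-mono {s} {s} {0} {c₁ + c₁ * c₂} 1≤s ≤-refl z≤n) (+-mono-≤
      (≤-trans h₁ (*-monoʳ-≤ a (^-mono 1≤s ≤-refl (m≤m+n c₁ (c₁ * c₂))))) step) ⟩
  σ + (a * σ + b * a ^ c₂ * σ)                     ≡⟨ eq a (b * a ^ c₂) σ ⟩
  (1 + (a + b * a ^ c₂)) * σ                       ∎
  where
  open ≤-Reasoning
  σ = s ^ (c₁ + c₁ * c₂)
  eq : ∀ a m σ → σ + (a * σ + m * σ) ≡ (1 + (a + m)) * σ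
  eq = solve-∀
  step : t₂ ≤ b * a ^ c₂ * σ
  step = begin
    t₂                                ≤⟨ h₂ ⟩
    x * j ^ c₂                        ≤⟨ *-mono-≤ x≤ (^-monoˡ-≤ c₂ (≤-trans j≤ h₁)) ⟩
    b * (a * s ^ c₁) ^ c₂             ≡⟨ cong (b *_) (trans (*-^ a (s ^ c₁) c₂)
      (cong (a ^ c₂ *_) (^-*-assoc s c₁ c₂))) ⟩
    b * (a ^ c₂ * s ^ (c₁ * c₂))      ≡⟨ sym (*-assoc b (a ^ c₂) _) ⟩
    b * a ^ c₂ * s ^ (c₁ * c₂)        ≤⟨ *-monoʳ-≤ (b * a ^ c₂) (^-mono 1≤s ≤-refl (m≤n+m (c₁ * c₂) c₁)) ⟩
    b * a ^ c₂ * σ                    ∎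

compose-cost : ∀ c₁ c₂ (u₁ u₂ : nat ⇀ nat) → Σ (nat ⇀ nat) λ F → ∀ k {s t₁ t₂ j i} → 1 ≤ s →
               t₁ ≤ fun u₁ k * s ^ c₁ → j ≤ t₁ → t₂ ≤ fun u₂ i * j ^ c₂ → i ≤ fun u₁ k →
               suc (t₁ + t₂) ≤ fun F k * s ^ (c₁ + c₁ * c₂)
compose-cost c₁ c₂ u₁ u₂ = F , λ k {s} 1≤s h₁ j≤ h₂ i≤ →
  ≤-trans (compose-bound c₁ c₂ {fun u₁ k} 1≤s h₁ j≤ h₂ (≤sumTo u₂ i≤))
    (≤-reflexive (cong (_* s ^ (c₁ + c₁ * c₂)) (sym (F≡ k))))
  where
  F : nat ⇀ nat
  F = plusᶜ (constᶜ 1) (plusᶜ u₁ (timesᶜ (sumToᶜ u₂ ∘ᶜ u₁) (powᶜ u₁ c₂)))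
  F≡ : ∀ k → fun F k ≡ 1 + (fun u₁ k + fun (sumToᶜ u₂) (fun u₁ k) * fun u₁ k ^ c₂)
  F≡ k = cong (λ z → 1 + (fun u₁ k + fun (sumToᶜ u₂) (fun u₁ k) * z)) (powᶜ-^ u₁ c₂ k)

FPT-reduces : ∀ {P Q} → P ≤fpt Q → FPT Q → FPT P
FPT-reduces {P} {Q} (pr , f₁ , c₁ , comp₁ , red) (pq , f₂ , c₂ , comp₂ , sol) =
  solve (proj₁ composed) (proj₂ composed)
  where
  composed = compose-cost c₁ c₂ (onUnary {f₁} comp₁) (onUnary {f₂} comp₂)
  solve : (F : nat ⇀ nat) → (∀ k {s t₁ t₂ j i} → 1 ≤ s → t₁ ≤ f₁ k * s ^ c₁ → j ≤ t₁ → t₂ ≤ f₂ i * j ^ c₂ → i ≤ f₁ k →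
                             suc (t₁ + t₂) ≤ fun F k * s ^ (c₁ + c₁ * c₂)) → FPT P
  solve F cost = (pr ⨾ pq) , fun F , c₁ + c₁ * c₂ , computable F , λ I →
    let J , t₁ , run₁ , t₁≤ , param≤ , equiv = red I
        dec , t₂ , run₂ , t₂≤ = sol J
    in map′ (Equivalence.to equiv) (Equivalence.from equiv) dec , suc (t₁ + t₂) , ⇓seq run₁ run₂ ,
       cost (param P I) (size>0 (code P I)) t₁≤ (out≤time run₁) t₂≤ param≤

JIT₂ : ParamProblem
JIT₂ = restrict (JITFlowShop 2) UnitOnSecondMachine

-- The reduction from weighted satisfiability

unary-toℕ : ∀ {m} (i : Fin m) → unary (toℕ i) ≡ encodeFin i
unary-toℕ zero    = refl
unary-toℕ (suc i) = cong (nil ∙_) (unary-toℕ i)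

enc-gate : ∀ {m} (g : Gate (Fin m)) → encGate (just (mapGate toℕ g)) ≡ encodeGate g
enc-gate (notᵍ i)  = cong (nil ∙_) (unary-toℕ i)
enc-gate (andᵍ is) = cong ((nil ∙ nil) ∙_) (operands-enc is)
  where
  operands-enc : ∀ {m} (is : List (Fin m)) → encodeList unary (map toℕ is) ≡ encodeList encodeFin is
  operands-enc []       = refl
  operands-enc (i ∷ is) = cong₂ _∙_ (unary-toℕ i) (operands-enc is)
enc-gate (orᵍ is)  = cong ((nil ∙ nil ∙ nil) ∙_) (operands-enc is)
  where
  operands-enc : ∀ {m} (is : List (Fin m)) → encodeList unary (map toℕ is) ≡ encodeList encodeFin is
  operands-enc []       = refl
  operands-enc (i ∷ is) = cong₂ _∙_ (unary-toℕ i) (operands-enc is)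

enc-nodes : ∀ {n m} (C : Circuit n m) → enc (list gate) (nodes C) ≡ encodeCircuit C
enc-nodes {n} inputs = go n
  where
  go : ∀ n → encodeList encGate (replicate n nothing) ≡ encodeVec (λ x → x) (Vec.replicate n nil)
  go zero    = refl
  go (suc n) = cong (nil ∙_) (go n)
enc-nodes (C ▷ g) = cong₂ _∙_ (enc-gate g) (enc-nodes C)

-- The equations depend on the number of inputs, which the code of a circuit does not state
-- explicitly.
countInputs : List NGate → ℕ
countInputs C = length (concatMap (λ g → if proj₁ g then [ tt ] else []) C)

countInputs-nodes : ∀ {n m} (C : Circuit n m) → countInputs (normalised C) ≡ n
countInputs-nodes {n} inputs = go n
  where
  go : ∀ n → countInputs (map normalise (replicate n nothing)) ≡ n
  go zero    = refl
  go (suc n) = cong suc (go n)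
countInputs-nodes (C ▷ notᵍ _) = countInputs-nodes C
countInputs-nodes (C ▷ andᵍ _) = countInputs-nodes C
countInputs-nodes (C ▷ orᵍ _)  = countInputs-nodes C

CircuitT InputT UnaryT : Ty
CircuitT = list gate
InputT = CircuitT ⊗ nat ⊗ bin
UnaryT = CircuitT ⊗ nat ⊗ nat

-- The instances agree as values of InputT and of UnaryT; only the encoding of
-- the weight changes.
prepareᶜ : InputT ⇀ UnaryT
prepareᶜ = pairᶜ (arr π₁) (pairᶜ (arr π₁ ∘ᶜ arr π₂) (toUnaryᶜ ∘ᶜ arr π₂ ∘ᶜ arr π₂))

prepare-cost : PB UnaryT (time prepareᶜ)
prepare-cost = pb-suc (pb-+ pbI (pb-suc (pb-+ (pb-suc (pb-+ pbI pb₂))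
  (pb-suc (pb-+ (pb-suc (pb-+ pbI pb₂)) (pb-at weightₐ toUnary-cost))))))
  where
  weightₐ : UnaryT ⟶ nat
  weightₐ = π₂ ⊚ π₂
  pb₂ : PB UnaryT (λ x → siz (nat ⊗ bin) (proj₂ x))
  pb₂ = pb-suc (pb-+ (pb-sizeat {A = UnaryT} (π₁ ⊚ π₂)) (pb-at weightₐ pb-bin))
  pbI : PB UnaryT (siz InputT)
  pbI = pb-suc (pb-+ (pb-sizeat {A = UnaryT} π₁) pb₂)

module _ (d : ℕ) where

  TaskT : Ty
  TaskT = (nat ⊗ nat) ⊗ list (SPolyT d)

  stageₐ : UnaryT ⟶ TaskT
  stageₐ = ((π₂ ⊚ π₂) ,ₐ lengthₐ (concatMapₐ circuitₐ (ifₐ (π₁ ⊚ π₂) (constₐ [ tt ]) (constₐ []))))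
           ,ₐ (call (dnfI d d) ⊚ (dropₐ (π₁ ⊚ π₂) circuitₐ ,ₐ constₐ true))
    where
    circuitₐ : UnaryT ⟶ list NGateT
    circuitₐ = mapₐ π₁ (normaliseₐ ⊚ π₂)

  slotsBound : nat ⇀ nat
  slotsBound = arr (as (plusₐ idₐ (lengthₐ (tuplesₐ d (sucₐ idₐ))))
    (λ k → k + length (tuples d (suc k))) (λ _ → refl))

  classes-length : ∀ n k P Q → length (Encoding.classes d n k P Q) ≡ fun slotsBound k
  classes-length n k P Q = trans (length-++ (Encoding.slotClasses d n k P Q))
    (cong₂ _+_ (trans (length-map _ (downFrom k)) (length-downFrom k)) (length-map _ (tuples d (suc k))))

  shop-param : ∀ k n PQ → FlowShop.#dueDates (shop d ((k , n) , PQ)) ≤ fun slotsBound k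
  shop-param k n (P , Q) = ≤-trans (Choose.#dueDates≤ (Encoding.classes d n k P Q)
    (Encoding.target d n k P Q)) (≤-reflexive (classes-length n k P Q))

  EnvT : Ty
  EnvT = EncodingPrograms.Env d

  unitary : ∀ x → UnitOnSecondMachine (shop d x)
  unitary ((k , n) , (P , Q)) = Choose.unit₂ (Encoding.classes d n k P Q) (Encoding.target d n k P Q)

  shop-yes : ∀ k n p → (Yes (JITFlowShop 2) (shop d ((k , n) , p)) → Solvable d n k p) ×
                       (Solvable d n k p → Yes (JITFlowShop 2) (shop d ((k , n) , p)))
  shop-yes k n (P , Q) =
    (λ y → E.decode (Ch.yes⇒choice E.w E.widths E.target-width y)) ,
    (λ (δs , g , v) → Ch.choice⇒yes E.w E.widths E.target-width (E.encode δs g v))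
    where
    module E = Encoding d n k P Q
    module Ch = Choose E.classes E.target

  module Decide (p : Prog) (u : nat ⇀ nat) (c : ℕ)
                (sol : ∀ I → Σ (Dec (Yes JIT₂ I)) λ answer → ∃[ t ]
                       (p ⊢ code JIT₂ I ⇓ encodeBool (does answer) [ t ]) ×
                       t ≤ fun u (param JIT₂ I) * ∥_∥ JIT₂ I ^ c) where

    instanceOf : ⟦ EnvT ⟧ → Instance JIT₂
    instanceOf x = shop d x , unitary x

    solves : ⟦ EnvT ⟧ → Bool
    solves x = does (proj₁ (sol (instanceOf x)))

    solves⇔ : ∀ k n q → (solves ((k , n) , q) ≡ true → Solvable d n k q) ×
      (Solvable d n k q → solves ((k , n) , q) ≡ true)
    solves⇔ k n q = go (proj₁ (sol (instanceOf ((k , n) , q)))) (shop-yes k n q)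
      where
      go : ∀ {Y X : Set} (dec : Dec Y) → (Y → X) × (X → Y) → (does dec ≡ true → X) × (X → does dec ≡ true)
      go (yes y) (to , from) = (λ _ → to y) , (λ _ → refl)
      go (no ¬y) (to , from) = (λ ()) , (λ x → contradiction (from x) ¬y)

    oracleTime : ⟦ EnvT ⟧ → ℕ
    oracleTime x = proj₁ (proj₂ (sol (instanceOf x)))

    oracleᶜ : EnvT ⇀ bool
    oracleᶜ = record
      { fun  = solves
      ; prog = prog (arr (shopₐ d)) ⨾ p
      ; time = λ x → suc (time (arr (shopₐ d)) x + oracleTime x)
      ; run  = λ x → ⇓seq (subst (λ y → prog (arr (shopₐ d)) ⊢ enc EnvT x ⇓ y [ time
        (arr (shopₐ d)) x ]) (enc-shop d x) (run (arr (shopₐ d)) x))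
                          (proj₁ (proj₂ (proj₂ (sol (instanceOf x)))))
      }

    -- The given time bound need not be monotone, so it is summed over all numbers
    -- of due dates that may occur for weight k.
    factor : ℕ → ℕ
    factor k = suc (fun (sumToᶜ u ∘ᶜ slotsBound) k)

    shopSize : ⟦ EnvT ⟧ → ℕ
    shopSize x = siz InstanceT (shopₐ d · x)

    oracleTime≤ : ∀ k n q → oracleTime ((k , n) , q) ≤ factor k * shopSize ((k , n) , q) ^ c
    oracleTime≤ k n q = ≤-trans (proj₂ (proj₂ (proj₂ (sol (instanceOf ((k , n) , q))))))
      (*-mono-≤ (m≤n⇒m≤1+n (≤sumTo u (shop-param k n q)))
        (≤-reflexive (cong (λ t → size t ^ c) (sym (enc-shop d ((k , n) , q))))))

    orₐ : bool ⊗ bool ⟶ bool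
    orₐ = as (ifₐ π₁ (constₐ true) π₂) (λ (a , b) → a ∨ b) (λ { (true , _) → refl ; (false , _) → refl })

    StepT : Ty
    StepT = TaskT ⊗ (SPolyT d ⊗ bool)

    argₐ : StepT ⟶ EnvT
    argₐ = (π₁ ⊚ π₁) ,ₐ (π₁ ⊚ π₂)

    accₐ : StepT ⟶ bool
    accₐ = π₂ ⊚ π₂

    stepᶜ : StepT ⇀ bool
    stepᶜ = arr orₐ ∘ᶜ pairᶜ (oracleᶜ ∘ᶜ arr argₐ) (arr accₐ)

    stepShape : ℕ → ℕ → ℕ → ℕ → ℕ → ℕ
    stepShape a s t b o = suc (suc (suc (a + suc (s + t)) + b) + o)

    stepBound : ⟦ StepT ⟧ → ℕ
    stepBound x = stepShape (time (arr argₐ) x) (time (arr (shopₐ d)) (argₐ · x)) (shopSize (argₐ · x) ^ c)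
                            (time (arr accₐ) x) (time (arr orₐ) (solves (argₐ · x) , accₐ · x))

    -- Only the time t of the oracle exceeds a polynomial. As the factor is at least 1, it can be
    -- pulled out of the whole sum, which leaves a polynomial.
    step-weigh : ∀ w a s {t m} b o → 1 ≤ w → t ≤ w * m → stepShape a s t b o ≤ w * stepShape a s m b o
    step-weigh (suc w) a s {t} {m} b o _ h = ≤-trans
      (s≤s (+-monoˡ-≤ o (s≤s (+-monoˡ-≤ b (s≤s (+-monoʳ-≤ a (s≤s (+-monoʳ-≤ s h))))))))
      (≤-trans (m≤m+n _ (w * (4 + a + s + b + o))) (≤-reflexive (eq w a s m b o)))
      where
      eq : ∀ w a s m b o → 1 + ((1 + ((1 + (a + (1 + (s + (m + w * m))))) + b)) + o) + w * (4 + a + s + b + o) ≡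
                           (1 + w) * (1 + ((1 + ((1 + (a + (1 + (s + m)))) + b)) + o))
      eq = solve-∀

    pb-stepBound : PB StepT stepBound
    pb-stepBound = pb-suc (pb-+ (pb-suc (pb-+ (pb-suc
      (pb-+ (poly argₐ) (pb-suc (pb-+ (pb-at argₐ (poly (shopₐ d)))
      (pb-^ c (pb-at argₐ (pb-sizeat (shopₐ d)))))))) (poly accₐ))) or-cost)
      where
      or-cost : PB StepT (λ x → time (arr orₐ) (solves (argₐ · x) , accₐ · x))
      or-cost = pb-∘ {f = λ x → solves (argₐ · x) , accₐ · x} (poly orₐ)
        (pb-≤ (λ x → s≤s (+-mono-≤ (bit (solves (argₐ · x))) (bit (accₐ · x)))) (pb-const 7))
        where
        bit : ∀ b → siz bool b ≤ 3
        bit true  = ≤-refl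
        bit false = s≤s z≤n

    anyᶜ : TaskT ⇀ bool
    anyᶜ = foldrᶜ stepᶜ (arr π₂) (constᶜ false)

    weightOf : ⟦ TaskT ⟧ → ℕ
    weightOf ((k , n) , _) = factor k

    -- All instances passed to the oracle in one run share k, hence one factor serves every
    -- iteration of the loop.
    any-cost : ∃[ t ] PB TaskT t × (∀ x → time anyᶜ x ≤ weightOf x * t x)
    any-cost = cost (deg pb-stepBound) (bnd pb-stepBound)
      where
      cost : ∀ e → (∀ x → stepBound x ≤ suc (siz StepT x) ^ e) → ∃[ t ] PB TaskT t ×
        (∀ x → time anyᶜ x ≤ weightOf x * t x)
      cost e bound = Foldr.foldr-cost stepᶜ (arr π₂) (constᶜ false)
        (pb-≤ (λ (γ , ys) → bit (Foldr.result stepᶜ (arr π₂) (constᶜ false) γ ys)) (pb-const 3))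
        weightOf (λ _ → s≤s z≤n) e
        (λ ((k , n) , ps) q acc → let x = ((k , n) , ps) , q , acc in ≤-trans
          (step-weigh (factor k) (time (arr argₐ) x) (time (arr (shopₐ d)) (argₐ · x))
            {oracleTime (argₐ · x)} {shopSize (argₐ · x) ^ c}
            (time (arr accₐ) x) (time (arr orₐ) (solves (argₐ · x) , accₐ · x)) (s≤s z≤n) (oracleTime≤ k n q))
          (*-monoʳ-≤ (factor k) (bound x)))
        (poly (π₂ {nat ⊗ nat} {list (SPolyT d)})) (pb-≤ (λ x → treeTime≤ nil (siz TaskT x))
          (pb-* (pb-const 1) (pb-suc pb-size)))
        where
        bit : ∀ b → siz bool b ≤ 3
        bit true  = ≤-refl
        bit false = s≤s z≤n

    any⇔ : ∀ k n ps → (fun anyᶜ ((k , n) , ps) ≡ true → Any (Solvable d n k) ps) ×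
                      (Any (Solvable d n k) ps → fun anyᶜ ((k , n) , ps) ≡ true)
    any⇔ k n ps₀ = go ps₀
      where
      result : List (SPoly d) → Bool
      result = foldr (λ q acc → solves ((k , n) , q) ∨ acc) false
      cases : ∀ {X Y : Set} {b c} → (b ≡ true → X) × (X → b ≡ true) → (c ≡ true → Y) × (Y → c ≡ true) →
              (b ∨ c ≡ true → X ⊎ Y) × (X ⊎ Y → b ∨ c ≡ true)
      cases {b = true}  (f , _) _       = (λ _ → inj₁ (f refl)) , (λ _ → refl)
      cases {b = false} (_ , g) (f , h) = (λ e → inj₂ (f e)) , (λ { (inj₁ x) → contradiction (g x) λ () ; (inj₂ y) → h y })
      go : ∀ ps → (result ps ≡ true → Any (Solvable d n k) ps) × (Any (Solvable d n k) ps → result ps ≡ true)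
      go []       = (λ ()) , (λ ())
      go (q ∷ qs) = let to , from = cases (solves⇔ k n q) (go qs) in
        (λ e → Any.fromSum (to e)) , (λ a → from (Any.toSum a))

    decideᶜ : InputT ⇀ bool
    decideᶜ = anyᶜ ∘ᶜ arr stageₐ ∘ᶜ prepareᶜ

    decide-cost : ∃[ e ] ∀ x → time decideᶜ x ≤ factor (proj₂ (proj₂ x)) * suc (siz UnaryT x) ^ e
    decide-cost = go pb
      where
      total : ⟦ UnaryT ⟧ → ℕ
      total x = suc (suc (time prepareᶜ x + time (arr stageₐ) x) + proj₁ any-cost (stageₐ · x))
      pb : PB UnaryT total
      pb = pb-suc (pb-+ (pb-suc (pb-+ prepare-cost (poly stageₐ))) (pb-at stageₐ (proj₁ (proj₂ any-cost))))
      shape : ∀ w {a b t m} → 1 ≤ w → t ≤ w * m → suc (suc (a + b) + t) ≤ w * suc (suc (a + b) + m)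
      shape (suc w) {a} {b} {t} {m} _ h = ≤-trans (s≤s (+-monoʳ-≤ (suc (a + b)) h))
        (≤-trans (m≤m+n _ (w * (2 + a + b))) (≤-reflexive (eq w a b m)))
        where
        eq : ∀ w a b m → 1 + ((1 + (a + b)) + (m + w * m)) + w * (2 + a + b) ≡ (1 + w) *
          (1 + ((1 + (a + b)) + m))
        eq = solve-∀
      go : PB UnaryT total → ∃[ e ] ∀ x → time decideᶜ x ≤ factor (proj₂ (proj₂ x)) * suc (siz UnaryT x) ^ e
      go (e , bound) = e , λ x → ≤-trans
        (shape (factor (proj₂ (proj₂ x))) {time prepareᶜ x} {time (arr stageₐ) x} {time anyᶜ
          (stageₐ · x)} {proj₁ any-cost (stageₐ · x)}
          (s≤s z≤n) (proj₂ (proj₂ any-cost) (stageₐ · x)))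
        (*-monoʳ-≤ (factor (proj₂ (proj₂ x))) (bound x))

-- The algorithm for weighted circuit satisfiability

decFrom : ∀ {Y : Set} b → (b ≡ true → Y) × (Y → b ≡ true) → Σ (Dec Y) λ a → does a ≡ b
decFrom true  (to , _)    = yes (to refl) , refl
decFrom false (_ , from) = no (λ y → contradiction (from y) λ ()) , refl

module _ (d : ℕ) (p : Prog) (u : nat ⇀ nat) (c : ℕ)
         (sol : ∀ I → Σ (Dec (Yes JIT₂ I)) λ answer → ∃[ t ]
                (p ⊢ code JIT₂ I ⇓ encodeBool (does answer) [ t ]) ×
                t ≤ fun u (param JIT₂ I) * ∥_∥ JIT₂ I ^ c) where

  module De = Decide d p u c sol

  WCS : ParamProblem
  WCS = WeightedCircuitSat 1 d

  input : Instance WCS → ⟦ InputT ⟧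
  input I = nodes circuit , toℕ output , weight
    where open WeightedCircuit I

  enc-input : ∀ I → enc InputT (input I) ≡ code WCS I
  enc-input I = cong₂ (λ a b → a ∙ b ∙ encodeℕ weight) (enc-nodes circuit) (unary-toℕ output)
    where open WeightedCircuit I

  correct : ∀ I → (fun De.decideᶜ (input I) ≡ true → Yes WCS I) × (Yes WCS I → fun De.decideᶜ (input I) ≡ true)
  correct I =
    (λ e → satisfiable⇐ d weight circuit output depth≤ weft≤
      (subst (λ n → Any (Solvable d n weight) ps) n≡ (proj₁ any e))) ,
    (λ y → proj₂ any (subst (λ n → Any (Solvable d n weight) ps) (sym n≡)
      (satisfiable⇒ d weight circuit output depth≤ weft≤ y)))
    where
    open WeightedCircuit I
    ps = polynomials d weight circuit output depth≤ weft≤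
    n≡ = countInputs-nodes circuit
    any = De.any⇔ weight (countInputs (normalised circuit)) ps

  -- Writing k in unary enlarges an input by a factor of at most 3 + 2 * k. Its power with exponent
  -- e depends on k alone and joins the computable factor.
  budget : ∀ e → Σ (nat ⇀ nat) λ F → ∀ k {s} t → t ≤ s * (3 + (k + k)) → De.factor k * t ^ e ≤ fun F k * s ^ e
  budget e = F , λ k {s} t h → begin
    De.factor k * t ^ e                            ≤⟨ *-monoʳ-≤ (De.factor k) (^-monoˡ-≤ e h) ⟩
    De.factor k * (s * (3 + (k + k))) ^ e          ≡⟨ cong (De.factor k *_)
      (trans (*-^ s (3 + (k + k)) e) (*-comm (s ^ e) ((3 + (k + k)) ^ e))) ⟩
    De.factor k * ((3 + (k + k)) ^ e * s ^ e)      ≡⟨ sym (*-assoc (De.factor k) ((3 + (k + k)) ^ e) (s ^ e)) ⟩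
    De.factor k * (3 + (k + k)) ^ e * s ^ e        ≡⟨ cong (λ z → De.factor k * z * s ^ e)
      (sym (powᶜ-^ linear e k)) ⟩
    fun F k * s ^ e                                ∎
    where
    open ≤-Reasoning
    linear F : nat ⇀ nat
    linear = plusᶜ (constᶜ 3) (plusᶜ idᶜ idᶜ)
    F = timesᶜ (plusᶜ (constᶜ 1) (sumToᶜ u ∘ᶜ slotsBound d)) (powᶜ linear e)

  unary-size : ∀ C o k → suc (siz UnaryT (C , o , k)) ≤ siz InputT (C , o , k) * (3 + (k + k))
  unary-size C o k = ≤-trans
    (≤-reflexive (cong (λ z → suc (suc (siz CircuitT C + suc (siz nat o + z)))) (siz-nat k)))
    (go (siz CircuitT C) (siz nat o) (siz bin k))
    where
    go : ∀ a b β → 1 + (1 + (a + (1 + (b + (1 + (k + k)))))) ≤ (1 + (a + (1 + (b + β)))) * (3 + (k + k))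
    go a b β = ≤-trans (m≤m+n _ (2 + 2 * a + 2 * b + 3 * β + (1 + a + b + β) * (k + k)))
      (≤-reflexive (eq a b β (k + k)))
      where
      eq : ∀ a b β m → 1 + (1 + (a + (1 + (b + (1 + m))))) + (2 + 2 * a + 2 * b + 3 * β + (1 + a + b + β) * m) ≡
                       (1 + (a + (1 + (b + β)))) * (3 + m)
      eq = solve-∀

  FPT-circuits : FPT WCS
  FPT-circuits = solve De.decide-cost
    where
    solve : (∃[ e ] ∀ x → time De.decideᶜ x ≤ De.factor (proj₂ (proj₂ x)) * suc (siz UnaryT x) ^ e) → FPT WCS
    solve (e , cost) = prog De.decideᶜ , fun (proj₁ (budget e)) , e , computable (proj₁ (budget e)) , λ I →
      let x = input I
          dec , does≡ = decFrom (fun De.decideᶜ x) (correct I)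
      in dec , time De.decideᶜ x ,
         subst₂ (λ y b → prog De.decideᶜ ⊢ y ⇓ encodeBool b [ time De.decideᶜ x ]) (enc-input I)
           (sym does≡) (run De.decideᶜ x) ,
         ≤-trans (cost x)
           (≤-trans (proj₂ (budget e) (WeightedCircuit.weight I) (suc (siz UnaryT x))
             (unary-size (proj₁ x) (proj₁ (proj₂ x)) (proj₂ (proj₂ x))))
             (≤-reflexive (cong (λ y → fun (proj₁ (budget e)) (WeightedCircuit.weight I) * size y ^ e)
               (enc-input I))))

theorem1 : W[1]-hard (restrict (JITFlowShop 2) UnitOnSecondMachine)
theorem1 (p , f , c , comp , sol) Q (d , Q≤WCS) =
  FPT-reduces Q≤WCS (FPT-circuits d p (onUnary {f} comp) c sol)
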